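{- Let $n$ be a non-negative integer, and let $N$ and $M$ be the unique positive integers for which $$4n+1=N^2M$$ where $M$ is square-free. Then the following are true: (1) If $M=1$, then $ped_{ -2}(n)$ is odd. (2) If $M=p$ is a prime and $\mathrm{ord}_p(4n+1)\equiv 1\pmod 4$, then $ped_{ -2}(n)\equiv 2\pmod 4$. (3) If $M=p$ is a prime and $\mathrm{ord}_p(4n+1)\equiv 3\pmod 8$, then $ped_{ -2}(n)\equiv 4\pmod 8$. (4) If $M=p_1p_2$, where $p_1$ and $p_2$ are distinct primes with $p_i\equiv 1\pmod 4$ and $\mathrm{ord}_{p_i}(4n+1)\equiv 1\pmod 4$ for $i=1,2$, then $ped_{ -2}(n)\equiv 4\pmod 8$. (5) In all other cases, $ped_{ -2}(n)\equiv 0\pmod 8$.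
   Context: For an integer $n\ge 0$, $ped_{ -2}(n)$ denotes the number of bipartitions of $n$ with even parts distinct, i.e. the number of ordered pairs of partitions $(\lambda,\mu)$ with total size $|\lambda|+|\mu|=n$ such that in each of $\lambda$ and $\mu$ the even parts are distinct (odd parts are unrestricted). Its generating function is $$\sum_{n=0}^{\infty}ped_{ -2}(n)q^n=\prod_{m=1}^{\infty}\frac{(1-q^{4m})^2}{(1-q^m)^2}.$$ For a prime $p$ and a positive integer $k$, $\mathrm{ord}_p(k)$ denotes the exponent of the highest power of $p$ dividing $k$. -}

module Defs where

open import Data.List using (List; []; _∷_; filter; length; upTo; cartesianProduct; cartesianProductWith)
open import Data.List.Membership.Propositional using (_∈_)
open import Data.List.Membership.Propositional.Properties
  using (∈-filter⁺; ∈-filter⁻; ∈-upTo⁺; ∈-cartesianProduct⁺; ∈-cartesianProductWith⁺; ∈-cartesianProductWith⁻)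
open import Data.List.Properties using (∷-injective)
open import Data.List.Relation.Unary.All as All using (All; []; _∷_; all?)
open import Data.List.Relation.Unary.AllPairs using ([]; _∷_)
open import Data.List.Relation.Unary.Any using (here; there)
open import Data.List.Relation.Unary.Linked using (Linked; linked?)
open import Data.List.Relation.Unary.Unique.Propositional using (Unique)
import Data.List.Relation.Unary.Unique.Propositional.Properties as Unique
open import Data.Nat
  using (ℕ; zero; suc; _+_; _*_; _^_; _≤_; _<_; _≥_; z≤n; s≤s; _<?_; _≥?_; _≟_; _%_; NonZero; NonTrivial)
open import Data.Nat.Divisibility using (_∣_; _∣?_; ∣⇒≤; 1∣_)
open import Data.Nat.ListAction using (sum)
open import Data.Nat.Primality using (Prime)
open import Data.Nat.Properties
  using (≤-trans; <⇒≤; <-≤-trans; ≤∧≢⇒<; ≤-pred; +-mono-≤; m≤m+n; m≤n+m; m<m*n; m^n≢0; *-comm)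
open import Data.Product using (_×_; _,_; proj₂; ∃₂)
open import Data.List.Relation.Unary.Unique.DecPropositional _≟_ using (unique?)
open import Function.Bundles using (_⇔_; mk⇔)
open import Relation.Binary.PropositionalEquality using (_≡_; _≢_; refl; subst)
open import Relation.Nullary using (Dec; yes; no)
open import Relation.Nullary.Decidable using (_×-dec_)

-- A partition is the list of its parts, in weakly decreasing order.
IsPartition : List ℕ → Set
IsPartition xs = All (0 <_) xs × Linked _≥_ xs

EvenPartsDistinct : List ℕ → Set
EvenPartsDistinct xs = Unique (filter (2 ∣?_) xs)

IsPEDBipartition : ℕ → List ℕ × List ℕ → Set
IsPEDBipartition n (xs , ys) =
  (IsPartition xs × EvenPartsDistinct xs) ×
  (IsPartition ys × EvenPartsDistinct ys) ×
  sum xs + sum ys ≡ n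

isPEDBipartition? : ∀ n b → Dec (IsPEDBipartition n b)
isPEDBipartition? n (xs , ys) =
  ped? xs ×-dec (ped? ys ×-dec (sum xs + sum ys ≟ n))
  where
  ped? : ∀ zs → Dec (IsPartition zs × EvenPartsDistinct zs)
  ped? zs = (all? (0 <?_) zs ×-dec linked? _≥?_ zs) ×-dec unique? (filter (2 ∣?_) zs)

-- All lists of length at most l with entries at most n.
boundedLists : ℕ → ℕ → List (List ℕ)
boundedLists n zero    = [] ∷ []
boundedLists n (suc l) = [] ∷ cartesianProductWith _∷_ (upTo (suc n)) (boundedLists n l)

-- A partition of size at most n has at most n parts, each at most n, so the
-- search space below misses nothing; see ∈-pedBipartitions.
pedBipartitions : ℕ → List (List ℕ × List ℕ)
pedBipartitions n =
  filter (isPEDBipartition? n) (cartesianProduct (boundedLists n n) (boundedLists n n))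

ped₋₂ : ℕ → ℕ
ped₋₂ n = length (pedBipartitions n)

∈-boundedLists : ∀ {n} l xs → length xs ≤ l → All (_≤ n) xs → xs ∈ boundedLists n l
∈-boundedLists zero    []       _         _        = here refl
∈-boundedLists (suc l) []       _         _        = here refl
∈-boundedLists (suc l) (x ∷ xs) (s≤s len) (p ∷ ps) =
  there (∈-cartesianProductWith⁺ _∷_ (∈-upTo⁺ (s≤s p)) (∈-boundedLists l xs len ps))

boundedLists-unique : ∀ n l → Unique (boundedLists n l)
boundedLists-unique n zero    = [] ∷ []
boundedLists-unique n (suc l) =
  All.tabulate nonempty ∷
  Unique.cartesianProductWith⁺ _∷_ ∷-injective (Unique.upTo⁺ (suc n)) (boundedLists-unique n l)
  where
  nonempty : ∀ {xs} → xs ∈ cartesianProductWith _∷_ (upTo (suc n)) (boundedLists n l) → [] ≢ xs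
  nonempty xs∈ refl with ∈-cartesianProductWith⁻ _∷_ (upTo (suc n)) (boundedLists n l) xs∈
  ... | _ , _ , _ , _ , ()

length≤sum : ∀ {xs} → All (0 <_) xs → length xs ≤ sum xs
length≤sum []       = z≤n
length≤sum (p ∷ ps) = +-mono-≤ p (length≤sum ps)

parts≤sum : ∀ xs → All (_≤ sum xs) xs
parts≤sum []       = []
parts≤sum (x ∷ xs) = m≤m+n x (sum xs) ∷ All.map (λ y≤ → ≤-trans y≤ (m≤n+m (sum xs) x)) (parts≤sum xs)

∈-pedBipartitions : ∀ n b → b ∈ pedBipartitions n ⇔ IsPEDBipartition n b
∈-pedBipartitions n (xs , ys) = mk⇔
  (λ b∈ → proj₂ (∈-filter⁻ (isPEDBipartition? n) {xs = candidates} b∈))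
  (λ b@(((xs>0 , _) , _) , ((ys>0 , _) , _) , size) →
    ∈-filter⁺ (isPEDBipartition? n)
      (∈-cartesianProduct⁺
        (bounded xs xs>0 (subst (sum xs ≤_) size (m≤m+n (sum xs) (sum ys))))
        (bounded ys ys>0 (subst (sum ys ≤_) size (m≤n+m (sum ys) (sum xs)))))
      b)
  where
  candidates : List (List ℕ × List ℕ)
  candidates = cartesianProduct (boundedLists n n) (boundedLists n n)

  bounded : ∀ zs → All (0 <_) zs → sum zs ≤ n → zs ∈ boundedLists n n
  bounded zs zs>0 s≤n = ∈-boundedLists n zs (≤-trans (length≤sum zs>0) s≤n)
    (All.map (λ z≤ → ≤-trans z≤ s≤n) (parts≤sum zs))

pedBipartitions-unique : ∀ n → Unique (pedBipartitions n)
pedBipartitions-unique n = Unique.filter⁺ (isPEDBipartition? n)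
  (Unique.cartesianProduct⁺ (boundedLists-unique n n) (boundedLists-unique n n))

SquareFree : ℕ → Set
SquareFree m = ∀ d → d * d ∣ m → d ≡ 1

-- The largest e ≤ b such that p ^ e divides k.
ordUpTo : ℕ → ℕ → ℕ → ℕ
ordUpTo zero    p k = 0
ordUpTo (suc b) p k with p ^ suc b ∣? k
... | yes _ = suc b
... | no  _ = ordUpTo b p k

-- For p ≥ 2 and k ≥ 1, p ^ e ∣ k forces e < k, so the bound k loses nothing;
-- see ord-divides and ord-maximal.
ord : ℕ → ℕ → ℕ
ord p k = ordUpTo k p k

ordUpTo-divides : ∀ b p k → p ^ ordUpTo b p k ∣ k
ordUpTo-divides zero    p k = 1∣ k
ordUpTo-divides (suc b) p k with p ^ suc b ∣? k
... | yes d = d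
... | no  _ = ordUpTo-divides b p k

ordUpTo-maximal : ∀ b p k e → e ≤ b → p ^ e ∣ k → e ≤ ordUpTo b p k
ordUpTo-maximal zero    p k e e≤b d = e≤b
ordUpTo-maximal (suc b) p k e e≤b d with p ^ suc b ∣? k
... | yes _ = e≤b
... | no ¬d = ordUpTo-maximal b p k e (≤-pred (≤∧≢⇒< e≤b λ { refl → ¬d d })) d

n<p^n : ∀ p .{{_ : NonTrivial p}} n → n < p ^ n
n<p^n (suc (suc p)) zero    = s≤s z≤n
n<p^n (suc (suc p)) (suc n) =
  <-≤-trans (s≤s (n<p^n (suc (suc p)) n)) (subst (x <_) (*-comm x (suc (suc p))) (m<m*n x (suc (suc p)) (s≤s (s≤s z≤n))))
  where
  x = suc (suc p) ^ n
  instance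
    x≢0 : NonZero x
    x≢0 = m^n≢0 (suc (suc p)) n

ord-divides : ∀ p k → p ^ ord p k ∣ k
ord-divides p k = ordUpTo-divides k p k

ord-maximal : ∀ p k .{{_ : NonTrivial p}} .{{_ : NonZero k}} e → p ^ e ∣ k → e ≤ ord p k
ord-maximal p k e d = ordUpTo-maximal k p k e
  (≤-trans (<⇒≤ (n<p^n p e)) (∣⇒≤ d)) d

-- In the following, M is the square-free part of 4 * n + 1.

Case₁ : ℕ → Set
Case₁ M = M ≡ 1

Case₂ : ℕ → ℕ → Set
Case₂ n M = Prime M × ord M (4 * n + 1) % 4 ≡ 1

Case₃ : ℕ → ℕ → Set
Case₃ n M = Prime M × ord M (4 * n + 1) % 8 ≡ 3

Case₄ : ℕ → ℕ → Set
Case₄ n M = ∃₂ λ p₁ p₂ →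
  Prime p₁ × Prime p₂ × p₁ ≢ p₂ × M ≡ p₁ * p₂ ×
  p₁ % 4 ≡ 1 × p₂ % 4 ≡ 1 ×
  ord p₁ (4 * n + 1) % 4 ≡ 1 × ord p₂ (4 * n + 1) % 4 ≡ 1

{-# OPTIONS --safe #-}
module Submission where

{-
Write P(q) = Σ ped₋₂(n) qⁿ, ψ(q) = Σ_{a ≥ 0} q^{a(a+1)/2} and φ(q) = Σ_{j ∈ ℤ} q^{j²} = 1 + 2 S(q).
The five cases are instances of one congruence,

  σ(4n + 1) ≡ (-1)ⁿ ped₋₂(n)   (mod 8),

where σ is the sum of divisors: σ is multiplicative, and the cases follow from the divisibility of
1 + p + … + pᵃ by 2, 4 and 8.  The congruence comes from four identities.

* Γ(q) ψ(q) = ψ(q²), where Γ(q)² = P(-q).  This is Gauss's product for ψ, obtained from the finite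
  identity of Shanks.
* ψ(q)² = φ(q) ψ(q²), so P(-q) φ(q) = ψ(q²).  Since φ⁴ ≡ 1 (mod 8), P(-q) ≡ φ(q)² ψ(q)² (mod 8).
* ψ(q)⁴ = Σ σ(2n + 1) qⁿ (Legendre).  Both sides have the logarithmic derivative 4 ψ′/ψ; for the
  right hand side this is proved by Liouville's method.
* The even part of φ² is congruent to φ(q²)² modulo 8, because S(q)² ≡ S(q²) (mod 2).  Hence the even
  part of ψ⁴ = φ² ψ(q²)² is congruent to φ(q²)² ψ(q²)².
-}

open import Defs
open import Algebra.Bundles using (CommutativeRing)
import Algebra.Solver.Ring
open import Algebra.Solver.Ring.AlmostCommutativeRing using (fromCommutativeRing; _-Raw-AlmostCommutative⟶_)
open import Data.Empty using (⊥-elim)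
open import Data.Integer as ℤ using (ℤ; +_; -[1+_]; 0ℤ; 1ℤ)
import Data.Integer.Properties as ℤ
open import Data.Integer.Tactic.RingSolver using (solve-∀)
open import Data.List using (List; []; _∷_; _++_; map; filter; cartesianProduct; upTo; length)
open import Data.List.Membership.Propositional using (_∈_)
open import Data.List.Membership.Propositional.Properties
  using (∈-map⁺; ∈-map⁻; ∈-++⁺ˡ; ∈-++⁺ʳ; ∈-++⁻; ∈-filter⁺; ∈-filter⁻; ∈-cartesianProduct⁺; ∈-cartesianProduct⁻; ∈-upTo⁺)
open import Data.List.Membership.Propositional.Properties.WithK using (unique∧set⇒bag)
open import Data.List.Properties using (filter-accept; filter-reject; upTo-∷ʳ)
open import Data.List.Relation.Binary.BagAndSetEquality using (∼bag⇒↭)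
open import Data.List.Relation.Binary.Permutation.Propositional using (_↭_; refl; prep; swap; trans)
open import Data.List.Relation.Unary.All as All using (All; []; _∷_; all?)
open import Data.List.Relation.Unary.AllPairs using ([]; _∷_)
open import Data.List.Relation.Unary.Any using (here; there)
open import Data.List.Relation.Unary.Linked as Linked using (Linked; []; [-]; _∷_; linked?)
open import Data.List.Relation.Unary.Linked.Properties using (Linked⇒AllPairs)
open import Data.List.Relation.Unary.Unique.Propositional using (Unique)
import Data.List.Relation.Unary.Unique.Propositional.Properties as Unique
import Data.Maybe as Maybe
open import Data.Nat as ℕ using (ℕ; zero; suc; z≤n; s≤s)
open import Data.Nat.Coprimality using (Coprime; coprime-divisor)
open import Data.Nat.Divisibility
open import Data.Nat.DivMod using (m*n/n≡m; m/n*n≡m; [m+kn]%n≡m%n; m<n⇒m%n≡m; m≡m%n+[m/n]*n)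
open import Data.Nat.Induction using (<-rec)
open import Data.Nat.ListAction using (sum; product)
open import Data.Nat.Primality using (Prime; euclidsLemma; prime⇒irreducible; prime⇒nonZero; prime⇒nonTrivial)
open import Data.Nat.Primality.Factorisation using (factorise)
import Data.Nat.Properties as ℕ
import Data.Nat.Tactic.RingSolver as ℕ-Solver
open import Data.List.Relation.Unary.Unique.DecPropositional ℕ._≟_ using (unique?)
open import Data.Product using (∃; ∃₂; _×_; _,_; proj₁; proj₂; map₂)
open import Data.Sum using (_⊎_; inj₁; inj₂; [_,_])
open import Data.Sum.Properties using (inj₁-injective; inj₂-injective)
open import Data.Unit using (⊤; tt)
open import Function.Base using (_∘_; id; const)
open import Function.Bundles using (Equivalence; mk⇔)
open import Level using (0ℓ)
open import Relation.Binary.PropositionalEquality as ≡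
  using (_≡_; _≢_; refl; sym; cong; cong₂; subst; module ≡-Reasoning)
open import Relation.Nullary using (Dec; yes; no; ¬_; contradiction)
open import Relation.Nullary.Decidable using (dec⇒maybe; _×-dec_)
open import Relation.Unary using (Decidable)

-- The product of (1 + q^{2m})/(1 - q^{2m-1}) generates the partitions with distinct even parts.
-- Replacing q by -q makes all its signs positive, and since ψ(q) is the product of (1 - q^{2m})/(1
-- - q^{2m-1}), it becomes the quotient ψ(q²)/ψ(q). This is the origin of Γ and of the sign (-1)ⁿ.
-- The sign does no harm: the classes of 1 mod 2, 2 mod 4, 4 mod 8 and 0 mod 8 are all stable under
-- negation.
--
-- Infinite products do not occur. The coefficient of Γ at n is read off from partitions with
-- bounded parts, for which the product is finite, and every division is a cancellation of a series
-- with constant term 1.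
--
-- The final arithmetic rests on the parity of exponents: a prime divides 4n + 1 = N²M to an odd
-- power exactly if it divides M. The primes outside M contribute odd factors to σ(4n + 1), those in
-- M even ones. So three primes in M already give 8, and the finer cases concern one or two primes.

private variable
  A B : Set

-- Sums over enumerated sets

∑ : List A → (A → ℤ) → ℤ
∑ []       w = 0ℤ
∑ (x ∷ xs) w = w x ℤ.+ ∑ xs w

∑-cong : ∀ (xs : List A) {v w} → (∀ {x} → x ∈ xs → v x ≡ w x) → ∑ xs v ≡ ∑ xs w
∑-cong []       eq = refl
∑-cong (x ∷ xs) eq = cong₂ ℤ._+_ (eq (here refl)) (∑-cong xs (eq ∘ there))

∑-0 : ∀ (xs : List A) → ∑ xs (λ _ → 0ℤ) ≡ 0ℤ
∑-0 []       = refl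
∑-0 (x ∷ xs) = ≡.trans (ℤ.+-identityˡ _) (∑-0 xs)

∑-++ : ∀ (xs ys : List A) {w} → ∑ (xs ++ ys) w ≡ ∑ xs w ℤ.+ ∑ ys w
∑-++ []       ys {w} = sym (ℤ.+-identityˡ (∑ ys w))
∑-++ (x ∷ xs) ys {w} = ≡.trans (cong (ℤ._+_ (w x)) (∑-++ xs ys)) (sym (ℤ.+-assoc (w x) (∑ xs w) (∑ ys w)))

∑-map : ∀ (f : A → B) xs {w} → ∑ (map f xs) w ≡ ∑ xs (w ∘ f)
∑-map f []       = refl
∑-map f (x ∷ xs) {w} = cong (ℤ._+_ (w (f x))) (∑-map f xs)

∑-+ : ∀ (xs : List A) v w → ∑ xs (λ x → v x ℤ.+ w x) ≡ ∑ xs v ℤ.+ ∑ xs w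
∑-+ []       v w = refl
∑-+ (x ∷ xs) v w = ≡.trans (cong (ℤ._+_ (v x ℤ.+ w x)) (∑-+ xs v w)) (interchange (v x) (w x) (∑ xs v) (∑ xs w))
  where
  interchange : ∀ a b c d → (a ℤ.+ b) ℤ.+ (c ℤ.+ d) ≡ (a ℤ.+ c) ℤ.+ (b ℤ.+ d)
  interchange = solve-∀

∑-*ˡ : ∀ (xs : List A) c w → ∑ xs (λ x → c ℤ.* w x) ≡ c ℤ.* ∑ xs w
∑-*ˡ []       c w = sym (ℤ.*-zeroʳ c)
∑-*ˡ (x ∷ xs) c w = ≡.trans (cong (ℤ._+_ (c ℤ.* w x)) (∑-*ˡ xs c w)) (sym (ℤ.*-distribˡ-+ c (w x) (∑ xs w)))

∑-1 : ∀ (xs : List A) → ∑ xs (λ _ → 1ℤ) ≡ + length xs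
∑-1 []       = refl
∑-1 (x ∷ xs) = cong (ℤ._+_ 1ℤ) (∑-1 xs)

∑-cartesianProduct : ∀ (xs : List A) (ys : List B) v w →
  ∑ (cartesianProduct xs ys) (λ (x , y) → v x ℤ.* w y) ≡ ∑ xs v ℤ.* ∑ ys w
∑-cartesianProduct []       ys v w = refl
∑-cartesianProduct (x ∷ xs) ys v w = begin
  ∑ (map (x ,_) ys ++ cartesianProduct xs ys) _
    ≡⟨ ∑-++ (map (x ,_) ys) _ ⟩
  ∑ (map (x ,_) ys) _ ℤ.+ ∑ (cartesianProduct xs ys) _
    ≡⟨ cong₂ ℤ._+_ (≡.trans (∑-map (x ,_) ys) (∑-*ˡ ys (v x) w)) (∑-cartesianProduct xs ys v w) ⟩
  v x ℤ.* ∑ ys w ℤ.+ ∑ xs v ℤ.* ∑ ys w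
    ≡⟨ ℤ.*-distribʳ-+ (∑ ys w) (v x) (∑ xs v) ⟨
  ∑ (x ∷ xs) v ℤ.* ∑ ys w ∎
  where open ≡-Reasoning

∑-↭ : ∀ {xs ys : List A} {w} → xs ↭ ys → ∑ xs w ≡ ∑ ys w
∑-↭ refl         = refl
∑-↭ {w = w} (prep x p) = cong (ℤ._+_ (w x)) (∑-↭ p)
∑-↭ {w = w} (swap x y p) =
  ≡.trans (cong (λ s → w x ℤ.+ (w y ℤ.+ s)) (∑-↭ p)) (exchange (w x) (w y) _)
  where
  exchange : ∀ a b c → a ℤ.+ (b ℤ.+ c) ≡ b ℤ.+ (a ℤ.+ c)
  exchange = solve-∀
∑-↭ (trans p q)  = ≡.trans (∑-↭ p) (∑-↭ q)

map-unique : ∀ (f : A → B) {xs} → (∀ {x y} → x ∈ xs → y ∈ xs → f x ≡ f y → x ≡ y) →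
  Unique xs → Unique (map f xs)
map-unique f inj []             = []
map-unique f {x ∷ xs} inj (x≢ ∷ xs!) =
  All.tabulate fresh ∷ map-unique f (λ p q → inj (there p) (there q)) xs!
  where
  fresh : ∀ {y} → y ∈ map f xs → f x ≢ y
  fresh y∈ fx≡y with ∈-map⁻ f y∈
  ... | z , z∈ , refl = All.lookup x≢ z∈ (inj (here refl) (there z∈) fx≡y)

-- The order of `list` is irrelevant: by `∑-unique` a sum over it depends only on `P`. Identities
-- between coefficients thus become statements about sets.
record Enumeration (P : A → Set) : Set where
  field
    list     : List A
    unique   : Unique list
    sound    : ∀ {x} → x ∈ list → P x
    complete : ∀ {x} → P x → x ∈ list

open Enumeration

-- Duplicate-free lists with the same members are permutations of each other; this is applied to the
-- image of `list E` and to `list F`.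
∑-bijection : ∀ {P : A → Set} {Q : B → Set} (E : Enumeration P) (F : Enumeration Q) {v w}
  (to : A → B) (from : B → A) →
  (∀ {x} → P x → Q (to x)) → (∀ {y} → Q y → P (from y)) →
  (∀ {x} → P x → from (to x) ≡ x) → (∀ {y} → Q y → to (from y) ≡ y) →
  (∀ {x} → P x → v x ≡ w (to x)) →
  ∑ (list E) v ≡ ∑ (list F) w
∑-bijection E F {v} {w} to from toQ fromP from∘to to∘from v≡w = begin
  ∑ (list E) v          ≡⟨ ∑-cong (list E) (v≡w ∘ sound E) ⟩
  ∑ (list E) (w ∘ to)   ≡⟨ ∑-map to (list E) ⟨
  ∑ (map to (list E)) w ≡⟨ ∑-↭ (∼bag⇒↭ (unique∧set⇒bag image-unique (unique F) (mk⇔ ⊆ ⊇))) ⟩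
  ∑ (list F) w          ∎
  where
  open ≡-Reasoning

  image-unique : Unique (map to (list E))
  image-unique = map-unique to
    (λ p q eq → ≡.trans (sym (from∘to (sound E p))) (≡.trans (cong from eq) (from∘to (sound E q))))
    (unique E)

  ⊆ : ∀ {y} → y ∈ map to (list E) → y ∈ list F
  ⊆ y∈ with ∈-map⁻ to y∈
  ... | x , x∈ , refl = complete F (toQ (sound E x∈))

  ⊇ : ∀ {y} → y ∈ list F → y ∈ map to (list E)
  ⊇ y∈ = subst (_∈ _) (to∘from (sound F y∈)) (∈-map⁺ to (complete E (fromP (sound F y∈))))

∑-unique : ∀ {P Q : A → Set} (E : Enumeration P) (F : Enumeration Q) {v w} →
  (∀ {x} → P x → Q x) → (∀ {x} → Q x → P x) → (∀ {x} → P x → v x ≡ w x) →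
  ∑ (list E) v ≡ ∑ (list F) w
∑-unique E F P⇒Q Q⇒P = ∑-bijection E F id id P⇒Q Q⇒P (λ _ → refl) (λ _ → refl)

filterEnumeration : ∀ {P : A → Set} (P? : Decidable P) {box : List A} → Unique box →
  (∀ {x} → P x → x ∈ box) → Enumeration P
filterEnumeration P? {box} box! P⇒∈ = record
  { list     = filter P? box
  ; unique   = Unique.filter⁺ P? box!
  ; sound    = λ x∈ → proj₂ (∈-filter⁻ P? {xs = box} x∈)
  ; complete = λ p → ∈-filter⁺ P? (P⇒∈ p) p
  }

sumEnumeration : ∀ {P : A → Set} {Q : B → Set} →
  Enumeration P → Enumeration Q → Enumeration [ P , Q ]
sumEnumeration {P = P} {Q} E F = record
  { list     = map inj₁ (list E) ++ map inj₂ (list F)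
  ; unique   = Unique.++⁺ (Unique.map⁺ inj₁-injective (unique E)) (Unique.map⁺ inj₂-injective (unique F)) disjoint
  ; sound    = sound′
  ; complete = complete′
  }
  where
  disjoint : ∀ {z} → ¬ (z ∈ map inj₁ (list E) × z ∈ map inj₂ (list F))
  disjoint (p , q) with ∈-map⁻ inj₁ p | ∈-map⁻ inj₂ q
  ... | _ , _ , refl | _ , _ , ()

  sound′ : ∀ {z} → z ∈ map inj₁ (list E) ++ map inj₂ (list F) → [ P , Q ] z
  sound′ z∈ with ∈-++⁻ (map inj₁ (list E)) z∈
  ... | inj₁ p with ∈-map⁻ inj₁ p
  ...   | _ , x∈ , refl = sound E x∈
  sound′ z∈ | inj₂ q with ∈-map⁻ inj₂ q
  ...   | _ , y∈ , refl = sound F y∈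

  complete′ : ∀ {z} → [ P , Q ] z → z ∈ map inj₁ (list E) ++ map inj₂ (list F)
  complete′ {inj₁ x} p = ∈-++⁺ˡ (∈-map⁺ inj₁ (complete E p))
  complete′ {inj₂ y} q = ∈-++⁺ʳ (map inj₁ (list E)) (∈-map⁺ inj₂ (complete F q))

∑-sumEnumeration : ∀ {P : A → Set} {Q : B → Set} (E : Enumeration P) (F : Enumeration Q) w →
  ∑ (list (sumEnumeration E F)) w ≡ ∑ (list E) (w ∘ inj₁) ℤ.+ ∑ (list F) (w ∘ inj₂)
∑-sumEnumeration E F w = ≡.trans (∑-++ (map inj₁ (list E)) _)
  (cong₂ ℤ._+_ (∑-map inj₁ (list E)) (∑-map inj₂ (list F)))

module GeneratingFunctions where

  -- Formal power series over ℤ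

  -- Dropping the first coefficient of `f` at each step runs through the pairs of indices with sum n
  -- without any subtraction; `convolve-suc` is the mirror recursion at the other end.
  convolve : (ℕ → ℤ) → (ℕ → ℤ) → ℕ → ℤ
  convolve f g zero    = f 0 ℤ.* g 0
  convolve f g (suc n) = f 0 ℤ.* g (suc n) ℤ.+ convolve (f ∘ suc) g n

  convolve-cong : ∀ {f f′ g g′} → (∀ n → f n ≡ f′ n) → (∀ n → g n ≡ g′ n) →
    ∀ n → convolve f g n ≡ convolve f′ g′ n
  convolve-cong f≡ g≡ zero    = cong₂ ℤ._*_ (f≡ 0) (g≡ 0)
  convolve-cong f≡ g≡ (suc n) =
    cong₂ ℤ._+_ (cong₂ ℤ._*_ (f≡ 0) (g≡ (suc n))) (convolve-cong (f≡ ∘ suc) g≡ n)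

  convolve-0ʳ : ∀ f g n → (∀ i → i ℕ.≤ n → g i ≡ 0ℤ) → convolve f g n ≡ 0ℤ
  convolve-0ʳ f g zero    g≡0 = ≡.trans (cong (f 0 ℤ.*_) (g≡0 0 ℕ.≤-refl)) (ℤ.*-zeroʳ (f 0))
  convolve-0ʳ f g (suc n) g≡0 = cong₂ ℤ._+_
    (≡.trans (cong (f 0 ℤ.*_) (g≡0 (suc n) ℕ.≤-refl)) (ℤ.*-zeroʳ (f 0)))
    (convolve-0ʳ (f ∘ suc) g n λ i i≤n → g≡0 i (ℕ.m≤n⇒m≤1+n i≤n))

  convolve-0ˡ : ∀ g n → convolve (λ _ → 0ℤ) g n ≡ 0ℤ
  convolve-0ˡ g zero    = refl
  convolve-0ˡ g (suc n) = ≡.trans (ℤ.+-identityˡ _) (convolve-0ˡ g n)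

  convolve-+ˡ : ∀ f g h n → convolve (λ i → f i ℤ.+ g i) h n ≡ convolve f h n ℤ.+ convolve g h n
  convolve-+ˡ f g h zero    = ℤ.*-distribʳ-+ (h 0) (f 0) (g 0)
  convolve-+ˡ f g h (suc n) =
    ≡.trans (cong (ℤ._+_ ((f 0 ℤ.+ g 0) ℤ.* h (suc n))) (convolve-+ˡ (f ∘ suc) (g ∘ suc) h n))
          (lemma (f 0) (g 0) (h (suc n)) (convolve (f ∘ suc) h n) (convolve (g ∘ suc) h n))
    where
    lemma : ∀ a b c x y → (a ℤ.+ b) ℤ.* c ℤ.+ (x ℤ.+ y) ≡ (a ℤ.* c ℤ.+ x) ℤ.+ (b ℤ.* c ℤ.+ y)
    lemma = solve-∀

  convolve-*ˡ : ∀ c f g n → convolve (λ i → c ℤ.* f i) g n ≡ c ℤ.* convolve f g n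
  convolve-*ˡ c f g zero    = ℤ.*-assoc c (f 0) (g 0)
  convolve-*ˡ c f g (suc n) =
    ≡.trans (cong (ℤ._+_ (c ℤ.* f 0 ℤ.* g (suc n))) (convolve-*ˡ c (f ∘ suc) g n))
          (lemma c (f 0) (g (suc n)) (convolve (f ∘ suc) g n))
    where
    lemma : ∀ c a b x → c ℤ.* a ℤ.* b ℤ.+ c ℤ.* x ≡ c ℤ.* (a ℤ.* b ℤ.+ x)
    lemma = solve-∀

  convolve-suc : ∀ f g n → convolve f g (suc n) ≡ f (suc n) ℤ.* g 0 ℤ.+ convolve f (g ∘ suc) n
  convolve-suc f g zero    = ℤ.+-comm (f 0 ℤ.* g 1) (f 1 ℤ.* g 0)
  convolve-suc f g (suc n) =
    ≡.trans (cong (ℤ._+_ (f 0 ℤ.* g (suc (suc n)))) (convolve-suc (f ∘ suc) g n))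
          (lemma (f 0 ℤ.* g (suc (suc n))) (f (suc (suc n)) ℤ.* g 0) (convolve (f ∘ suc) (g ∘ suc) n))
    where
    lemma : ∀ a b c → a ℤ.+ (b ℤ.+ c) ≡ b ℤ.+ (a ℤ.+ c)
    lemma = solve-∀

  convolve-comm : ∀ f g n → convolve f g n ≡ convolve g f n
  convolve-comm f g zero    = ℤ.*-comm (f 0) (g 0)
  convolve-comm f g (suc n) = ≡.trans
    (cong₂ ℤ._+_ (ℤ.*-comm (f 0) (g (suc n))) (convolve-comm (f ∘ suc) g n))
    (sym (convolve-suc g f n))

  convolve-assoc : ∀ f g h n → convolve (convolve f g) h n ≡ convolve f (convolve g h) n
  convolve-assoc f g h zero    = ℤ.*-assoc (f 0) (g 0) (h 0)
  convolve-assoc f g h (suc n) = begin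
    f 0 ℤ.* g 0 ℤ.* h (suc n) ℤ.+ convolve (λ i → f 0 ℤ.* g (suc i) ℤ.+ convolve (f ∘ suc) g i) h n
      ≡⟨ cong (ℤ._+_ (f 0 ℤ.* g 0 ℤ.* h (suc n))) (≡.trans (convolve-+ˡ (λ i → f 0 ℤ.* g (suc i)) (convolve (f ∘ suc) g) h n)
           (cong₂ ℤ._+_ (convolve-*ˡ (f 0) (g ∘ suc) h n) (convolve-assoc (f ∘ suc) g h n))) ⟩
    f 0 ℤ.* g 0 ℤ.* h (suc n) ℤ.+ (f 0 ℤ.* convolve (g ∘ suc) h n ℤ.+ convolve (f ∘ suc) (convolve g h) n)
      ≡⟨ lemma (f 0) (g 0) (h (suc n)) _ _ ⟩
    f 0 ℤ.* convolve g h (suc n) ℤ.+ convolve (f ∘ suc) (convolve g h) n ∎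
    where
    open ≡-Reasoning
    lemma : ∀ a b c x y → a ℤ.* b ℤ.* c ℤ.+ (a ℤ.* x ℤ.+ y) ≡ a ℤ.* (b ℤ.* c ℤ.+ x) ℤ.+ y
    lemma = solve-∀

  record Series : Set where
    no-eta-equality
    constructor series
    field coeff : ℕ → ℤ

  open Series public

  infix 4 _≈_

  record _≈_ (f g : Series) : Set where
    no-eta-equality
    constructor pointwise
    field at : ∀ n → coeff f n ≡ coeff g n

  open _≈_

  infixl 6 _+_
  infixl 7 _*_
  infix  8 -_

  _+_ _*_ : Series → Series → Series
  coeff (f + g) n = coeff f n ℤ.+ coeff g n
  coeff (f * g)   = convolve (coeff f) (coeff g)

  -_ : Series → Series
  coeff (- f) n = ℤ.- coeff f n

  constant : ℤ → Series
  coeff (constant c) zero    = c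
  coeff (constant c) (suc n) = 0ℤ

  0# 1# : Series
  coeff 0# n = 0ℤ
  1# = constant 1ℤ

  *-identityˡ : ∀ f → 1# * f ≈ f
  at (*-identityˡ f) zero    = ℤ.*-identityˡ (coeff f 0)
  at (*-identityˡ f) (suc n) = ≡.trans
    (cong₂ ℤ._+_ (ℤ.*-identityˡ (coeff f (suc n))) (convolve-0ˡ (coeff f) n))
    (ℤ.+-identityʳ (coeff f (suc n)))

  private module Laws where
    *-comm : ∀ f g → f * g ≈ g * f
    at (*-comm f g) = convolve-comm (coeff f) (coeff g)

    ≈-sym : ∀ {f g} → f ≈ g → g ≈ f
    at (≈-sym p) n = sym (at p n)

    ≈-trans : ∀ {f g h} → f ≈ g → g ≈ h → f ≈ h
    at (≈-trans p q) n = ≡.trans (at p n) (at q n)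

    *-cong : ∀ {f f′ g g′} → f ≈ f′ → g ≈ g′ → f * g ≈ f′ * g′
    at (*-cong p q) = convolve-cong (at p) (at q)

    *-assoc : ∀ f g h → (f * g) * h ≈ f * (g * h)
    at (*-assoc f g h) = convolve-assoc (coeff f) (coeff g) (coeff h)

    distribʳ : ∀ h f g → (f + g) * h ≈ f * h + g * h
    at (distribʳ h f g) = convolve-+ˡ (coeff f) (coeff g) (coeff h)

  seriesRing : CommutativeRing 0ℓ 0ℓ
  seriesRing = record
    { Carrier = Series ; _≈_ = _≈_ ; _+_ = _+_ ; _*_ = _*_ ; -_ = -_ ; 0# = 0# ; 1# = 1#
    ; isCommutativeRing = record
      { isRing = record
        { +-isAbelianGroup = record
          { isGroup = record
            { isMonoid = record
              { isSemigroup = record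
                { isMagma = record
                  { isEquivalence = record
                    { refl = pointwise λ _ → refl ; sym = ≈-sym ; trans = ≈-trans }
                  ; ∙-cong = λ p q → pointwise λ n → cong₂ ℤ._+_ (at p n) (at q n) }
                ; assoc = λ f g h → pointwise λ n → ℤ.+-assoc (coeff f n) (coeff g n) (coeff h n) }
              ; identity = (λ f → pointwise λ n → ℤ.+-identityˡ (coeff f n))
                         , (λ f → pointwise λ n → ℤ.+-identityʳ (coeff f n)) }
            ; inverse = (λ f → pointwise λ n → ℤ.+-inverseˡ (coeff f n))
                      , (λ f → pointwise λ n → ℤ.+-inverseʳ (coeff f n))
            ; ⁻¹-cong = λ p → pointwise λ n → cong ℤ.-_ (at p n) }
          ; comm = λ f g → pointwise λ n → ℤ.+-comm (coeff f n) (coeff g n) }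
        ; *-cong = *-cong
        ; *-assoc = *-assoc
        ; *-identity = *-identityˡ , λ f → ≈-trans (*-comm f 1#) (*-identityˡ f)
        ; distrib = (λ h f g → ≈-trans (*-comm h (f + g)) (≈-trans (distribʳ h f g)
                      (pointwise λ n → cong₂ ℤ._+_ (at (*-comm f h) n) (at (*-comm g h) n))))
                  , distribʳ }
      ; *-comm = *-comm } }
    where open Laws

  open CommutativeRing seriesRing
    using (_-_; +-cong; +-congˡ; +-congʳ; *-congˡ; *-congʳ; -‿cong)
  open CommutativeRing seriesRing using (*-cong) renaming (refl to ≈-refl; sym to ≈-sym; trans to ≈-trans)
  module ≈-Reasoning where
    open import Relation.Binary.Reasoning.Setoid (CommutativeRing.setoid seriesRing) public

  constant-* : ∀ a f n → coeff (constant a * f) n ≡ a ℤ.* coeff f n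
  constant-* a f zero    = refl
  constant-* a f (suc n) = ≡.trans
    (cong (ℤ._+_ (a ℤ.* coeff f (suc n))) (convolve-0ˡ (coeff f) n))
    (ℤ.+-identityʳ (a ℤ.* coeff f (suc n)))

  private
    embedding : ℤ.+-*-rawRing -Raw-AlmostCommutative⟶ fromCommutativeRing seriesRing
    embedding = record
      { ⟦_⟧    = constant
      ; +-homo = λ a b → pointwise λ { zero → refl ; (suc n) → refl }
      ; *-homo = λ a b → pointwise λ { zero → refl ; (suc n) → sym (≡.trans (constant-* a (constant b) (suc n)) (ℤ.*-zeroʳ a)) }
      ; -‿homo = λ a → pointwise λ { zero → refl ; (suc n) → refl }
      ; 0-homo = pointwise λ { zero → refl ; (suc n) → refl }
      ; 1-homo = pointwise λ _ → refl
      }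

  -- Equality of series cannot be decided, so polynomials are normalised over ℤ, embedded as the
  -- constant series.
  module SeriesSolver = Algebra.Solver.Ring ℤ.+-*-rawRing (fromCommutativeRing seriesRing) embedding
    (λ a b → Maybe.map (λ a≡b → pointwise λ n → cong (λ c → coeff (constant c) n) a≡b) (dec⇒maybe (a ℤ.≟ b)))

  open SeriesSolver using (solve; _:=_; _:+_; _:*_; _:-_; :-_; con)

  constant-cong : ∀ {a b} → a ≡ b → constant a ≈ constant b
  constant-cong refl = ≈-refl

  constant-0 : constant 0ℤ ≈ 0#
  at constant-0 zero    = refl
  at constant-0 (suc n) = refl

  Vanishes : ℕ → Series → Set
  Vanishes N f = ∀ {j} → j ℕ.< N → coeff f j ≡ 0ℤ

  Vanishes-*ˡ : ∀ {N f} g → Vanishes N f → Vanishes N (g * f)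
  Vanishes-*ˡ {f = f} g f≡0 {j} j<N =
    convolve-0ʳ (coeff g) (coeff f) j λ i i≤j → f≡0 (ℕ.≤-<-trans i≤j j<N)

  Vanishes-resp : ∀ {N f g} → f ≈ g → Vanishes N f → Vanishes N g
  Vanishes-resp f≈g f≡0 {j} j<N = ≡.trans (sym (at f≈g j)) (f≡0 j<N)

  -- As `f` has constant term 1, the coefficient of `f * g` at j is that of `g` at j plus a
  -- combination of earlier coefficients of `g`, which vanish by strong induction.
  Vanishes-cancel : ∀ {N} f g → coeff f 0 ≡ 1ℤ → Vanishes N (f * g) → Vanishes N g
  Vanishes-cancel {N} f g f₀≡1 fg≡0 {j} = <-rec (λ j → j ℕ.< N → coeff g j ≡ 0ℤ) step j
    where
    open ≡-Reasoning
    step : ∀ j → (∀ {i} → i ℕ.< j → i ℕ.< N → coeff g i ≡ 0ℤ) → j ℕ.< N → coeff g j ≡ 0ℤ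
    step zero below 0<N = begin
      coeff g 0               ≡⟨ ℤ.*-identityˡ (coeff g 0) ⟨
      1ℤ ℤ.* coeff g 0        ≡⟨ cong (ℤ._* coeff g 0) f₀≡1 ⟨
      coeff f 0 ℤ.* coeff g 0 ≡⟨ fg≡0 0<N ⟩
      0ℤ                      ∎
    step (suc j) below j<N = begin
      coeff g (suc j)                       ≡⟨ ℤ.*-identityˡ (coeff g (suc j)) ⟨
      1ℤ ℤ.* coeff g (suc j)                ≡⟨ cong (ℤ._* coeff g (suc j)) f₀≡1 ⟨
      coeff f 0 ℤ.* coeff g (suc j)         ≡⟨ ℤ.+-identityʳ _ ⟨
      coeff f 0 ℤ.* coeff g (suc j) ℤ.+ 0ℤ  ≡⟨ cong (ℤ._+_ (coeff f 0 ℤ.* coeff g (suc j))) rest≡0 ⟨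
      coeff (f * g) (suc j)                 ≡⟨ fg≡0 j<N ⟩
      0ℤ                                    ∎
      where
      rest≡0 : convolve (coeff f ∘ suc) (coeff g) j ≡ 0ℤ
      rest≡0 = convolve-0ʳ (coeff f ∘ suc) (coeff g) j
        λ i i≤j → below (ℕ.s≤s i≤j) (ℕ.<-trans (ℕ.s≤s i≤j) j<N)

  *-cancelˡ : ∀ f {g h} → coeff f 0 ≡ 1ℤ → f * g ≈ f * h → g ≈ h
  at (*-cancelˡ f {g} {h} f₀≡1 fg≈fh) n =
    ℤ.i-j≡0⇒i≡j (coeff g n) (coeff h n) (Vanishes-cancel f (g - h) f₀≡1 difference≡0 (ℕ.n<1+n n))
    where
    difference≈0 : f * (g - h) ≈ constant 0ℤ
    difference≈0 = ≈-trans (solve 3 (λ f g h → f :* (g :- h) := f :* g :- f :* h) ≈-refl f g h)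
      (≈-trans (+-congʳ fg≈fh) (solve 2 (λ f h → f :* h :- f :* h := con 0ℤ) ≈-refl f h))
    difference≡0 : Vanishes (suc n) (f * (g - h))
    difference≡0 {j} _ = ≡.trans (at difference≈0 j) (at constant-0 j)

  -- Powers of q and the derivation q d/dq

  shift : Series → Series
  coeff (shift f) zero    = 0ℤ
  coeff (shift f) (suc n) = coeff f n

  shift-cong : ∀ {f g} → f ≈ g → shift f ≈ shift g
  at (shift-cong f≈g) zero    = refl
  at (shift-cong f≈g) (suc n) = at f≈g n

  shift-* : ∀ f g → shift f * g ≈ shift (f * g)
  at (shift-* f g) zero    = refl
  at (shift-* f g) (suc n) = ℤ.+-identityˡ (coeff (f * g) n)

  q^ : ℕ → Series
  q^ zero    = 1#
  q^ (suc m) = shift (q^ m)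

  q^-+ : ∀ a b → q^ (a ℕ.+ b) ≈ q^ a * q^ b
  q^-+ zero    b = ≈-sym (*-identityˡ (q^ b))
  q^-+ (suc a) b = ≈-trans (shift-cong (q^-+ a b)) (≈-sym (shift-* (q^ a) (q^ b)))

  q^-vanishes : ∀ m → Vanishes m (q^ m)
  q^-vanishes (suc m) {zero}  _         = refl
  q^-vanishes (suc m) {suc j} (ℕ.s≤s j<m) = q^-vanishes m j<m

  -- q d/dq
  θ : Series → Series
  coeff (θ f) n = + n ℤ.* coeff f n

  θ-* : ∀ f g → θ (f * g) ≈ θ f * g + f * θ g
  at (θ-* f g) = leibniz (coeff f) (coeff g)
    where
    open ≡-Reasoning
    regroup : ∀ a b c p q r → (1ℤ ℤ.+ a) ℤ.* (b ℤ.* c) ℤ.+ (r ℤ.+ (p ℤ.+ q)) ≡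
      (0ℤ ℤ.* b ℤ.* c ℤ.+ (r ℤ.+ p)) ℤ.+ (b ℤ.* ((1ℤ ℤ.+ a) ℤ.* c) ℤ.+ q)
    regroup = solve-∀
    expand : ∀ n x y → (1ℤ ℤ.+ n) ℤ.* (x ℤ.+ y) ≡ (1ℤ ℤ.+ n) ℤ.* x ℤ.+ (y ℤ.+ n ℤ.* y)
    expand = solve-∀
    scale : ∀ n x → (1ℤ ℤ.+ n) ℤ.* x ≡ x ℤ.+ n ℤ.* x
    scale = solve-∀

    leibniz : ∀ f g n → + n ℤ.* convolve f g n ≡
      convolve (λ i → + i ℤ.* f i) g n ℤ.+ convolve f (λ i → + i ℤ.* g i) n
    leibniz f g zero = sym (cong (ℤ._+_ 0ℤ) (ℤ.*-zeroʳ (f 0)))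
    leibniz f g (suc n) = begin
      + suc n ℤ.* (f 0 ℤ.* g (suc n) ℤ.+ convolve (f ∘ suc) g n)
        ≡⟨ expand (+ n) (f 0 ℤ.* g (suc n)) (convolve (f ∘ suc) g n) ⟩
      + suc n ℤ.* (f 0 ℤ.* g (suc n)) ℤ.+ (convolve (f ∘ suc) g n ℤ.+ + n ℤ.* convolve (f ∘ suc) g n)
        ≡⟨ cong (λ x → + suc n ℤ.* (f 0 ℤ.* g (suc n)) ℤ.+ (convolve (f ∘ suc) g n ℤ.+ x)) (leibniz (f ∘ suc) g n) ⟩
      + suc n ℤ.* (f 0 ℤ.* g (suc n)) ℤ.+ (convolve (f ∘ suc) g n ℤ.+ (tail′ ℤ.+ convolve (f ∘ suc) (λ i → + i ℤ.* g i) n))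
        ≡⟨ regroup (+ n) (f 0) (g (suc n)) tail′ _ (convolve (f ∘ suc) g n) ⟩
      (0ℤ ℤ.* f 0 ℤ.* g (suc n) ℤ.+ (convolve (f ∘ suc) g n ℤ.+ tail′)) ℤ.+ (f 0 ℤ.* (+ suc n ℤ.* g (suc n)) ℤ.+ convolve (f ∘ suc) (λ i → + i ℤ.* g i) n)
        ≡⟨ cong (λ x → (0ℤ ℤ.* f 0 ℤ.* g (suc n) ℤ.+ x) ℤ.+ (f 0 ℤ.* (+ suc n ℤ.* g (suc n)) ℤ.+ convolve (f ∘ suc) (λ i → + i ℤ.* g i) n)) tail-rule ⟨
      convolve (λ i → + i ℤ.* f i) g (suc n) ℤ.+ convolve f (λ i → + i ℤ.* g i) (suc n) ∎
      where
      tail′ : ℤ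
      tail′ = convolve (λ i → + i ℤ.* f (suc i)) g n
      tail-rule : convolve (λ i → + suc i ℤ.* f (suc i)) g n ≡ convolve (f ∘ suc) g n ℤ.+ tail′
      tail-rule = ≡.trans (convolve-cong (λ i → scale (+ i) (f (suc i))) (λ _ → refl) n)
        (convolve-+ˡ (f ∘ suc) (λ i → + i ℤ.* f (suc i)) g n)

  -- Even part and dilation

  double : ℕ → ℕ
  double zero    = zero
  double (suc n) = suc (suc (double n))

  -- The even part with q² renamed to q; it undoes `dilate`, the substitution of q² for q.
  even : Series → Series
  coeff (even f) n = coeff f (double n)

  spread : (ℕ → ℤ) → ℕ → ℤ
  spread f zero          = f 0
  spread f (suc zero)    = 0ℤ
  spread f (suc (suc n)) = spread (f ∘ suc) n

  dilate : Series → Series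
  coeff (dilate f) = spread (coeff f)

  spread-cong : ∀ {f g} → (∀ n → f n ≡ g n) → ∀ n → spread f n ≡ spread g n
  spread-cong f≡g zero          = f≡g 0
  spread-cong f≡g (suc zero)    = refl
  spread-cong f≡g (suc (suc n)) = spread-cong (f≡g ∘ suc) n

  dilate-cong : ∀ {f g} → f ≈ g → dilate f ≈ dilate g
  at (dilate-cong f≈g) = spread-cong (at f≈g)

  spread-+ : ∀ f g n → spread (λ i → f i ℤ.+ g i) n ≡ spread f n ℤ.+ spread g n
  spread-+ f g zero          = refl
  spread-+ f g (suc zero)    = refl
  spread-+ f g (suc (suc n)) = spread-+ (f ∘ suc) (g ∘ suc) n

  spread-*ˡ : ∀ c f n → spread (λ i → c ℤ.* f i) n ≡ c ℤ.* spread f n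
  spread-*ˡ c f zero          = refl
  spread-*ˡ c f (suc zero)    = sym (ℤ.*-zeroʳ c)
  spread-*ˡ c f (suc (suc n)) = spread-*ˡ c (f ∘ suc) n

  dilate-* : ∀ f g → dilate (f * g) ≈ dilate f * dilate g
  at (dilate-* f g) = go (coeff f) (coeff g)
    where
    open ≡-Reasoning
    go : ∀ f g n → spread (convolve f g) n ≡ convolve (spread f) (spread g) n
    go f g zero          = refl
    go f g (suc zero)    = sym (cong (ℤ._+ 0ℤ) (ℤ.*-zeroʳ (f 0)))
    go f g (suc (suc n)) = begin
      spread (λ i → f 0 ℤ.* g (suc i) ℤ.+ convolve (f ∘ suc) g i) n
        ≡⟨ spread-+ (λ i → f 0 ℤ.* g (suc i)) (convolve (f ∘ suc) g) n ⟩
      spread (λ i → f 0 ℤ.* g (suc i)) n ℤ.+ spread (convolve (f ∘ suc) g) n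
        ≡⟨ cong₂ ℤ._+_ (spread-*ˡ (f 0) (g ∘ suc) n) (go (f ∘ suc) g n) ⟩
      f 0 ℤ.* spread (g ∘ suc) n ℤ.+ convolve (spread (f ∘ suc)) (spread g) n
        ≡⟨ cong (ℤ._+_ (f 0 ℤ.* spread (g ∘ suc) n)) (ℤ.+-identityˡ _) ⟨
      convolve (spread f) (spread g) (suc (suc n)) ∎

  even-dilate : ∀ f → even (dilate f) ≈ f
  at (even-dilate f) = go (coeff f)
    where
    go : ∀ f n → spread f (double n) ≡ f n
    go f zero    = refl
    go f (suc n) = go (f ∘ suc) n

  -- Series in q² behave as scalars when the even part is taken.
  even-dilate-* : ∀ f g → even (dilate f * g) ≈ f * even g
  at (even-dilate-* f g) = go (coeff f) (coeff g)
    where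
    go : ∀ f g n → convolve (spread f) g (double n) ≡ convolve f (g ∘ double) n
    go f g zero    = refl
    go f g (suc n) = cong (ℤ._+_ (f 0 ℤ.* g (double (suc n))))
      (≡.trans (ℤ.+-identityˡ _) (go (f ∘ suc) g n))

  square-parity : ∀ i → ∃ λ h → i ℤ.* i ≡ i ℤ.+ + 2 ℤ.* h
  square-parity (+ n)      = nonneg n
    where
    step : ∀ n h → n ℤ.* n ≡ n ℤ.+ + 2 ℤ.* h → (1ℤ ℤ.+ n) ℤ.* (1ℤ ℤ.+ n) ≡ (1ℤ ℤ.+ n) ℤ.+ + 2 ℤ.* (h ℤ.+ n)
    step n h eq = ≡.trans (lhs n) (≡.trans (cong (λ s → 1ℤ ℤ.+ + 2 ℤ.* n ℤ.+ s) eq) (rhs n h))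
      where
      lhs : ∀ n → (1ℤ ℤ.+ n) ℤ.* (1ℤ ℤ.+ n) ≡ 1ℤ ℤ.+ + 2 ℤ.* n ℤ.+ n ℤ.* n
      lhs = solve-∀
      rhs : ∀ n h → 1ℤ ℤ.+ + 2 ℤ.* n ℤ.+ (n ℤ.+ + 2 ℤ.* h) ≡ (1ℤ ℤ.+ n) ℤ.+ + 2 ℤ.* (h ℤ.+ n)
      rhs = solve-∀
    nonneg : ∀ n → ∃ λ h → + n ℤ.* + n ≡ + n ℤ.+ + 2 ℤ.* h
    nonneg zero    = 0ℤ , refl
    nonneg (suc n) with nonneg n
    ... | h , eq = h ℤ.+ + n , step (+ n) h eq
  square-parity -[1+ n ] with square-parity (+ suc n)
  ... | h , eq = h ℤ.+ + suc n , ≡.trans eq (flip (+ suc n) h)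
    where
    flip : ∀ n h → n ℤ.+ + 2 ℤ.* h ≡ ℤ.- n ℤ.+ + 2 ℤ.* (h ℤ.+ n)
    flip = solve-∀

  -- Frobenius: modulo 2 the products of coefficients at distinct indices come in equal pairs and
  -- cancel, and the squares that remain satisfy a² ≡ a.
  square≡dilate-mod-2 : ∀ f → ∃ λ h → f * f ≈ dilate f + constant (+ 2) * h
  square≡dilate-mod-2 f = series (proj₁ ∘ go (coeff f)) , pointwise λ n →
    ≡.trans (proj₂ (go (coeff f) n)) (cong (ℤ._+_ (coeff (dilate f) n)) (sym (constant-* (+ 2) (series _) n)))
    where
    go : ∀ f n → ∃ λ h → convolve f f n ≡ spread f n ℤ.+ + 2 ℤ.* h
    go f zero          = square-parity (f 0)
    go f (suc zero)    = f 0 ℤ.* f 1 , lemma (f 0) (f 1)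
      where
      lemma : ∀ a b → a ℤ.* b ℤ.+ b ℤ.* a ≡ 0ℤ ℤ.+ + 2 ℤ.* (a ℤ.* b)
      lemma = solve-∀
    -- Taking off the first and the last term, which are equal, leaves the square of the shifted
    -- series two degrees lower.
    go f (suc (suc n)) with go (f ∘ suc) n
    ... | h , eq = f 0 ℤ.* f (suc (suc n)) ℤ.+ h , (begin
      f 0 ℤ.* f (suc (suc n)) ℤ.+ convolve (f ∘ suc) f (suc n)
        ≡⟨ cong (ℤ._+_ (f 0 ℤ.* f (suc (suc n)))) (convolve-suc (f ∘ suc) f n) ⟩
      f 0 ℤ.* f (suc (suc n)) ℤ.+ (f (suc (suc n)) ℤ.* f 0 ℤ.+ convolve (f ∘ suc) (f ∘ suc) n)
        ≡⟨ cong (λ s → f 0 ℤ.* f (suc (suc n)) ℤ.+ (f (suc (suc n)) ℤ.* f 0 ℤ.+ s)) eq ⟩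
      f 0 ℤ.* f (suc (suc n)) ℤ.+ (f (suc (suc n)) ℤ.* f 0 ℤ.+ (spread (f ∘ suc) n ℤ.+ + 2 ℤ.* h))
        ≡⟨ lemma (f 0) (f (suc (suc n))) (spread (f ∘ suc) n) h ⟩
      spread (f ∘ suc) n ℤ.+ + 2 ℤ.* (f 0 ℤ.* f (suc (suc n)) ℤ.+ h) ∎)
      where
      open ≡-Reasoning
      lemma : ∀ a b s h → a ℤ.* b ℤ.+ (b ℤ.* a ℤ.+ (s ℤ.+ + 2 ℤ.* h)) ≡ s ℤ.+ + 2 ℤ.* (a ℤ.* b ℤ.+ h)
      lemma = solve-∀

  -- Generating functions of graded sets

  -- A relation in place of a degree function lets the graded set be a subset of `A`: elements
  -- without a degree do not count. `functional` keeps the fibres disjoint, on which products rely.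
  record Graded (A : Set) : Set₁ where
    field
      Deg        : A → ℕ → Set
      fibre      : ∀ n → Enumeration (λ x → Deg x n)
      functional : ∀ {x m n} → Deg x m → Deg x n → m ≡ n

  open Graded

  gen : Graded A → (A → ℤ) → Series
  coeff (gen G w) n = ∑ (list (fibre G n)) w

  gradedBy : (deg : A → ℕ) (box : ℕ → List A) → (∀ n → Unique (box n)) → (∀ x → x ∈ box (deg x)) → Graded A
  gradedBy deg box box! ∈box = record
    { Deg        = λ x n → deg x ≡ n
    ; fibre      = λ n → filterEnumeration (λ x → deg x ℕ.≟ n) (box! n) λ { {x} refl → ∈box x }
    ; functional = λ { refl refl → refl }
    }

  gen-cong : ∀ (G : Graded A) {v w} → (∀ {x n} → Deg G x n → v x ≡ w x) → gen G v ≈ gen G w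
  at (gen-cong G v≡w) n = ∑-cong (list (fibre G n)) (v≡w ∘ sound (fibre G n))

  gen-+ : ∀ (G : Graded A) v w → gen G (λ x → v x ℤ.+ w x) ≈ gen G v + gen G w
  at (gen-+ G v w) n = ∑-+ (list (fibre G n)) v w

  gen-*ˡ : ∀ (G : Graded A) c w → gen G (λ x → c ℤ.* w x) ≈ constant c * gen G w
  at (gen-*ˡ G c w) n = ≡.trans (∑-*ˡ (list (fibre G n)) c w) (sym (constant-* c (gen G w) n))

  gen-θ : ∀ (G : Graded A) (deg : A → ℕ) → (∀ {x n} → Deg G x n → deg x ≡ n) → ∀ w →
    gen G (λ x → + deg x ℤ.* w x) ≈ θ (gen G w)
  at (gen-θ G deg Deg⇒deg w) n = ≡.trans
    (∑-cong (list (fibre G n)) λ {x} x∈ → cong (λ i → + i ℤ.* w x) (Deg⇒deg (sound (fibre G n) x∈)))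
    (∑-*ˡ (list (fibre G n)) (+ n) w)

  gen-bijection : ∀ (G : Graded A) (H : Graded B) {v w} (to : A → B) (from : B → A) →
    (∀ {x n} → Deg G x n → Deg H (to x) n) → (∀ {y n} → Deg H y n → Deg G (from y) n) →
    (∀ {x n} → Deg G x n → from (to x) ≡ x) → (∀ {y n} → Deg H y n → to (from y) ≡ y) →
    (∀ {x n} → Deg G x n → v x ≡ w (to x)) →
    gen G v ≈ gen H w
  at (gen-bijection G H to from toDeg fromDeg from∘to to∘from v≡w) n =
    ∑-bijection (fibre G n) (fibre H n) to from toDeg fromDeg from∘to to∘from v≡w

  infixr 5 _⊕_
  infixr 6 _⊗_

  _⊕_ : Graded A → Graded B → Graded (A ⊎ B)
  G ⊕ H = record
    { Deg        = λ z n → [ (λ x → Deg G x n) , (λ y → Deg H y n) ] z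
    ; fibre      = λ n → sumEnumeration (fibre G n) (fibre H n)
    ; functional = λ { {inj₁ x} → functional G ; {inj₂ y} → functional H }
    }

  gen-⊕ : ∀ (G : Graded A) (H : Graded B) w → gen (G ⊕ H) w ≈ gen G (w ∘ inj₁) + gen H (w ∘ inj₂)
  at (gen-⊕ G H w) n = ∑-sumEnumeration (fibre G n) (fibre H n) w

  DegProduct : (A → ℕ → Set) → (B → ℕ → Set) → A × B → ℕ → Set
  DegProduct P Q (x , y) n = ∃₂ λ i j → i ℕ.+ j ≡ n × P x i × Q y j

  -- This follows the recursion of `convolve`, so that sums over the list turn into products of
  -- series by the same induction.
  productList : (ℕ → List A) → (ℕ → List B) → ℕ → List (A × B)
  productList L M zero    = cartesianProduct (L 0) (M 0)
  productList L M (suc n) = cartesianProduct (L 0) (M (suc n)) ++ productList (L ∘ suc) M n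

  ∈-productList⁻ : ∀ (L : ℕ → List A) (M : ℕ → List B) n {z} → z ∈ productList L M n →
    DegProduct (λ x i → x ∈ L i) (λ y j → y ∈ M j) z n
  ∈-productList⁻ L M zero z∈ with ∈-cartesianProduct⁻ (L 0) (M 0) z∈
  ... | x∈ , y∈ = 0 , 0 , refl , x∈ , y∈
  ∈-productList⁻ L M (suc n) z∈ with ∈-++⁻ (cartesianProduct (L 0) (M (suc n))) z∈
  ... | inj₁ z∈′ with ∈-cartesianProduct⁻ (L 0) (M (suc n)) z∈′
  ...   | x∈ , y∈ = 0 , suc n , refl , x∈ , y∈
  ∈-productList⁻ L M (suc n) z∈ | inj₂ z∈′ with ∈-productList⁻ (L ∘ suc) M n z∈′
  ...   | i , j , refl , x∈ , y∈ = suc i , j , refl , x∈ , y∈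

  ∈-productList⁺ : ∀ (L : ℕ → List A) (M : ℕ → List B) i j {x y} → x ∈ L i → y ∈ M j →
    (x , y) ∈ productList L M (i ℕ.+ j)
  ∈-productList⁺ L M zero zero    x∈ y∈ = ∈-cartesianProduct⁺ x∈ y∈
  ∈-productList⁺ L M zero (suc j) x∈ y∈ = ∈-++⁺ˡ (∈-cartesianProduct⁺ x∈ y∈)
  ∈-productList⁺ L M (suc i) j    x∈ y∈ =
    ∈-++⁺ʳ (cartesianProduct (L 0) (M (suc (i ℕ.+ j)))) (∈-productList⁺ (L ∘ suc) M i j x∈ y∈)

  productList-unique : ∀ (L : ℕ → List A) (M : ℕ → List B) → (∀ i → Unique (L i)) → (∀ j → Unique (M j)) →
    (∀ {x i j} → x ∈ L i → x ∈ L j → i ≡ j) → ∀ n → Unique (productList L M n)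
  productList-unique L M L! M! disjoint zero    = Unique.cartesianProduct⁺ (L! 0) (M! 0)
  productList-unique L M L! M! disjoint (suc n) = Unique.++⁺
    (Unique.cartesianProduct⁺ (L! 0) (M! (suc n)))
    (productList-unique (L ∘ suc) M (L! ∘ suc) M! (λ p q → ℕ.suc-injective (disjoint p q)) n)
    λ (p , q) → clash (proj₁ (∈-cartesianProduct⁻ (L 0) (M (suc n)) p)) (∈-productList⁻ (L ∘ suc) M n q)
    where
    clash : ∀ {x y} → x ∈ L 0 → ¬ DegProduct (λ x i → x ∈ L (suc i)) (λ y j → y ∈ M j) (x , y) n
    clash x∈ (i , _ , _ , x∈′ , _) with disjoint x∈ x∈′
    ... | ()

  ∑-productList : ∀ (L : ℕ → List A) (M : ℕ → List B) v w n →
    ∑ (productList L M n) (λ (x , y) → v x ℤ.* w y) ≡ convolve (λ i → ∑ (L i) v) (λ j → ∑ (M j) w) n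
  ∑-productList L M v w zero    = ∑-cartesianProduct (L 0) (M 0) v w
  ∑-productList L M v w (suc n) = ≡.trans (∑-++ (cartesianProduct (L 0) (M (suc n))) _)
    (cong₂ ℤ._+_ (∑-cartesianProduct (L 0) (M (suc n)) v w) (∑-productList (L ∘ suc) M v w n))

  _⊗_ : Graded A → Graded B → Graded (A × B)
  G ⊗ H = record
    { Deg        = DegProduct (Deg G) (Deg H)
    ; fibre      = λ n → record
      { list     = productList L M n
      ; unique   = productList-unique L M (λ i → unique (fibre G i)) (λ j → unique (fibre H j))
          (λ {x} {i} {j} p q → functional G (sound (fibre G i) p) (sound (fibre G j) q)) n
      ; sound    = λ z∈ → let i , j , i+j≡n , x∈ , y∈ = ∈-productList⁻ L M n z∈
                          in i , j , i+j≡n , sound (fibre G i) x∈ , sound (fibre H j) y∈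
      ; complete = λ { (i , j , refl , p , q) → ∈-productList⁺ L M i j (complete (fibre G i) p) (complete (fibre H j) q) }
      }
    ; functional = λ (i , j , i+j≡m , p , q) (i′ , j′ , i′+j′≡n , p′ , q′) →
        ≡.trans (sym i+j≡m) (≡.trans (cong₂ ℕ._+_ (functional G p p′) (functional H q q′)) i′+j′≡n)
    }
    where
    L = list ∘ fibre G
    M = list ∘ fibre H

  gen-⊗ : ∀ (G : Graded A) (H : Graded B) v w →
    gen (G ⊗ H) (λ (x , y) → v x ℤ.* w y) ≈ gen G v * gen H w
  at (gen-⊗ G H v w) = ∑-productList (list ∘ fibre G) (list ∘ fibre H) v w

  -- Theta series

  one : A → ℤ
  one _ = 1ℤ

  gradedℕ : (deg : ℕ → ℕ) → (∀ n → n ℕ.≤ deg n) → Graded ℕ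
  gradedℕ deg n≤deg = gradedBy deg (upTo ∘ suc) (Unique.upTo⁺ ∘ suc) (λ n → ∈-upTo⁺ (s≤s (n≤deg n)))

  gradedℕ² : (deg : ℕ × ℕ → ℕ) → (∀ i j → i ℕ.≤ deg (i , j)) → (∀ i j → j ℕ.≤ deg (i , j)) → Graded (ℕ × ℕ)
  gradedℕ² deg i≤deg j≤deg = gradedBy deg
    (λ n → cartesianProduct (upTo (suc n)) (upTo (suc n)))
    (λ n → Unique.cartesianProduct⁺ (Unique.upTo⁺ (suc n)) (Unique.upTo⁺ (suc n)))
    (λ (i , j) → ∈-cartesianProduct⁺ (∈-upTo⁺ (s≤s (i≤deg i j))) (∈-upTo⁺ (s≤s (j≤deg i j))))

  triangle : ℕ → ℕ
  triangle zero    = 0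
  triangle (suc n) = suc n ℕ.+ triangle n

  n≤triangle : ∀ n → n ℕ.≤ triangle n
  n≤triangle zero    = z≤n
  n≤triangle (suc n) = ℕ.m≤m+n (suc n) (triangle n)

  double≡ : ∀ n → double n ≡ n ℕ.+ n
  double≡ zero    = refl
  double≡ (suc n) = cong suc (≡.trans (cong suc (double≡ n)) (sym (ℕ.+-suc n n)))

  n≤double : ∀ n → n ℕ.≤ double n
  n≤double n = subst (n ℕ.≤_) (sym (double≡ n)) (ℕ.m≤m+n n n)

  triangles doubleTriangles squares : Graded ℕ
  triangles       = gradedℕ triangle n≤triangle
  doubleTriangles = gradedℕ (double ∘ triangle) (λ n → ℕ.≤-trans (n≤triangle n) (n≤double (triangle n)))
  squares         = gradedℕ (λ n → suc n ℕ.* suc n) (λ n → ℕ.≤-trans (ℕ.n≤1+n n) (ℕ.m≤m*n (suc n) (suc n)))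

  -- `ψ₂` is ψ(q²). In `squares` the index n stands for n + 1, so `S` starts with q.
  ψ ψ₂ S φ : Series
  ψ  = gen triangles one
  ψ₂ = gen doubleTriangles one
  S  = gen squares one
  φ  = 1# + (S + S)

  data Parity : ℕ → Set where
    isEven : ∀ k → Parity (double k)
    isOdd  : ∀ k → Parity (suc (double k))

  parity : ∀ n → Parity n
  parity zero          = isEven 0
  parity (suc zero)    = isOdd 0
  parity (suc (suc n)) with parity n
  ... | isEven k = isEven (suc k)
  ... | isOdd k  = isOdd (suc k)

  double-injective : ∀ {m n} → double m ≡ double n → m ≡ n
  double-injective {zero}  {zero}  _  = refl
  double-injective {suc m} {suc n} eq = cong suc (double-injective (ℕ.suc-injective (ℕ.suc-injective eq)))

  double≢suc-double : ∀ {m n} → double m ≢ suc (double n)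
  double≢suc-double {suc m} {suc n} eq = double≢suc-double (ℕ.suc-injective (ℕ.suc-injective eq))

  ∑-empty : ∀ {P : A → Set} (E : Enumeration P) {w} → (∀ {x} → ¬ P x) → ∑ (list E) w ≡ 0ℤ
  ∑-empty E ¬P = ≡.trans (∑-cong (list E) (λ x∈ → contradiction (sound E x∈) ¬P)) (∑-0 (list E))

  spread-odd : ∀ f n → spread f (suc (double n)) ≡ 0ℤ
  spread-odd f zero    = refl
  spread-odd f (suc n) = spread-odd (f ∘ suc) n

  gen-dilate : ∀ (G H : Graded A) w → (∀ {x n} → Deg G x n → Deg H x (double n)) →
    (∀ {x m} → Deg H x m → ∃ λ n → m ≡ double n × Deg G x n) → gen H w ≈ dilate (gen G w)
  at (gen-dilate G H w G⇒H H⇒G) m with parity m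
  ... | isEven k = ≡.trans (∑-unique (fibre H (double k)) (fibre G k) H⇒G′ G⇒H (λ _ → refl))
                           (sym (at (even-dilate (gen G w)) k))
    where
    H⇒G′ : ∀ {x} → Deg H x (double k) → Deg G x k
    H⇒G′ {x} d with H⇒G d
    ... | n , eq , d′ = subst (Deg G x) (double-injective (sym eq)) d′
  ... | isOdd k = ≡.trans (∑-empty (fibre H (suc (double k))) impossible)
                          (sym (spread-odd (coeff (gen G w)) k))
    where
    impossible : ∀ {x} → ¬ Deg H x (suc (double k))
    impossible d with H⇒G d
    ... | n , eq , _ = double≢suc-double (sym eq)

  ψ₂≈dilate-ψ : ψ₂ ≈ dilate ψ
  ψ₂≈dilate-ψ = gen-dilate triangles doubleTriangles one (cong double) λ { refl → _ , refl , refl }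

  -- The pairs of triangular numbers T(a), T(b) with a > b, where k = a - b - 1. The diagonal and
  -- two copies of this set make up all pairs.
  upper : Graded (ℕ × ℕ)
  upper = gradedℕ² (λ (b , k) → triangle (suc (b ℕ.+ k)) ℕ.+ triangle b)
    (λ b k → ℕ.≤-trans (n≤triangle b) (ℕ.m≤n+m _ (triangle (suc (b ℕ.+ k)))))
    (λ b k → ℕ.≤-trans (ℕ.≤-trans (ℕ.m≤n+m k (suc b)) (n≤triangle (suc (b ℕ.+ k)))) (ℕ.m≤m+n _ (triangle b)))

  Comparison : Set
  Comparison = ℕ ⊎ ((ℕ × ℕ) ⊎ (ℕ × ℕ))

  raise : Comparison → Comparison
  raise (inj₁ a)              = inj₁ (suc a)
  raise (inj₂ (inj₁ (b , k))) = inj₂ (inj₁ (suc b , k))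
  raise (inj₂ (inj₂ (b , k))) = inj₂ (inj₂ (suc b , k))

  compare : ℕ × ℕ → Comparison
  compare (zero  , zero)  = inj₁ 0
  compare (zero  , suc k) = inj₂ (inj₁ (0 , k))
  compare (suc k , zero)  = inj₂ (inj₂ (0 , k))
  compare (suc a , suc b) = raise (compare (a , b))

  uncompare : Comparison → ℕ × ℕ
  uncompare (inj₁ a)              = a , a
  uncompare (inj₂ (inj₁ (b , k))) = b , suc (b ℕ.+ k)
  uncompare (inj₂ (inj₂ (b , k))) = suc (b ℕ.+ k) , b

  uncompare-raise : ∀ z → uncompare (raise z) ≡ (suc (proj₁ (uncompare z)) , suc (proj₂ (uncompare z)))
  uncompare-raise (inj₁ a)        = refl
  uncompare-raise (inj₂ (inj₁ _)) = refl
  uncompare-raise (inj₂ (inj₂ _)) = refl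

  uncompare-compare : ∀ ab → uncompare (compare ab) ≡ ab
  uncompare-compare (zero  , zero)  = refl
  uncompare-compare (zero  , suc k) = refl
  uncompare-compare (suc k , zero)  = refl
  uncompare-compare (suc a , suc b) = ≡.trans (uncompare-raise (compare (a , b)))
    (cong (λ (x , y) → suc x , suc y) (uncompare-compare (a , b)))

  compare-uncompare : ∀ z → compare (uncompare z) ≡ z
  compare-uncompare (inj₁ zero)                  = refl
  compare-uncompare (inj₁ (suc a))               = cong raise (compare-uncompare (inj₁ a))
  compare-uncompare (inj₂ (inj₁ (zero , k)))     = refl
  compare-uncompare (inj₂ (inj₁ (suc b , k)))    = cong raise (compare-uncompare (inj₂ (inj₁ (b , k))))
  compare-uncompare (inj₂ (inj₂ (zero , k)))     = refl
  compare-uncompare (inj₂ (inj₂ (suc b , k)))    = cong raise (compare-uncompare (inj₂ (inj₂ (b , k))))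

  -- T_a + T_b with a = b + k + 1 is ((a+b+1)/2)² + 2 T_{(a-b-1)/2} for even k and
  -- ((a-b)/2)² + 2 T_{(a+b)/2} for odd k.
  rotate : ℕ × ℕ → ℕ × ℕ
  rotate (b , zero)        = b , 0
  rotate (b , suc zero)    = 0 , suc b
  rotate (b , suc (suc k)) = let i , t = rotate (b , k) in suc i , suc t

  unrotate : ℕ × ℕ → ℕ × ℕ
  unrotate (i     , zero)  = i , 0
  unrotate (zero  , suc t) = t , 1
  unrotate (suc i , suc t) = let b , k = unrotate (i , t) in b , suc (suc k)

  unrotate-rotate : ∀ bk → unrotate (rotate bk) ≡ bk
  unrotate-rotate (b , zero)        = refl
  unrotate-rotate (b , suc zero)    = refl
  unrotate-rotate (b , suc (suc k)) = cong (map₂ (suc ∘ suc)) (unrotate-rotate (b , k))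

  rotate-unrotate : ∀ it → rotate (unrotate it) ≡ it
  rotate-unrotate (i     , zero)  = refl
  rotate-unrotate (zero  , suc t) = refl
  rotate-unrotate (suc i , suc t) = cong (λ (i , t) → suc i , suc t) (rotate-unrotate (i , t))

  -- Raising k by 2 raises both degrees in `rotate-deg`, by 5 + 2(i + t) on one side and by 5 + 2(b
  -- + k) on the other; this invariant makes the increments agree.
  rotate-sum : ∀ b k → proj₁ (rotate (b , k)) ℕ.+ proj₂ (rotate (b , k)) ≡ b ℕ.+ k
  rotate-sum b zero          = refl
  rotate-sum b (suc zero)    = sym (ℕ.+-comm b 1)
  rotate-sum b (suc (suc k)) = ≡.trans (lemma₁ (proj₁ (rotate (b , k))) (proj₂ (rotate (b , k))))
    (≡.trans (cong (suc ∘ suc) (rotate-sum b k)) (lemma₂ b k))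
    where
    lemma₁ : ∀ i t → suc i ℕ.+ suc t ≡ suc (suc (i ℕ.+ t))
    lemma₁ = ℕ-Solver.solve-∀
    lemma₂ : ∀ b k → suc (suc (b ℕ.+ k)) ≡ b ℕ.+ suc (suc k)
    lemma₂ = ℕ-Solver.solve-∀

  triangle-square : ∀ b → triangle (suc b) ℕ.+ triangle b ≡ suc b ℕ.* suc b
  triangle-square zero    = refl
  triangle-square (suc b) = ≡.trans (lemma₁ b (triangle b)) (≡.trans (cong (λ s → s ℕ.+ (b ℕ.+ b ℕ.+ 3)) (triangle-square b)) (lemma₂ b))
    where
    lemma₁ : ∀ b t → (suc (suc b) ℕ.+ (suc b ℕ.+ t)) ℕ.+ (suc b ℕ.+ t) ≡ (suc b ℕ.+ t ℕ.+ t) ℕ.+ (b ℕ.+ b ℕ.+ 3)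
    lemma₁ = ℕ-Solver.solve-∀
    lemma₂ : ∀ b → suc b ℕ.* suc b ℕ.+ (b ℕ.+ b ℕ.+ 3) ≡ suc (suc b) ℕ.* suc (suc b)
    lemma₂ = ℕ-Solver.solve-∀

  rotate-deg : ∀ b k → let i , t = rotate (b , k) in
    suc i ℕ.* suc i ℕ.+ double (triangle t) ≡ triangle (suc (b ℕ.+ k)) ℕ.+ triangle b
  rotate-deg b zero = ≡.trans (ℕ.+-identityʳ _) (≡.trans (sym (triangle-square b))
    (cong (λ x → triangle (suc x) ℕ.+ triangle b) (sym (ℕ.+-identityʳ b))))
  rotate-deg b (suc zero) = ≡.trans (cong suc (double≡ (triangle (suc b))))
    (≡.trans (lemma b (triangle b)) (cong (λ x → triangle (suc x) ℕ.+ triangle b) (sym (ℕ.+-comm b 1))))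
    where
    lemma : ∀ b t → suc ((suc b ℕ.+ t) ℕ.+ (suc b ℕ.+ t)) ≡ (suc (suc b) ℕ.+ (suc b ℕ.+ t)) ℕ.+ t
    lemma = ℕ-Solver.solve-∀
  rotate-deg b (suc (suc k)) with rotate (b , k) | rotate-sum b k | rotate-deg b k
  ... | i , t | i+t≡ | deg≡ = begin
    suc (suc i) ℕ.* suc (suc i) ℕ.+ double (triangle (suc t))
      ≡⟨ cong (ℕ._+_ (suc (suc i) ℕ.* suc (suc i))) (double≡ (triangle (suc t))) ⟩
    suc (suc i) ℕ.* suc (suc i) ℕ.+ (triangle (suc t) ℕ.+ triangle (suc t))
      ≡⟨ lemma₁ i t (triangle t) ⟩
    suc i ℕ.* suc i ℕ.+ (triangle t ℕ.+ triangle t) ℕ.+ (5 ℕ.+ 2 ℕ.* (i ℕ.+ t))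
      ≡⟨ cong₂ (λ x y → suc i ℕ.* suc i ℕ.+ x ℕ.+ (5 ℕ.+ 2 ℕ.* y)) (sym (double≡ (triangle t))) i+t≡ ⟩
    suc i ℕ.* suc i ℕ.+ double (triangle t) ℕ.+ (5 ℕ.+ 2 ℕ.* (b ℕ.+ k))
      ≡⟨ cong (λ x → x ℕ.+ (5 ℕ.+ 2 ℕ.* (b ℕ.+ k))) deg≡ ⟩
    triangle (suc (b ℕ.+ k)) ℕ.+ triangle b ℕ.+ (5 ℕ.+ 2 ℕ.* (b ℕ.+ k))
      ≡⟨ lemma₂ (b ℕ.+ k) (triangle (suc (b ℕ.+ k))) (triangle b) ⟩
    triangle (suc (suc (suc (b ℕ.+ k)))) ℕ.+ triangle b
      ≡⟨ cong (λ x → triangle (suc x) ℕ.+ triangle b) (≡.trans (ℕ.+-suc b (suc k)) (cong suc (ℕ.+-suc b k))) ⟨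
    triangle (suc (b ℕ.+ suc (suc k))) ℕ.+ triangle b ∎
    where
    open ≡-Reasoning
    lemma₁ : ∀ i t x → suc (suc i) ℕ.* suc (suc i) ℕ.+ ((suc t ℕ.+ x) ℕ.+ (suc t ℕ.+ x)) ≡
      suc i ℕ.* suc i ℕ.+ (x ℕ.+ x) ℕ.+ (5 ℕ.+ 2 ℕ.* (i ℕ.+ t))
    lemma₁ = ℕ-Solver.solve-∀
    lemma₂ : ∀ s x y → x ℕ.+ y ℕ.+ (5 ℕ.+ 2 ℕ.* s) ≡ (suc (suc (suc s)) ℕ.+ (suc (suc s) ℕ.+ x)) ℕ.+ y
    lemma₂ = ℕ-Solver.solve-∀

  gen-upper : gen upper one ≈ S * ψ₂
  gen-upper = ≈-trans
    (gen-bijection upper (squares ⊗ doubleTriangles) rotate unrotate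
      (λ { {b , k} refl → _ , _ , rotate-deg b k , refl , refl })
      (λ { {it} (_ , _ , refl , refl , refl) → ≡.trans (sym (rotate-deg (proj₁ (unrotate it)) (proj₂ (unrotate it))))
             (cong (λ (i , t) → suc i ℕ.* suc i ℕ.+ double (triangle t)) (rotate-unrotate it)) })
      (λ {bk} _ → unrotate-rotate bk) (λ {it} _ → rotate-unrotate it) (λ _ → refl))
    (gen-⊗ squares doubleTriangles one one)

  -- The diagonal pairs contribute ψ(q²), and the pairs on either side of the diagonal `S * ψ₂`
  -- each.
  ψ*ψ≈φ*ψ₂ : ψ * ψ ≈ φ * ψ₂
  ψ*ψ≈φ*ψ₂ = begin
    ψ * ψ
      ≈⟨ gen-⊗ triangles triangles one one ⟨
    gen (triangles ⊗ triangles) one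
      ≈⟨ gen-bijection (triangles ⊗ triangles) (doubleTriangles ⊕ upper ⊕ upper) compare uncompare
           (λ { {ab} (_ , _ , refl , refl , refl) → toDeg ab }) (λ {z} → fromDeg z)
           (λ {ab} _ → uncompare-compare ab) (λ {z} _ → compare-uncompare z) (λ _ → refl) ⟩
    gen (doubleTriangles ⊕ upper ⊕ upper) one
      ≈⟨ ≈-trans (gen-⊕ doubleTriangles (upper ⊕ upper) one) (+-congˡ (gen-⊕ upper upper one)) ⟩
    ψ₂ + (gen upper one + gen upper one)
      ≈⟨ +-congˡ (+-cong gen-upper gen-upper) ⟩
    ψ₂ + (S * ψ₂ + S * ψ₂)
      ≈⟨ solve 2 (λ s p → p :+ (s :* p :+ s :* p) := (con 1ℤ :+ (s :+ s)) :* p) ≈-refl S ψ₂ ⟩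
    φ * ψ₂ ∎
    where
    open ≈-Reasoning
    G = doubleTriangles ⊕ upper ⊕ upper

    fromDeg : ∀ z {n} → Deg G z n → Deg (triangles ⊗ triangles) (uncompare z) n
    fromDeg (inj₁ a) refl = _ , _ , sym (double≡ (triangle a)) , refl , refl
    fromDeg (inj₂ (inj₁ (b , k))) refl = _ , _ , ℕ.+-comm (triangle b) _ , refl , refl
    fromDeg (inj₂ (inj₂ (b , k))) refl = _ , _ , refl , refl , refl

    deg-exists : ∀ z → ∃ (Deg G z)
    deg-exists (inj₁ a)        = _ , refl
    deg-exists (inj₂ (inj₁ _)) = _ , refl
    deg-exists (inj₂ (inj₂ _)) = _ , refl

    -- The degree of `compare ab` is found on the way back: `fromDeg` gives it as the degree of
    -- `uncompare (compare ab)`, which is `ab`.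
    toDeg : ∀ ab → Deg G (compare ab) (triangle (proj₁ ab) ℕ.+ triangle (proj₂ ab))
    toDeg ab with deg-exists (compare ab)
    ... | n , d with subst (λ x → Deg (triangles ⊗ triangles) x n) (uncompare-compare ab) (fromDeg (compare ab) d)
    ... | _ , _ , eq , refl , refl = subst (Deg G (compare ab)) (sym eq) d

  -- The number of representations by four triangular numbers

  odds : Graded (ℕ × ℕ)
  odds = gradedℕ² (λ (u , v) → v ℕ.+ u ℕ.* suc (2 ℕ.* v))
    (λ u v → ℕ.≤-trans (ℕ.m≤m*n u (suc (2 ℕ.* v))) (ℕ.m≤n+m _ v))
    (λ u v → ℕ.m≤m+n v _)

  oddsDeg : ℕ × ℕ → ℕ
  oddsDeg (u , v) = v ℕ.+ u ℕ.* suc (2 ℕ.* v)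

  2x+1 : ℤ → ℤ
  2x+1 x = 1ℤ ℤ.+ + 2 ℤ.* x

  -- The coefficient at n is the sum of the divisors d = 2u + 1 of 2n + 1 = (2u + 1)(2v + 1).
  σ-odd : Series
  σ-odd = gen odds (λ (u , v) → 2x+1 (+ u))

  -- T(β) = β(β + 1)/2 at all integers. The equality of its values at β and -1 - β reflects the
  -- passage from b to - b, where b = 2β + 1 and b² = 8T(β) + 1.
  triangleℤ : ℤ → ℕ
  triangleℤ (+ n)    = triangle n
  triangleℤ -[1+ n ] = triangle n

  opposite : ℤ → ℤ
  opposite (+ n)    = -[1+ n ]
  opposite -[1+ n ] = + n

  opposite≡ : ∀ β → opposite β ≡ -[1+ 0 ] ℤ.- β
  opposite≡ (+ zero)  = refl
  opposite≡ (+ suc n) = refl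
  opposite≡ -[1+ n ]  = refl

  triangleℤ-opposite : ∀ β → triangleℤ (opposite β) ≡ triangleℤ β
  triangleℤ-opposite (+ n)    = refl
  triangleℤ-opposite -[1+ n ] = refl

  2*triangle : ∀ n → + 2 ℤ.* + triangle n ≡ + n ℤ.* + n ℤ.+ + n
  2*triangle zero    = refl
  2*triangle (suc n) = ≡.trans (lemma₁ (+ n) (+ triangle n))
    (≡.trans (cong (λ x → + 2 ℤ.* (1ℤ ℤ.+ + n) ℤ.+ x) (2*triangle n)) (lemma₂ (+ n)))
    where
    lemma₁ : ∀ n t → + 2 ℤ.* ((1ℤ ℤ.+ n) ℤ.+ t) ≡ + 2 ℤ.* (1ℤ ℤ.+ n) ℤ.+ + 2 ℤ.* t
    lemma₁ = solve-∀
    lemma₂ : ∀ n → + 2 ℤ.* (1ℤ ℤ.+ n) ℤ.+ (n ℤ.* n ℤ.+ n) ≡ (1ℤ ℤ.+ n) ℤ.* (1ℤ ℤ.+ n) ℤ.+ (1ℤ ℤ.+ n)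
    lemma₂ = solve-∀

  2*triangleℤ : ∀ β → + 2 ℤ.* + triangleℤ β ≡ β ℤ.* β ℤ.+ β
  2*triangleℤ (+ n)    = 2*triangle n
  2*triangleℤ -[1+ n ] = ≡.trans (2*triangle n) (lemma (+ n))
    where
    lemma : ∀ n → n ℤ.* n ℤ.+ n ≡ (ℤ.- (1ℤ ℤ.+ n)) ℤ.* (ℤ.- (1ℤ ℤ.+ n)) ℤ.+ (ℤ.- (1ℤ ℤ.+ n))
    lemma = solve-∀

  +oddsDeg : ∀ u v → + oddsDeg (u , v) ≡ + v ℤ.+ + u ℤ.* 2x+1 (+ v)
  +oddsDeg u v = cong (ℤ._+_ (+ v)) (≡.trans (ℤ.pos-* u (suc (2 ℕ.* v)))
    (cong (λ x → + u ℤ.* (1ℤ ℤ.+ x)) (ℤ.pos-* 2 v)))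

  -- Liouville's method.  A solution of b² + 4ac = 8n + 5 with b odd and a, c > 0 is
  -- written as b = 2β + 1, a = 2u + 1, c = 2v + 1.  Since a + b - c = 2(u + β - v) + 1 is
  -- odd, it is positive or negative.  The solutions with a + b - c > 0 are parametrised by
  -- (u , v , w) with w = u + β - v ≥ 0; they carry the involution (a , c , a + b - c) ↦
  -- (a + b - c , c , a), and (a , b , c) ↦ (c , - b , a) exchanges both kinds.

  triangleFormDeg : ℕ × ℕ × ℕ → ℕ
  triangleFormDeg (u , v , w) = triangleℤ (+ w ℤ.+ + v ℤ.- + u) ℕ.+ oddsDeg (u , v)

  reverse : ℕ × ℕ × ℕ → ℕ × ℕ × ℕ
  reverse (u , v , w) = w , v , u

  -- With e = a + b - c the form b² + 4ac becomes a² + c² + e² + 2ac + 2ce - 2ae, which is symmetric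
  -- in a and e. The degree is doubled to clear the denominator of T(β).
  triangleFormDeg-reverse : ∀ t → triangleFormDeg (reverse t) ≡ triangleFormDeg t
  triangleFormDeg-reverse (u , v , w) = ℤ.+-injective (ℤ.*-cancelˡ-≡ (+ 2) _ _
    (≡.trans (expand w v u) (≡.trans (symmetric (+ u) (+ v) (+ w)) (sym (expand u v w)))))
    where
    symmetric : ∀ u v w →
      ((u ℤ.+ v ℤ.- w) ℤ.* (u ℤ.+ v ℤ.- w) ℤ.+ (u ℤ.+ v ℤ.- w)) ℤ.+ + 2 ℤ.* (v ℤ.+ w ℤ.* (1ℤ ℤ.+ + 2 ℤ.* v)) ≡
      ((w ℤ.+ v ℤ.- u) ℤ.* (w ℤ.+ v ℤ.- u) ℤ.+ (w ℤ.+ v ℤ.- u)) ℤ.+ + 2 ℤ.* (v ℤ.+ u ℤ.* (1ℤ ℤ.+ + 2 ℤ.* v))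
    symmetric = solve-∀
    expand : ∀ u v w → let β = + w ℤ.+ + v ℤ.- + u in
      + 2 ℤ.* + triangleFormDeg (u , v , w) ≡ (β ℤ.* β ℤ.+ β) ℤ.+ + 2 ℤ.* (+ v ℤ.+ + u ℤ.* 2x+1 (+ v))
    expand u v w = let β = + w ℤ.+ + v ℤ.- + u in
      ≡.trans (ℤ.*-distribˡ-+ (+ 2) (+ triangleℤ β) (+ oddsDeg (u , v)))
        (cong₂ ℤ._+_ (2*triangleℤ β) (cong (ℤ._*_ (+ 2)) (+oddsDeg u v)))

  positiveForms : Graded (ℕ × ℕ × ℕ)
  positiveForms = gradedBy triangleFormDeg
    (λ n → cartesianProduct (upTo (suc n)) (cartesianProduct (upTo (suc n)) (upTo (suc n))))
    (λ n → let upTo! = Unique.upTo⁺ (suc n) in Unique.cartesianProduct⁺ upTo! (Unique.cartesianProduct⁺ upTo! upTo!))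
    (λ t@(u , v , w) → ∈-cartesianProduct⁺ (∈-upTo⁺ (s≤s (u≤ t)))
      (∈-cartesianProduct⁺ (∈-upTo⁺ (s≤s (v≤ t)))
        -- The degree shows no direct bound for `w`, but `reverse` moves it to the first component
        -- without changing the degree.
        (∈-upTo⁺ (s≤s (subst (w ℕ.≤_) (triangleFormDeg-reverse t) (u≤ (reverse t)))))))
    where
    u≤ : ∀ t → proj₁ t ℕ.≤ triangleFormDeg t
    u≤ (u , v , w) = ℕ.≤-trans (ℕ.m≤m*n u (suc (2 ℕ.* v))) (ℕ.≤-trans (ℕ.m≤n+m _ v) (ℕ.m≤n+m _ (triangleℤ (+ w ℤ.+ + v ℤ.- + u))))
    v≤ : ∀ t → proj₁ (proj₂ t) ℕ.≤ triangleFormDeg t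
    v≤ (u , v , w) = ℕ.≤-trans (ℕ.m≤m+n v _) (ℕ.m≤n+m _ (triangleℤ (+ w ℤ.+ + v ℤ.- + u)))

  trianglesℤ : Graded ℤ
  trianglesℤ = gradedBy triangleℤ
    (λ n → map +_ (upTo (suc n)) ++ map -[1+_] (upTo (suc n)))
    (λ n → Unique.++⁺ (Unique.map⁺ ℤ.+-injective (Unique.upTo⁺ (suc n)))
                      (Unique.map⁺ ℤ.-[1+-injective (Unique.upTo⁺ (suc n))) disjoint)
    λ { (+ n)    → ∈-++⁺ˡ (∈-map⁺ +_ (∈-upTo⁺ (s≤s (n≤triangle n))))
      ; -[1+ n ] → ∈-++⁺ʳ (map +_ (upTo (suc (triangle n)))) (∈-map⁺ -[1+_] (∈-upTo⁺ (s≤s (n≤triangle n)))) }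
    where
    disjoint : ∀ {xs ys z} → ¬ (z ∈ map +_ xs × z ∈ map -[1+_] ys)
    disjoint (p , q) with ∈-map⁻ +_ p | ∈-map⁻ -[1+_] q
    ... | _ , _ , refl | _ , _ , ()

  -- The integer is x = u + β - v, and a + b - c = 2x + 1. If it is negative, the form is replaced
  -- by (c, - b, a), for which a + b - c changes sign; hence the exchange of u and v.
  classify : ℤ → ℕ × ℕ → (ℕ × ℕ × ℕ) ⊎ (ℕ × ℕ × ℕ)
  classify (+ w)    (u , v) = inj₁ (u , v , w)
  classify -[1+ w ] (u , v) = inj₂ (v , u , w)

  toForms : ℤ × ℕ × ℕ → (ℕ × ℕ × ℕ) ⊎ (ℕ × ℕ × ℕ)
  toForms (β , u , v) = classify (+ u ℤ.+ β ℤ.- + v) (u , v)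

  fromForms : (ℕ × ℕ × ℕ) ⊎ (ℕ × ℕ × ℕ) → ℤ × ℕ × ℕ
  fromForms (inj₁ (u , v , w)) = + w ℤ.+ + v ℤ.- + u , u , v
  fromForms (inj₂ (u , v , w)) = opposite (+ w ℤ.+ + v ℤ.- + u) , v , u

  fromForms-classify : ∀ x u v → fromForms (classify x (u , v)) ≡ (x ℤ.+ + v ℤ.- + u , u , v)
  fromForms-classify (+ w)    u v = refl
  fromForms-classify -[1+ w ] u v = cong (_, u , v) (≡.trans (opposite≡ _) (lemma (+ w) (+ u) (+ v)))
    where
    lemma : ∀ w u v → -[1+ 0 ] ℤ.- (w ℤ.+ u ℤ.- v) ≡ ℤ.- (1ℤ ℤ.+ w) ℤ.+ v ℤ.- u
    lemma = solve-∀

  fromForms-toForms : ∀ t → fromForms (toForms t) ≡ t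
  fromForms-toForms (β , u , v) = ≡.trans (fromForms-classify (+ u ℤ.+ β ℤ.- + v) u v)
    (cong (_, u , v) (lemma β (+ u) (+ v)))
    where
    lemma : ∀ β u v → (u ℤ.+ β ℤ.- v) ℤ.+ v ℤ.- u ≡ β
    lemma = solve-∀

  toForms-fromForms : ∀ z → toForms (fromForms z) ≡ z
  toForms-fromForms (inj₁ (u , v , w)) = cong (λ x → classify x (u , v)) (lemma (+ u) (+ v) (+ w))
    where
    lemma : ∀ u v w → u ℤ.+ (w ℤ.+ v ℤ.- u) ℤ.- v ≡ w
    lemma = solve-∀
  toForms-fromForms (inj₂ (u , v , w)) = cong (λ x → classify x (v , u))
    (≡.trans (cong (λ x → + v ℤ.+ x ℤ.- + u) (opposite≡ (+ w ℤ.+ + v ℤ.- + u))) (lemma (+ u) (+ v) (+ w)))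
    where
    lemma : ∀ u v w → v ℤ.+ (-[1+ 0 ] ℤ.- (w ℤ.+ v ℤ.- u)) ℤ.- u ≡ ℤ.- (1ℤ ℤ.+ w)
    lemma = solve-∀

  oddsDeg-swap : ∀ u v → oddsDeg (u , v) ≡ oddsDeg (v , u)
  oddsDeg-swap = lemma
    where
    lemma : ∀ u v → v ℕ.+ u ℕ.* suc (2 ℕ.* v) ≡ u ℕ.+ v ℕ.* suc (2 ℕ.* u)
    lemma = ℕ-Solver.solve-∀

  DegForms : ℤ × ℕ × ℕ → ℕ
  DegForms (β , uv) = triangleℤ β ℕ.+ oddsDeg uv

  deg-fromForms : ∀ z {n} → Deg (positiveForms ⊕ positiveForms) z n → DegForms (fromForms z) ≡ n
  deg-fromForms (inj₁ t) refl = refl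
  deg-fromForms (inj₂ (u , v , w)) refl = cong₂ ℕ._+_ (triangleℤ-opposite (+ w ℤ.+ + v ℤ.- + u)) (oddsDeg-swap v u)

  forms≅positiveForms : ∀ F → gen (trianglesℤ ⊗ odds) F ≈ gen (positiveForms ⊕ positiveForms) (F ∘ fromForms)
  forms≅positiveForms F = gen-bijection (trianglesℤ ⊗ odds) (positiveForms ⊕ positiveForms) toForms fromForms
    (λ { {t} (_ , _ , refl , refl , refl) → toDeg t })
    (λ {z} d → _ , _ , deg-fromForms z d , refl , refl)
    (λ {t} _ → fromForms-toForms t) (λ {z} _ → toForms-fromForms z)
    (λ {t} _ → cong F (sym (fromForms-toForms t)))
    where
    deg-exists : ∀ z → ∃ (Deg (positiveForms ⊕ positiveForms) z)
    deg-exists (inj₁ _) = _ , refl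
    deg-exists (inj₂ _) = _ , refl

    toDeg : ∀ t → Deg (positiveForms ⊕ positiveForms) (toForms t) (DegForms t)
    toDeg t with deg-exists (toForms t)
    ... | n , d = subst (Deg (positiveForms ⊕ positiveForms) (toForms t))
      (≡.trans (sym (deg-fromForms (toForms t) d)) (cong DegForms (fromForms-toForms t))) d

  trianglesℤ≅ : ∀ F → gen (trianglesℤ ⊗ odds) F ≈
    gen (triangles ⊗ odds) (λ (n , uv) → F (+ n , uv)) + gen (triangles ⊗ odds) (λ (n , uv) → F (-[1+ n ] , uv))
  trianglesℤ≅ F = ≈-trans
    (gen-bijection (trianglesℤ ⊗ odds) ((triangles ⊗ odds) ⊕ (triangles ⊗ odds)) to from
      (λ { {+ n , _} d → d ; { -[1+ n ] , _} d → d }) (λ { {inj₁ _} d → d ; {inj₂ _} d → d })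
      (λ { {+ n , _} _ → refl ; { -[1+ n ] , _} _ → refl }) (λ { {inj₁ _} _ → refl ; {inj₂ _} _ → refl })
      (λ { {+ n , _} _ → refl ; { -[1+ n ] , _} _ → refl }))
    (gen-⊕ (triangles ⊗ odds) (triangles ⊗ odds) (F ∘ from))
    where
    to : ℤ × ℕ × ℕ → (ℕ × ℕ × ℕ) ⊎ (ℕ × ℕ × ℕ)
    to (+ n      , uv) = inj₁ (n , uv)
    to (-[1+ n ] , uv) = inj₂ (n , uv)
    from : (ℕ × ℕ × ℕ) ⊎ (ℕ × ℕ × ℕ) → ℤ × ℕ × ℕ
    from (inj₁ (n , uv)) = + n , uv
    from (inj₂ (n , uv)) = -[1+ n ] , uv

  -- If ac = 2j + 1 and b² = 8T + 1, then ac - b² = 2(j - 4T). The weights of one degree therefore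
  -- add up to twice the coefficient of `ψ * θ σ-odd` minus 4 times `σ-odd * θ ψ`.
  liouvilleWeight : ℤ → ℤ → ℤ → ℤ
  liouvilleWeight a b c = a ℤ.* (a ℤ.* c ℤ.- b ℤ.* b)

  -- The odd part - b a² cancels in the sum over all forms; it is chosen such that the
  -- weight, added up over the orbit of a form with a + b - c > 0, vanishes.
  weight : ℤ → ℤ → ℤ → ℤ
  weight a b c = a ℤ.* (a ℤ.* c ℤ.- b ℤ.* b) ℤ.- b ℤ.* (a ℤ.* a)

  formWeight : ℤ × ℕ × ℕ → ℤ
  formWeight (β , u , v) = weight (2x+1 (+ u)) (2x+1 β) (2x+1 (+ v))

  orbitWeight : ℕ × ℕ × ℕ → ℤ
  orbitWeight t = formWeight (fromForms (inj₁ t)) ℤ.+ formWeight (fromForms (inj₂ t))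

  -- The four forms are (a, b, c) and (e, a + c - e, c), with e = a + b - c, and their images under
  -- (a, b, c) ↦ (c, - b, a). Written in a, c and e, the sum of their weights is the zero
  -- polynomial.
  orbitWeight-reverse : ∀ t → orbitWeight t ℤ.+ orbitWeight (reverse t) ≡ 0ℤ
  orbitWeight-reverse (u , v , w) = ≡.trans
    (cong₂ (λ x y → (formWeight (fromForms (inj₁ (u , v , w))) ℤ.+ weight (2x+1 (+ v)) (2x+1 x) (2x+1 (+ u))) ℤ.+
                    (formWeight (fromForms (inj₁ (w , v , u))) ℤ.+ weight (2x+1 (+ v)) (2x+1 y) (2x+1 (+ w))))
      (opposite≡ (+ w ℤ.+ + v ℤ.- + u)) (opposite≡ (+ u ℤ.+ + v ℤ.- + w)))
    (vanish (+ u) (+ v) (+ w))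
    where
    polynomial : ∀ a c e →
      let W = λ a b c → a ℤ.* (a ℤ.* c ℤ.- b ℤ.* b) ℤ.- b ℤ.* (a ℤ.* a) in
      (W a (e ℤ.+ c ℤ.- a) c ℤ.+ W c (ℤ.- (e ℤ.+ c ℤ.- a)) a) ℤ.+ (W e (a ℤ.+ c ℤ.- e) c ℤ.+ W c (ℤ.- (a ℤ.+ c ℤ.- e)) e) ≡ 0ℤ
    polynomial = solve-∀
    b≡ : ∀ w v u → 1ℤ ℤ.+ + 2 ℤ.* (w ℤ.+ v ℤ.- u) ≡ (1ℤ ℤ.+ + 2 ℤ.* w) ℤ.+ (1ℤ ℤ.+ + 2 ℤ.* v) ℤ.- (1ℤ ℤ.+ + 2 ℤ.* u)
    b≡ = solve-∀
    -b≡ : ∀ w v u → 1ℤ ℤ.+ + 2 ℤ.* (-[1+ 0 ] ℤ.- (w ℤ.+ v ℤ.- u)) ≡ ℤ.- ((1ℤ ℤ.+ + 2 ℤ.* w) ℤ.+ (1ℤ ℤ.+ + 2 ℤ.* v) ℤ.- (1ℤ ℤ.+ + 2 ℤ.* u))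
    -b≡ = solve-∀
    vanish : ∀ u v w →
      (weight (2x+1 u) (2x+1 (w ℤ.+ v ℤ.- u)) (2x+1 v) ℤ.+ weight (2x+1 v) (2x+1 (-[1+ 0 ] ℤ.- (w ℤ.+ v ℤ.- u))) (2x+1 u)) ℤ.+
      (weight (2x+1 w) (2x+1 (u ℤ.+ v ℤ.- w)) (2x+1 v) ℤ.+ weight (2x+1 v) (2x+1 (-[1+ 0 ] ℤ.- (u ℤ.+ v ℤ.- w))) (2x+1 w)) ≡ 0ℤ
    vanish u v w = ≡.trans
      (cong₂ ℤ._+_ (cong₂ (λ x y → weight (2x+1 u) x (2x+1 v) ℤ.+ weight (2x+1 v) y (2x+1 u)) (b≡ w v u) (-b≡ w v u))
                   (cong₂ (λ x y → weight (2x+1 w) x (2x+1 v) ℤ.+ weight (2x+1 v) y (2x+1 w)) (b≡ u v w) (-b≡ u v w)))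
      (polynomial (2x+1 u) (2x+1 v) (2x+1 w))

  gen-0 : ∀ (G : Graded A) {w} → (∀ x → w x ≡ 0ℤ) → gen G w ≈ 0#
  at (gen-0 G w≡0) n = ≡.trans (∑-cong (list (fibre G n)) (λ {x} _ → w≡0 x)) (∑-0 (list (fibre G n)))

  f+f≈0⇒f≈0 : ∀ f → f + f ≈ 0# → f ≈ 0#
  at (f+f≈0⇒f≈0 f 2f≈0) n = ℤ.*-cancelˡ-≡ (+ 2) (coeff f n) 0ℤ (≡.trans (lemma (coeff f n)) (at 2f≈0 n))
    where
    lemma : ∀ x → + 2 ℤ.* x ≡ x ℤ.+ x
    lemma = solve-∀

  -- Adding `weight` for b and - b doubles its even part and cancels its odd part, so twice the sum
  -- runs over all forms with b of either sign; these are regrouped into orbits.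
  liouville : gen (triangles ⊗ odds) (λ (n , u , v) → liouvilleWeight (2x+1 (+ u)) (2x+1 (+ n)) (2x+1 (+ v))) ≈ 0#
  liouville = f+f≈0⇒f≈0 _ (begin
    gen (triangles ⊗ odds) L + gen (triangles ⊗ odds) L
      ≈⟨ gen-+ (triangles ⊗ odds) L L ⟨
    gen (triangles ⊗ odds) (λ t → L t ℤ.+ L t)
      ≈⟨ gen-cong (triangles ⊗ odds) (λ { {n , u , v} _ → even-part n u v }) ⟩
    gen (triangles ⊗ odds) (λ (n , uv) → formWeight (+ n , uv) ℤ.+ formWeight (-[1+ n ] , uv))
      ≈⟨ gen-+ (triangles ⊗ odds) (λ (n , uv) → formWeight (+ n , uv)) (λ (n , uv) → formWeight (-[1+ n ] , uv)) ⟩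
    gen (triangles ⊗ odds) (λ (n , uv) → formWeight (+ n , uv)) + gen (triangles ⊗ odds) (λ (n , uv) → formWeight (-[1+ n ] , uv))
      ≈⟨ trianglesℤ≅ formWeight ⟨
    gen (trianglesℤ ⊗ odds) formWeight
      ≈⟨ forms≅positiveForms formWeight ⟩
    gen (positiveForms ⊕ positiveForms) (formWeight ∘ fromForms)
      ≈⟨ gen-⊕ positiveForms positiveForms (formWeight ∘ fromForms) ⟩
    gen positiveForms (formWeight ∘ fromForms ∘ inj₁) + gen positiveForms (formWeight ∘ fromForms ∘ inj₂)
      ≈⟨ gen-+ positiveForms (formWeight ∘ fromForms ∘ inj₁) (formWeight ∘ fromForms ∘ inj₂) ⟨
    gen positiveForms orbitWeight
      ≈⟨ orbits-cancel ⟩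
    0# ∎)
    where
    open ≈-Reasoning
    L : ℕ × ℕ × ℕ → ℤ
    L (n , u , v) = liouvilleWeight (2x+1 (+ u)) (2x+1 (+ n)) (2x+1 (+ v))

    even-part : ∀ n u v → L (n , u , v) ℤ.+ L (n , u , v) ≡ formWeight (+ n , u , v) ℤ.+ formWeight (-[1+ n ] , u , v)
    even-part n u v = ≡.trans (lemma (2x+1 (+ u)) (2x+1 (+ n)) (2x+1 (+ v)))
      (cong (λ b → formWeight (+ n , u , v) ℤ.+ weight (2x+1 (+ u)) b (2x+1 (+ v))) (lemma′ (+ n)))
      where
      lemma′ : ∀ n → ℤ.- (1ℤ ℤ.+ + 2 ℤ.* n) ≡ 1ℤ ℤ.+ + 2 ℤ.* (ℤ.- (1ℤ ℤ.+ n))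
      lemma′ = solve-∀
      lemma : ∀ a b c → a ℤ.* (a ℤ.* c ℤ.- b ℤ.* b) ℤ.+ a ℤ.* (a ℤ.* c ℤ.- b ℤ.* b) ≡
        (a ℤ.* (a ℤ.* c ℤ.- b ℤ.* b) ℤ.- b ℤ.* (a ℤ.* a)) ℤ.+
        (a ℤ.* (a ℤ.* c ℤ.- ℤ.- b ℤ.* ℤ.- b) ℤ.- ℤ.- b ℤ.* (a ℤ.* a))
      lemma = solve-∀

    -- `reverse` fixes the forms with u = w, so the whole sum is doubled instead of being split into
    -- pairs.
    orbits-cancel : gen positiveForms orbitWeight ≈ 0#
    orbits-cancel = f+f≈0⇒f≈0 _ (begin
      gen positiveForms orbitWeight + gen positiveForms orbitWeight
        ≈⟨ +-congˡ (gen-bijection positiveForms positiveForms reverse reverse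
             (λ { {t} refl → triangleFormDeg-reverse t }) (λ { {t} refl → triangleFormDeg-reverse t })
             (λ _ → refl) (λ _ → refl) (λ _ → refl)) ⟩
      gen positiveForms orbitWeight + gen positiveForms (orbitWeight ∘ reverse)
        ≈⟨ gen-+ positiveForms orbitWeight (orbitWeight ∘ reverse) ⟨
      gen positiveForms (λ t → orbitWeight t ℤ.+ orbitWeight (reverse t))
        ≈⟨ gen-0 positiveForms orbitWeight-reverse ⟩
      0# ∎)

  -- The equation θF/F = 4 θψ/ψ for F = `σ-odd`, with denominators cleared. Twice the difference of
  -- its sides is the series in `liouville`.
  σ-odd-recurrence : ψ * θ σ-odd ≈ constant (+ 4) * (σ-odd * θ ψ)
  σ-odd-recurrence = ≈-trans (difference≈0⇒≈ (≈-trans (≈-sym expand) (f+f≈0⇒f≈0 _ (≈-trans twice liouville)))) 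
    (*-congˡ (solve 2 (λ f g → f :* g := g :* f) ≈-refl (θ ψ) σ-odd))
    where
    difference≈0⇒≈ : ∀ {f g} → f - g ≈ 0# → f ≈ g
    at (difference≈0⇒≈ {f} {g} f-g≈0) n = ℤ.i-j≡0⇒i≡j (coeff f n) (coeff g n) (at f-g≈0 n)
    w₁ w₂ w₃ : ℕ × ℕ × ℕ → ℤ
    w₁ (n , u , v) = 1ℤ ℤ.* (+ oddsDeg (u , v) ℤ.* 2x+1 (+ u))
    w₂ (n , u , v) = (+ triangle n ℤ.* 1ℤ) ℤ.* 2x+1 (+ u)
    w₃ t = w₁ t ℤ.+ ℤ.- + 4 ℤ.* w₂ t

    expand : gen (triangles ⊗ odds) w₃ ≈ ψ * θ σ-odd - constant (+ 4) * (θ ψ * σ-odd)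
    expand = begin
      gen (triangles ⊗ odds) w₃
        ≈⟨ ≈-trans (gen-+ (triangles ⊗ odds) w₁ _) (+-congˡ (gen-*ˡ (triangles ⊗ odds) (ℤ.- + 4) w₂)) ⟩
      gen (triangles ⊗ odds) w₁ + constant (ℤ.- + 4) * gen (triangles ⊗ odds) w₂
        ≈⟨ +-cong (≈-trans (gen-⊗ triangles odds one (λ uv → + oddsDeg uv ℤ.* 2x+1 (+ proj₁ uv)))
                           (*-congˡ (gen-θ odds oddsDeg (λ d → d) (λ uv → 2x+1 (+ proj₁ uv)))))
                  (*-congˡ (≈-trans (gen-⊗ triangles odds (λ n → + triangle n ℤ.* 1ℤ) (λ uv → 2x+1 (+ proj₁ uv)))
                                    (*-congʳ (gen-θ triangles triangle (λ d → d) one)))) ⟩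
      ψ * θ σ-odd + constant (ℤ.- + 4) * (θ ψ * σ-odd)
        ≈⟨ solve 2 (λ f g → f :+ con (ℤ.- + 4) :* g := f :- con (+ 4) :* g) ≈-refl (ψ * θ σ-odd) (θ ψ * σ-odd) ⟩
      ψ * θ σ-odd - constant (+ 4) * (θ ψ * σ-odd) ∎
      where open ≈-Reasoning

    twice : gen (triangles ⊗ odds) w₃ + gen (triangles ⊗ odds) w₃ ≈
      gen (triangles ⊗ odds) (λ (n , u , v) → liouvilleWeight (2x+1 (+ u)) (2x+1 (+ n)) (2x+1 (+ v)))
    twice = ≈-trans (≈-sym (gen-+ (triangles ⊗ odds) w₃ w₃)) (gen-cong (triangles ⊗ odds) λ { {n , u , v} _ → twice-weight n u v })
      where
      twice-weight : ∀ n u v → w₃ (n , u , v) ℤ.+ w₃ (n , u , v) ≡ liouvilleWeight (2x+1 (+ u)) (2x+1 (+ n)) (2x+1 (+ v))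
      twice-weight n u v = ≡.trans (cong (λ e → let w = 1ℤ ℤ.* (e ℤ.* 2x+1 (+ u)) ℤ.+ ℤ.- + 4 ℤ.* w₂ (n , u , v) in w ℤ.+ w) (+oddsDeg u v))
        (≡.trans (lemma₁ (+ triangle n) (+ u) (+ v))
        (≡.trans (cong (λ s → (1ℤ ℤ.+ + 2 ℤ.* + u) ℤ.* ((1ℤ ℤ.+ + 2 ℤ.* + u) ℤ.* (1ℤ ℤ.+ + 2 ℤ.* + v) ℤ.- (1ℤ ℤ.+ + 4 ℤ.* s))) (2*triangle n))
        (lemma₂ (+ n) (+ u) (+ v))))
        where
        lemma₁ : ∀ t u v →
          let w = 1ℤ ℤ.* ((v ℤ.+ u ℤ.* (1ℤ ℤ.+ + 2 ℤ.* v)) ℤ.* (1ℤ ℤ.+ + 2 ℤ.* u)) ℤ.+ ℤ.- + 4 ℤ.* (t ℤ.* 1ℤ ℤ.* (1ℤ ℤ.+ + 2 ℤ.* u)) in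
          w ℤ.+ w ≡ (1ℤ ℤ.+ + 2 ℤ.* u) ℤ.* ((1ℤ ℤ.+ + 2 ℤ.* u) ℤ.* (1ℤ ℤ.+ + 2 ℤ.* v) ℤ.- (1ℤ ℤ.+ + 4 ℤ.* (+ 2 ℤ.* t)))
        lemma₁ = solve-∀
        lemma₂ : ∀ n u v → (1ℤ ℤ.+ + 2 ℤ.* u) ℤ.* ((1ℤ ℤ.+ + 2 ℤ.* u) ℤ.* (1ℤ ℤ.+ + 2 ℤ.* v) ℤ.- (1ℤ ℤ.+ + 4 ℤ.* (n ℤ.* n ℤ.+ n))) ≡
          (1ℤ ℤ.+ + 2 ℤ.* u) ℤ.* ((1ℤ ℤ.+ + 2 ℤ.* u) ℤ.* (1ℤ ℤ.+ + 2 ℤ.* v) ℤ.- (1ℤ ℤ.+ + 2 ℤ.* n) ℤ.* (1ℤ ℤ.+ + 2 ℤ.* n))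
        lemma₂ = solve-∀

  -- The equation is linear, so the difference d satisfies it too. As p has constant term 1 and θ p
  -- has none, it determines n times the coefficient of d at n from earlier coefficients.
  θ-unique : ∀ {p f g} c → coeff p 0 ≡ 1ℤ → coeff f 0 ≡ coeff g 0 →
    p * θ f ≈ constant c * (f * θ p) → p * θ g ≈ constant c * (g * θ p) → f ≈ g
  at (θ-unique {p} {f} {g} c p₀≡1 f₀≡g₀ f-eq g-eq) n = ℤ.i-j≡0⇒i≡j (coeff f n) (coeff g n) (d≡0 n)
    where
    d : Series
    d = f - g

    d-eq : p * θ d ≈ θ p * (constant c * d)
    d-eq = begin
      p * θ d ≈⟨ *-congˡ (pointwise λ n → lemma (+ n) (coeff f n) (coeff g n)) ⟩
      p * (θ f - θ g) ≈⟨ solve 3 (λ p a b → p :* (a :- b) := p :* a :- p :* b) ≈-refl p (θ f) (θ g) ⟩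
      p * θ f - p * θ g ≈⟨ +-cong f-eq (-‿cong g-eq) ⟩
      constant c * (f * θ p) - constant c * (g * θ p)
        ≈⟨ solve 4 (λ k p a b → k :* (a :* p) :- k :* (b :* p) := p :* (k :* (a :- b))) ≈-refl (constant c) (θ p) f g ⟩
      θ p * (constant c * d) ∎
      where
      open ≈-Reasoning
      lemma : ∀ n a b → n ℤ.* (a ℤ.- b) ≡ n ℤ.* a ℤ.- n ℤ.* b
      lemma = solve-∀

    vanishes : ∀ n → Vanishes (suc n) d
    vanishes zero    {zero} _ = ≡.trans (cong (ℤ._- coeff g 0) f₀≡g₀) (ℤ.+-inverseʳ (coeff g 0))
    vanishes zero    {suc j} (s≤s ())
    vanishes (suc n) {j} (s≤s j≤1+n) with ℕ.m≤n⇒m<n∨m≡n j≤1+n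
    ... | inj₁ j<1+n = vanishes n j<1+n
    ... | inj₂ refl = [ (λ ()) , (λ eq → eq) ] (ℤ.i*j≡0⇒i≡0∨j≡0 (+ suc n) (θd≡0 (ℕ.n<1+n (suc n))))
      where
      -- `θ p` starts in degree 1, so the product vanishes one degree further than `d` is known to.
      shifted : Vanishes (suc (suc n)) (θ p * (constant c * d))
      shifted {zero}  _ = refl
      shifted {suc j} (s≤s (s≤s j≤n)) = ≡.trans (ℤ.+-identityˡ _)
        (convolve-0ʳ _ (coeff (constant c * d)) j λ i i≤j → Vanishes-*ˡ {f = d} (constant c) (vanishes n) (s≤s (ℕ.≤-trans i≤j j≤n)))

      θd≡0 : Vanishes (suc (suc n)) (θ d)
      θd≡0 = Vanishes-cancel p (θ d) p₀≡1 (Vanishes-resp (≈-sym d-eq) shifted)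

    d≡0 : ∀ n → coeff d n ≡ 0ℤ
    d≡0 n = vanishes n (ℕ.n<1+n n)

  σ-odd≈ψ⁴ : σ-odd ≈ (ψ * ψ) * (ψ * ψ)
  σ-odd≈ψ⁴ = θ-unique (+ 4) refl refl σ-odd-recurrence (begin
    ψ * θ ((ψ * ψ) * (ψ * ψ))
      ≈⟨ *-congˡ (≈-trans (θ-* (ψ * ψ) (ψ * ψ)) (+-cong (*-congʳ (θ-* ψ ψ)) (*-congˡ (θ-* ψ ψ)))) ⟩
    ψ * ((θ ψ * ψ + ψ * θ ψ) * (ψ * ψ) + (ψ * ψ) * (θ ψ * ψ + ψ * θ ψ))
      ≈⟨ solve 2 (λ p d → p :* ((d :* p :+ p :* d) :* (p :* p) :+ (p :* p) :* (d :* p :+ p :* d)) :=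
                          con (+ 4) :* (((p :* p) :* (p :* p)) :* d)) ≈-refl ψ (θ ψ) ⟩
    constant (+ 4) * (((ψ * ψ) * (ψ * ψ)) * θ ψ) ∎)
    where open ≈-Reasoning

  -- Gauss's product for the triangular numbers, in Shanks's finite form

  pow : Series → ℕ → Series
  pow y zero    = 1#
  pow y (suc n) = y * pow y n

  -- X k plays the role of x^k.
  module Shanks (X : ℕ → Series) (X-0 : X 0 ≈ 1#) (X-+ : ∀ a b → X (a ℕ.+ b) ≈ X a * X b) where
    open ≈-Reasoning

    oddFactors evenFactors : ℕ → Series
    oddFactors zero     = 1#
    oddFactors (suc n)  = oddFactors n * (1# - X (suc (double n)))
    evenFactors zero    = 1#
    evenFactors (suc n) = evenFactors n * (1# - X (double (suc n)))

    partialTheta : ℕ → Series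
    partialTheta zero    = constant 0ℤ
    partialTheta (suc k) = partialTheta k + X (triangle k)

    -- u n y = Σ_{s ≤ n} Π_{s < i ≤ n} (1 - x^{2i}) · Π_{i ≤ s} (1 - x^{2i-1}) · y^s
    u : ℕ → Series → Series
    u zero    y = 1#
    u (suc m) y = (1# - X (double (suc m))) * u m y + oddFactors (suc m) * pow y (suc m)

    pow-X : ∀ a k → pow (X a) k ≈ X (k ℕ.* a)
    pow-X a zero    = ≈-sym X-0
    pow-X a (suc k) = ≈-trans (*-congˡ (pow-X a k)) (≈-sym (X-+ a (k ℕ.* a)))

    pow-X2* : ∀ y k → pow (X 2 * y) k ≈ X (double k) * pow y k
    pow-X2* y zero    = ≈-trans (≈-sym (*-identityˡ 1#)) (*-congʳ (≈-sym X-0))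
    pow-X2* y (suc k) = begin
      X 2 * y * pow (X 2 * y) k        ≈⟨ *-congˡ (pow-X2* y k) ⟩
      X 2 * y * (X (double k) * pow y k)
        ≈⟨ solve 4 (λ a b c d → a :* b :* (c :* d) := a :* c :* (b :* d)) ≈-refl (X 2) y (X (double k)) (pow y k) ⟩
      X 2 * X (double k) * (y * pow y k) ≈⟨ *-congʳ (X-+ 2 (double k)) ⟨
      X (double (suc k)) * (y * pow y k) ∎

    -- A difference equation in y, by induction on m. At y = x^{2m+1} the factor 1 - x y is 1 -
    -- x^{2m+2}, the very factor by which `u (suc m)` extends `u m`.
    u-step : ∀ m y → (1# - X 1 * y) * u m (X 2 * y) ≈ (1# - y) * u m y + oddFactors (suc m) * pow y (suc m)
    u-step zero y = solve 2 (λ x y → (con 1ℤ :- x :* y) :* con 1ℤ := (con 1ℤ :- y) :* con 1ℤ :+ con 1ℤ :* (con 1ℤ :- x) :* (y :* con 1ℤ))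
      ≈-refl (X 1) y
    u-step (suc m) y = begin
      (1# - x * y) * ((1# - z) * u′ + d * pow (X 2 * y) (suc m))
        ≈⟨ *-congˡ (+-congˡ (*-congˡ (pow-X2* y (suc m)))) ⟩
      (1# - x * y) * ((1# - z) * u′ + d * (z * p))
        ≈⟨ solve 6 (λ x y z d p u′ → (con 1ℤ :- x :* y) :* ((con 1ℤ :- z) :* u′ :+ d :* (z :* p)) :=
             (con 1ℤ :- z) :* ((con 1ℤ :- x :* y) :* u′) :+ (con 1ℤ :- x :* y) :* (d :* (z :* p))) ≈-refl x y z d p u′ ⟩
      (1# - z) * ((1# - x * y) * u′) + (1# - x * y) * (d * (z * p))
        ≈⟨ +-congʳ (*-congˡ (u-step m y)) ⟩
      (1# - z) * ((1# - y) * u m y + d * p) + (1# - x * y) * (d * (z * p))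
        ≈⟨ solve 6 (λ x y z d p u → (con 1ℤ :- z) :* ((con 1ℤ :- y) :* u :+ d :* p) :+ (con 1ℤ :- x :* y) :* (d :* (z :* p)) :=
             (con 1ℤ :- y) :* ((con 1ℤ :- z) :* u :+ d :* p) :+ d :* (con 1ℤ :- x :* z) :* (y :* p)) ≈-refl x y z d p (u m y) ⟩
      (1# - y) * ((1# - z) * u m y + d * p) + d * (1# - x * z) * (y * p)
        ≈⟨ +-congˡ (*-congʳ (*-congˡ (+-congˡ (-‿cong (X-+ 1 (double (suc m))))))) ⟨
      (1# - y) * u (suc m) y + oddFactors (suc (suc m)) * pow y (suc (suc m)) ∎
      where
      x = X 1
      z = X (double (suc m))
      d = oddFactors (suc m)
      p = pow y (suc m)
      u′ = u m (X 2 * y)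

    -- The partial sum ends with T(2n). The step to n + 1 adds T(2n + 1) = (n + 1)(2n + 1) and T(2n
    -- + 2) = (n + 1)(2n + 3), and these are the exponents of the powers y^{n+1} and (x² y)^{n+1}
    -- for y = x^{2n+1}.
    u-partialTheta : ∀ n → oddFactors n * partialTheta (suc (double n)) ≈ u n (X (suc (double n)))
    u-partialTheta zero = ≈-trans (*-congˡ (+-congˡ X-0))
      (solve 0 (con 1ℤ :* (con 0ℤ :+ con 1ℤ) := con 1ℤ) ≈-refl)
    u-partialTheta (suc n) = begin
      d * (P + X (triangle (suc (double n))) + X (triangle (double (suc n))))
        ≈⟨ *-congˡ (+-cong (+-congˡ (≈-sym pow-y)) (≈-sym pow-y′)) ⟩
      d * (P + p + p′)
        ≈⟨ solve 5 (λ d₀ P p p′ y → d₀ :* (con 1ℤ :- y) :* (P :+ p :+ p′) :=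
             (con 1ℤ :- y) :* (d₀ :* P) :+ d₀ :* (con 1ℤ :- y) :* p :+ d₀ :* (con 1ℤ :- y) :* p′) ≈-refl (oddFactors n) P p p′ y ⟩
      (1# - y) * (oddFactors n * P) + d * p + d * p′
        ≈⟨ +-congʳ (+-congʳ (*-congˡ (u-partialTheta n))) ⟩
      (1# - y) * u n y + d * p + d * p′
        ≈⟨ +-congʳ (u-step n y) ⟨
      (1# - X 1 * y) * u n (X 2 * y) + d * p′
        ≈⟨ +-congʳ (*-congʳ (+-congˡ (-‿cong (X-+ 1 (suc (double n)))))) ⟨
      (1# - X (double (suc n))) * u n (X 2 * y) + d * p′
        ≈⟨ +-cong (*-congˡ (u-cong n (X-+ 2 (suc (double n))))) (*-congˡ (pow-cong (suc n) (X-+ 2 (suc (double n))))) ⟨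
      u (suc n) (X (suc (double (suc n)))) ∎
      where
      y = X (suc (double n))
      d = oddFactors (suc n)
      P = partialTheta (suc (double n))
      p = pow y (suc n)
      p′ = pow (X 2 * y) (suc n)

      pow-cong : ∀ {y y′} k → y ≈ y′ → pow y k ≈ pow y′ k
      pow-cong zero    y≈ = ≈-refl
      pow-cong (suc k) y≈ = *-cong y≈ (pow-cong k y≈)

      u-cong : ∀ {y y′} n → y ≈ y′ → u n y ≈ u n y′
      u-cong zero    y≈ = ≈-refl
      u-cong (suc n) y≈ = +-cong (*-congˡ (u-cong n y≈)) (*-congˡ (pow-cong (suc n) y≈))

      triangle-odd : ∀ n → triangle (suc (double n)) ≡ suc n ℕ.* suc (double n)
      triangle-odd zero    = refl
      triangle-odd (suc n) = ≡.trans (cong (λ t → suc (suc (suc (double n))) ℕ.+ (suc (suc (double n)) ℕ.+ t)) (triangle-odd n))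
        (≡.trans (cong (λ k → suc (suc (suc k)) ℕ.+ (suc (suc k) ℕ.+ suc n ℕ.* suc k)) (double≡ n))
          (≡.trans (lemma n) (cong (λ k → suc (suc n) ℕ.* suc (suc (suc k))) (sym (double≡ n)))))
        where
        lemma : ∀ n → suc (suc (suc (n ℕ.+ n))) ℕ.+ (suc (suc (n ℕ.+ n)) ℕ.+ suc n ℕ.* suc (n ℕ.+ n)) ≡
          suc (suc n) ℕ.* suc (suc (suc (n ℕ.+ n)))
        lemma = ℕ-Solver.solve-∀

      pow-y : p ≈ X (triangle (suc (double n)))
      pow-y = subst (λ k → p ≈ X k) (sym (triangle-odd n)) (pow-X (suc (double n)) (suc n))

      pow-y′ : p′ ≈ X (triangle (double (suc n)))
      pow-y′ = ≈-trans (≈-trans (pow-X2* y (suc n)) (*-congˡ pow-y))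
        (≈-sym (X-+ (double (suc n)) (triangle (suc (double n)))))

    -- Modulo y only the summand s = 0 of `u n y` survives, and it is the product of the even
    -- factors.
    finite-gauss : ∀ n → ∃ λ v → oddFactors n * partialTheta (suc (double n)) ≈ evenFactors n + X (suc (double n)) * v
    finite-gauss n = let v , eq = u≈ n (X (suc (double n))) in v , ≈-trans (u-partialTheta n) eq
      where
      u≈ : ∀ m y → ∃ λ v → u m y ≈ evenFactors m + y * v
      u≈ zero    y = constant 0ℤ , solve 1 (λ y → con 1ℤ := con 1ℤ :+ y :* con 0ℤ) ≈-refl y
      u≈ (suc m) y = let v , eq = u≈ m y in _ , ≈-trans (+-congʳ (*-congˡ eq))
        (solve 6 (λ z d y p n v → (con 1ℤ :- z) :* (n :+ y :* v) :+ d :* (y :* p) := n :* (con 1ℤ :- z) :+ y :* ((con 1ℤ :- z) :* v :+ d :* p))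
          ≈-refl (X (double (suc m))) (oddFactors (suc m)) y (pow y m) (evenFactors m) v)

  -- Specialisation of the finite identity to x = q and x = q²

  q²^ : ℕ → Series
  q²^ k = q^ (double k)

  double-+ : ∀ a b → double (a ℕ.+ b) ≡ double a ℕ.+ double b
  double-+ zero    b = refl
  double-+ (suc a) b = cong (suc ∘ suc) (double-+ a b)

  module G₁ = Shanks q^ ≈-refl q^-+
  module G₂ = Shanks q²^ ≈-refl (λ a b → subst (λ k → q^ k ≈ q²^ a * q²^ b) (sym (double-+ a b)) (q^-+ (double a) (double b)))

  q^-diagonal : ∀ m → coeff (q^ m) m ≡ 1ℤ
  q^-diagonal zero    = refl
  q^-diagonal (suc m) = q^-diagonal m

  q^-off-diagonal : ∀ m n → m ≢ n → coeff (q^ m) n ≡ 0ℤ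
  q^-off-diagonal zero    zero    m≢n = contradiction refl m≢n
  q^-off-diagonal zero    (suc n) m≢n = refl
  q^-off-diagonal (suc m) zero    m≢n = refl
  q^-off-diagonal (suc m) (suc n) m≢n = q^-off-diagonal m n (m≢n ∘ cong suc)

  ∑-upTo-suc : ∀ k w → ∑ (upTo (suc k)) w ≡ ∑ (upTo k) w ℤ.+ w k
  ∑-upTo-suc k w = ≡.trans (cong (λ l → ∑ l w) (sym (upTo-∷ʳ k))) (≡.trans (∑-++ (upTo k) (k ∷ []))
    (cong (ℤ._+_ (∑ (upTo k) w)) (ℤ.+-identityʳ (w k))))

  ∑-q^ : ∀ (deg : A → ℕ) n xs →
    ∑ xs (λ x → coeff (q^ (deg x)) n) ≡ ∑ (filter (λ x → deg x ℕ.≟ n) xs) one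
  ∑-q^ deg n []       = refl
  ∑-q^ deg n (x ∷ xs) with deg x ℕ.≟ n
  ... | yes deg≡n = ≡.trans
    (cong₂ ℤ._+_ (≡.trans (cong (λ m → coeff (q^ m) n) deg≡n) (q^-diagonal n)) (∑-q^ deg n xs))
    (cong (λ l → ∑ l one) (sym (filter-accept (λ x → deg x ℕ.≟ n) deg≡n)))
  ... | no deg≢n = ≡.trans
    (≡.trans (cong₂ ℤ._+_ (q^-off-diagonal (deg x) n deg≢n) (∑-q^ deg n xs)) (ℤ.+-identityˡ _))
    (cong (λ l → ∑ l one) (sym (filter-reject (λ x → deg x ℕ.≟ n) deg≢n)))

  coeff-gradedℕ : ∀ deg (n≤deg : ∀ n → n ℕ.≤ deg n) {j k} → j ℕ.< k →
    coeff (gen (gradedℕ deg n≤deg) one) j ≡ ∑ (upTo k) (λ s → coeff (q^ (deg s)) j)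
  coeff-gradedℕ deg n≤deg {j} {k} j<k = ≡.trans
    (∑-unique (fibre (gradedℕ deg n≤deg) j)
      (filterEnumeration (λ s → deg s ℕ.≟ j) (Unique.upTo⁺ k) (λ { {s} refl → ∈-upTo⁺ (ℕ.≤-<-trans (n≤deg s) j<k) }))
      id id (λ _ → refl))
    (sym (∑-q^ deg j (upTo k)))

  -- T(s) ≥ s, so the omitted terms have degree at least k and do not reach j.
  coeff-partialTheta₁ : ∀ {j} k → j ℕ.< k → coeff (G₁.partialTheta k) j ≡ coeff ψ j
  coeff-partialTheta₁ {j} k j<k = ≡.trans (go k) (sym (coeff-gradedℕ triangle n≤triangle j<k))
    where
    go : ∀ k → coeff (G₁.partialTheta k) j ≡ ∑ (upTo k) (λ s → coeff (q^ (triangle s)) j)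
    go zero    = at constant-0 j
    go (suc k) = ≡.trans (cong (ℤ._+ coeff (q^ (triangle k)) j) (go k)) (sym (∑-upTo-suc k _))

  coeff-partialTheta₂ : ∀ {j} k → j ℕ.< k → coeff (G₂.partialTheta k) j ≡ coeff ψ₂ j
  coeff-partialTheta₂ {j} k j<k = ≡.trans (go k) (sym (coeff-gradedℕ (double ∘ triangle) (λ n → ℕ.≤-trans (n≤triangle n) (n≤double (triangle n))) j<k))
    where
    go : ∀ k → coeff (G₂.partialTheta k) j ≡ ∑ (upTo k) (λ s → coeff (q²^ (triangle s)) j)
    go zero    = at constant-0 j
    go (suc k) = ≡.trans (cong (ℤ._+ coeff (q²^ (triangle k)) j) (go k)) (sym (∑-upTo-suc k _))

  -- Partitions with distinct even parts

  IsPED : List ℕ → Set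
  IsPED xs = IsPartition xs × EvenPartsDistinct xs

  isPED? : ∀ xs → Dec (IsPED xs)
  isPED? xs = (all? (0 ℕ.<?_) xs ×-dec linked? ℕ._≥?_ xs) ×-dec unique? (filter (2 ∣?_) xs)

  Bounded : ℕ → List ℕ → Set
  Bounded m xs = IsPED xs × All (ℕ._≤ m) xs

  -- A bound on the parts turns the generating function into a finite product, built up one part
  -- size at a time.
  pedBounded : ℕ → Graded (List ℕ)
  pedBounded m = record
    { Deg        = λ xs n → Bounded m xs × sum xs ≡ n
    ; fibre      = λ n → filterEnumeration
        (λ xs → (isPED? xs ×-dec all? (ℕ._≤? m) xs) ×-dec (sum xs ℕ.≟ n))
        (boundedLists-unique n n) λ { ((((positive , _) , _) , _) , refl) → ∈-boundedLists n _ (length≤sum positive) (parts≤sum _) }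
    ; functional = λ { (_ , refl) (_ , refl) → refl }
    }

  sign : ℕ → ℤ
  sign zero    = 1ℤ
  sign (suc n) = ℤ.- sign n

  sign-+ : ∀ m n → sign (m ℕ.+ n) ≡ sign m ℤ.* sign n
  sign-+ zero    n = sym (ℤ.*-identityˡ (sign n))
  sign-+ (suc m) n = ≡.trans (cong ℤ.-_ (sign-+ m n)) (ℤ.neg-distribˡ-* (sign m) (sign n))

  sign-double : ∀ n → sign (double n) ≡ 1ℤ
  sign-double zero    = refl
  sign-double (suc n) = ≡.trans (ℤ.neg-involutive (sign (double n))) (sign-double n)

  signedPED : ℕ → Series
  signedPED m = gen (pedBounded m) (sign ∘ sum)

  head-maximal : ∀ {x xs} → Linked ℕ._≥_ (x ∷ xs) → All (ℕ._≤ x) xs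
  head-maximal link with Linked⇒AllPairs (λ p q → ℕ.≤-trans q p) link
  ... | x≥ ∷ _ = x≥

  Linked-∷ : ∀ {x xs} → All (ℕ._≤ x) xs → Linked ℕ._≥_ xs → Linked ℕ._≥_ (x ∷ xs)
  Linked-∷ {xs = []}    _         _    = [-]
  Linked-∷ {xs = _ ∷ _} (y≤x ∷ _) link = y≤x ∷ link

  monomial : ℕ → Graded ⊤
  monomial m = gradedBy (const m) (λ _ → tt ∷ []) (λ _ → [] ∷ []) (λ _ → here refl)

  gen-monomial : ∀ m w → gen (monomial m) w ≈ constant (w tt) * q^ m
  at (gen-monomial m w) n = begin
    ∑ (list (fibre (monomial m) n)) w
      ≡⟨ ∑-cong (list (fibre (monomial m) n)) (λ { {tt} _ → sym (ℤ.*-identityʳ (w tt)) }) ⟩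
    ∑ (list (fibre (monomial m) n)) (λ _ → w tt ℤ.* 1ℤ)
      ≡⟨ ∑-*ˡ (list (fibre (monomial m) n)) (w tt) one ⟩
    w tt ℤ.* ∑ (list (fibre (monomial m) n)) one
      ≡⟨ cong (ℤ._*_ (w tt)) (≡.trans (sym (∑-q^ (const m) n (tt ∷ []))) (ℤ.+-identityʳ _)) ⟩
    w tt ℤ.* coeff (q^ m) n
      ≡⟨ constant-* (w tt) (q^ m) n ⟨
    coeff (constant (w tt) * q^ m) n ∎
    where open ≡-Reasoning

  -- Recursion on the largest part: either all parts are at most m, or the head is m + 1 and is
  -- taken off. What remains has parts up to m′, to be chosen as m + 1 if the head may be repeated
  -- (odd) and as m if it may not (even).
  module _ (m m′ : ℕ) (m′≤1+m : m′ ℕ.≤ suc m)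
    (remove : ∀ {ys} → IsPED (suc m ∷ ys) → All (ℕ._≤ suc m) ys → Bounded m′ ys)
    (insert : ∀ {ys} → Bounded m′ ys → EvenPartsDistinct (suc m ∷ ys)) where

    private
      splitHead : List ℕ → List ℕ ⊎ (⊤ × List ℕ)
      splitHead []       = inj₁ []
      splitHead (x ∷ xs) with x ℕ.≟ suc m
      ... | yes _ = inj₂ (tt , xs)
      ... | no  _ = inj₁ (x ∷ xs)

      join : List ℕ ⊎ (⊤ × List ℕ) → List ℕ
      join (inj₁ xs)       = xs
      join (inj₂ (_ , ys)) = suc m ∷ ys

      G = pedBounded m ⊕ monomial (suc m) ⊗ pedBounded m′

      join-splitHead : ∀ xs → join (splitHead xs) ≡ xs
      join-splitHead []       = refl
      join-splitHead (x ∷ xs) with x ℕ.≟ suc m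
      ... | yes refl = refl
      ... | no  _    = refl

      splitHead-join : ∀ {z n} → Deg G z n → splitHead (join z) ≡ z
      splitHead-join {inj₁ []}       _ = refl
      splitHead-join {inj₁ (x ∷ xs)} ((_ , x≤m ∷ _) , _) with x ℕ.≟ suc m
      ... | yes refl = contradiction x≤m (ℕ.<⇒≱ (ℕ.n<1+n m))
      ... | no  _    = refl
      splitHead-join {inj₂ (tt , ys)} _ with suc m ℕ.≟ suc m
      ... | yes _ = refl
      ... | no ≢  = contradiction refl ≢

      toDeg : ∀ {xs n} → Deg (pedBounded (suc m)) xs n → Deg G (splitHead xs) n
      toDeg {[]} ((ped , []) , s) = (ped , []) , s
      toDeg {x ∷ xs} ((ped@((_ , link) , _) , x≤ ∷ xs≤) , refl) with x ℕ.≟ suc m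
      ... | yes refl = suc m , sum xs , refl , refl , remove ped xs≤ , refl
      ... | no  x≢   = (ped , x≤m ∷ All.map (λ y≤x → ℕ.≤-trans y≤x x≤m) (head-maximal link)) , refl
        where
        x≤m = ℕ.≤-pred (ℕ.≤∧≢⇒< x≤ x≢)

      joinDeg : ∀ {z n} → Deg G z n → Deg (pedBounded (suc m)) (join z) n
      joinDeg {inj₁ xs} ((ped , xs≤) , s) = (ped , All.map ℕ.m≤n⇒m≤1+n xs≤) , s
      joinDeg {inj₂ (tt , ys)} (_ , _ , refl , refl , (bounded@(((positive , link) , distinct) , ys≤) , refl)) =
        (((s≤s z≤n ∷ positive , Linked-∷ ys≤1+m link) , insert bounded) , ℕ.≤-refl ∷ ys≤1+m) , refl
        where
        ys≤1+m = All.map (λ y≤ → ℕ.≤-trans y≤ m′≤1+m) ys≤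

    signedPED-suc : signedPED (suc m) ≈ signedPED m + constant (sign (suc m)) * q^ (suc m) * signedPED m′
    signedPED-suc = begin
      signedPED (suc m)
        ≈⟨ gen-bijection (pedBounded (suc m)) G splitHead join toDeg (λ {z} → joinDeg {z}) (λ {xs} _ → join-splitHead xs) (λ {z} → splitHead-join {z})
             (λ {xs} _ → cong (sign ∘ sum) (sym (join-splitHead xs))) ⟩
      gen G (sign ∘ sum ∘ join)
        ≈⟨ gen-⊕ (pedBounded m) (monomial (suc m) ⊗ pedBounded m′) (sign ∘ sum ∘ join) ⟩
      signedPED m + gen (monomial (suc m) ⊗ pedBounded m′) (λ (_ , ys) → sign (suc m ℕ.+ sum ys))
        ≈⟨ +-congˡ (gen-cong (monomial (suc m) ⊗ pedBounded m′) λ { {_ , ys} _ → sign-+ (suc m) (sum ys) }) ⟩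
      signedPED m + gen (monomial (suc m) ⊗ pedBounded m′) (λ (_ , ys) → sign (suc m) ℤ.* sign (sum ys))
        ≈⟨ +-congˡ (gen-⊗ (monomial (suc m)) (pedBounded m′) (const (sign (suc m))) (sign ∘ sum)) ⟩
      signedPED m + gen (monomial (suc m)) (const (sign (suc m))) * signedPED m′
        ≈⟨ +-congˡ (*-congʳ (gen-monomial (suc m) (const (sign (suc m))))) ⟩
      signedPED m + constant (sign (suc m)) * q^ (suc m) * signedPED m′ ∎
      where open ≈-Reasoning

  2∣double : ∀ n → 2 ∣ double n
  2∣double n = divides n (≡.trans (double≡ n) (lemma n))
    where
    lemma : ∀ n → n ℕ.+ n ≡ n ℕ.* 2
    lemma = ℕ-Solver.solve-∀

  2∤suc-double : ∀ n → ¬ 2 ∣ suc (double n)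
  2∤suc-double n (divides k eq) = double≢suc-double {k} {n} (sym (≡.trans eq (≡.trans (lemma k) (sym (double≡ k)))))
    where
    lemma : ∀ n → n ℕ.* 2 ≡ n ℕ.+ n
    lemma = ℕ-Solver.solve-∀

  -- An odd part may be repeated, so the recursion has the same series on both sides; solving for
  -- it, with the sign -1 of an odd part, gives the factor 1 + q^{2n+1}.
  signedPED-odd : ∀ n → (1# + q^ (suc (double n))) * signedPED (suc (double n)) ≈ signedPED (double n)
  signedPED-odd n = begin
    (1# + q) * f
      ≈⟨ solve 2 (λ q f → (con 1ℤ :+ q) :* f := f :+ q :* f) ≈-refl q f ⟩
    f + q * f
      ≈⟨ +-congʳ (signedPED-suc (double n) (suc (double n)) ℕ.≤-refl remove insert) ⟩
    g + constant (ℤ.- sign (double n)) * q * f + q * f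
      ≈⟨ +-congʳ (+-congˡ (*-congʳ (*-congʳ (constant-cong (cong ℤ.-_ (sign-double n)))))) ⟩
    g + constant (ℤ.- 1ℤ) * q * f + q * f
      ≈⟨ solve 3 (λ q f g → g :+ con (ℤ.- 1ℤ) :* q :* f :+ q :* f := g) ≈-refl q f g ⟩
    g ∎
    where
    open ≈-Reasoning
    q = q^ (suc (double n))
    f = signedPED (suc (double n))
    g = signedPED (double n)

    remove : ∀ {ys} → IsPED (suc (double n) ∷ ys) → All (ℕ._≤ suc (double n)) ys → Bounded (suc (double n)) ys
    remove (((_ ∷ positive) , link) , distinct) ys≤ =
      ((positive , Linked.tail link) , subst Unique (filter-reject (2 ∣?_) (2∤suc-double n)) distinct) , ys≤

    insert : ∀ {ys} → Bounded (suc (double n)) ys → EvenPartsDistinct (suc (double n) ∷ ys)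
    insert ((_ , distinct) , _) = subst Unique (sym (filter-reject (2 ∣?_) (2∤suc-double n))) distinct

  signedPED-even : ∀ n → signedPED (double (suc n)) ≈ (1# + q^ (double (suc n))) * signedPED (suc (double n))
  signedPED-even n = begin
    signedPED (double (suc n))
      ≈⟨ signedPED-suc (suc (double n)) (suc (double n)) (ℕ.n≤1+n _) remove insert ⟩
    f + constant (sign (double (suc n))) * q * f
      ≈⟨ +-congˡ (*-congʳ (*-congʳ (constant-cong (sign-double (suc n))))) ⟩
    f + constant 1ℤ * q * f
      ≈⟨ solve 2 (λ q f → f :+ con 1ℤ :* q :* f := (con 1ℤ :+ q) :* f) ≈-refl q f ⟩
    (1# + q) * f ∎
    where
    open ≈-Reasoning
    q = q^ (double (suc n))
    f = signedPED (suc (double n))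

    remove : ∀ {ys} → IsPED (double (suc n) ∷ ys) → All (ℕ._≤ double (suc n)) ys → Bounded (suc (double n)) ys
    remove {ys} (((_ ∷ positive) , link) , distinct) ys≤
      with subst Unique (filter-accept (2 ∣?_) {xs = ys} (2∣double (suc n))) distinct
    ... | fresh ∷ distinct′ = ((positive , Linked.tail link) , distinct′) , All.tabulate λ {y} y∈ →
      ℕ.≤-pred (ℕ.≤∧≢⇒< (All.lookup ys≤ y∈)
        λ { refl → All.lookup fresh (∈-filter⁺ (2 ∣?_) y∈ (2∣double (suc n))) refl })

    insert : ∀ {ys} → Bounded (suc (double n)) ys → EvenPartsDistinct (double (suc n) ∷ ys)
    insert {ys} ((_ , distinct) , ys≤) = subst Unique (sym (filter-accept (2 ∣?_) {xs = ys} (2∣double (suc n))))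
      (All.tabulate (λ y∈ eq → ℕ.<⇒≢ (s≤s (All.lookup ys≤ (proj₁ (∈-filter⁻ (2 ∣?_) {xs = ys} y∈)))) (sym eq)) ∷ distinct)

  signedPED-0 : signedPED 0 ≈ 1#
  signedPED-0 = ≈-trans
    (gen-bijection (pedBounded 0) (monomial 0) {w = one} (const tt) (const [])
      (λ { (bounded , refl) → cong sum (sym (empty bounded)) })
      (λ { refl → ((([] , []) , []) , []) , refl })
      (λ (bounded , _) → sym (empty bounded)) (λ _ → refl)
      (λ (bounded , _) → cong (sign ∘ sum) (empty bounded)))
    (≈-trans (gen-monomial 0 one) (*-identityˡ 1#))
    where
    empty : ∀ {xs} → Bounded 0 xs → xs ≡ []
    empty {[]}         _                              = refl
    empty {zero  ∷ _} ((((() ∷ _ , _) , _) , _))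
    empty {suc _ ∷ _} (_ , () ∷ _)

  partitions : Graded (List ℕ)
  partitions = record
    { Deg        = λ xs n → IsPED xs × sum xs ≡ n
    ; fibre      = λ n → filterEnumeration (λ xs → isPED? xs ×-dec (sum xs ℕ.≟ n))
        (boundedLists-unique n n) λ { (((positive , _) , _) , refl) → ∈-boundedLists n _ (length≤sum positive) (parts≤sum _) }
    ; functional = λ { (_ , refl) (_ , refl) → refl }
    }

  Γ : Series
  Γ = gen partitions (sign ∘ sum)

  coeff-Γ : ∀ {m n} → n ℕ.≤ m → coeff Γ n ≡ coeff (signedPED m) n
  coeff-Γ {m} {n} n≤m = ∑-unique (fibre partitions n) (fibre (pedBounded m) n)
    (λ { {xs} (ped , refl) → (ped , All.map (λ x≤ → ℕ.≤-trans x≤ n≤m) (parts≤sum xs)) , refl })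
    (λ ((ped , _) , s) → ped , s) (λ _ → refl)

  oddFactors⁺ evenFactors⁺ : ℕ → Series
  oddFactors⁺ zero     = 1#
  oddFactors⁺ (suc n)  = oddFactors⁺ n * (1# + q^ (suc (double n)))
  evenFactors⁺ zero    = 1#
  evenFactors⁺ (suc n) = evenFactors⁺ n * (1# + q^ (double (suc n)))

  signedPED-product : ∀ n → signedPED (double n) * oddFactors⁺ n ≈ evenFactors⁺ n
  signedPED-product zero    = ≈-trans (*-congʳ signedPED-0) (*-identityˡ 1#)
  signedPED-product (suc n) = begin
    signedPED (double (suc n)) * (oddFactors⁺ n * (1# + o))
      ≈⟨ *-congʳ (signedPED-even n) ⟩
    (1# + e) * signedPED (suc (double n)) * (oddFactors⁺ n * (1# + o))
      ≈⟨ solve 4 (λ o e f c → (con 1ℤ :+ e) :* f :* (c :* (con 1ℤ :+ o)) := (con 1ℤ :+ o) :* f :* c :* (con 1ℤ :+ e)) ≈-refl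
           o e (signedPED (suc (double n))) (oddFactors⁺ n) ⟩
    (1# + o) * signedPED (suc (double n)) * oddFactors⁺ n * (1# + e)
      ≈⟨ *-congʳ (≈-trans (*-congʳ (signedPED-odd n)) (signedPED-product n)) ⟩
    evenFactors⁺ n * (1# + e) ∎
    where
    open ≈-Reasoning
    o = q^ (suc (double n))
    e = q^ (double (suc n))

  q²^≈ : ∀ k → q²^ k ≈ q^ k * q^ k
  q²^≈ k = subst (λ m → q^ m ≈ q^ k * q^ k) (sym (double≡ k)) (q^-+ k k)

  -- By (1 - q^k)(1 + q^k) = 1 - q^{2k}, the factors with plus signs lead from the Shanks products
  -- for q to those for q².
  difference-of-squares : ∀ {f f⁺ f₂} k → f * f⁺ ≈ f₂ → (f * (1# - q^ k)) * (f⁺ * (1# + q^ k)) ≈ f₂ * (1# - q²^ k)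
  difference-of-squares {f} {f⁺} {f₂} k ff⁺≈f₂ = begin
    (f * (1# - q^ k)) * (f⁺ * (1# + q^ k))
      ≈⟨ solve 3 (λ f g q → (f :* (con 1ℤ :- q)) :* (g :* (con 1ℤ :+ q)) := (f :* g) :* (con 1ℤ :- q :* q)) ≈-refl f f⁺ (q^ k) ⟩
    (f * f⁺) * (1# - q^ k * q^ k)
      ≈⟨ *-cong ff⁺≈f₂ (+-congˡ (-‿cong (≈-sym (q²^≈ k)))) ⟩
    f₂ * (1# - q²^ k) ∎
    where open ≈-Reasoning

  oddFactors-square : ∀ n → G₁.oddFactors n * oddFactors⁺ n ≈ G₂.oddFactors n
  oddFactors-square zero    = *-identityˡ 1#
  oddFactors-square (suc n) = difference-of-squares (suc (double n)) (oddFactors-square n)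

  evenFactors-square : ∀ n → G₁.evenFactors n * evenFactors⁺ n ≈ G₂.evenFactors n
  evenFactors-square zero    = *-identityˡ 1#
  evenFactors-square (suc n) = difference-of-squares (double (suc n)) (evenFactors-square n)

  oddFactors₂-unit : ∀ n → coeff (G₂.oddFactors n) 0 ≡ 1ℤ
  oddFactors₂-unit zero    = refl
  oddFactors₂-unit (suc n) = cong (ℤ._* 1ℤ) (oddFactors₂-unit n)

  -- Multiplied by the odd factors for q², both terms become the even factors for q² up to multiples
  -- of q^{2n+1}, by `finite-gauss` for q and for q². The odd factors have constant term 1 and
  -- cancel.
  signedPED-theta : ∀ n → Vanishes (suc (double n))
    (signedPED (double n) * G₁.partialTheta (suc (double n)) - G₂.partialTheta (suc (double n)))
  signedPED-theta n = Vanishes-cancel d₂ (g * p₁ - p₂) (oddFactors₂-unit n)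
    (Vanishes-resp (≈-sym factored) (Vanishes-*ˡ {f = x} (e * v - x * v′) (q^-vanishes (suc (double n)))))
    where
    d = G₁.oddFactors n
    d⁺ = oddFactors⁺ n
    d₂ = G₂.oddFactors n
    e = evenFactors⁺ n
    g = signedPED (double n)
    x = q^ (suc (double n))
    p₁ = G₁.partialTheta (suc (double n))
    p₂ = G₂.partialTheta (suc (double n))
    v = proj₁ (G₁.finite-gauss n)
    v′ = proj₁ (G₂.finite-gauss n)

    factored : d₂ * (g * p₁ - p₂) ≈ (e * v - x * v′) * x
    factored = begin
      d₂ * (g * p₁ - p₂)
        ≈⟨ solve 4 (λ d g p r → d :* (g :* p :- r) := d :* g :* p :- d :* r) ≈-refl d₂ g p₁ p₂ ⟩
      d₂ * g * p₁ - d₂ * p₂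
        ≈⟨ +-cong (*-congʳ (*-congʳ (≈-sym (oddFactors-square n)))) (-‿cong (proj₂ (G₂.finite-gauss n))) ⟩
      d * d⁺ * g * p₁ - (G₂.evenFactors n + q²^ (suc (double n)) * v′)
        ≈⟨ +-cong (solve 4 (λ d c g p → d :* c :* g :* p := g :* c :* (d :* p)) ≈-refl d d⁺ g p₁)
                  (-‿cong (+-cong (≈-sym (evenFactors-square n)) (*-congʳ (q²^≈ (suc (double n)))))) ⟩
      g * d⁺ * (d * p₁) - (G₁.evenFactors n * e + x * x * v′)
        ≈⟨ +-congʳ (*-cong (signedPED-product n) (proj₂ (G₁.finite-gauss n))) ⟩
      e * (G₁.evenFactors n + x * v) - (G₁.evenFactors n * e + x * x * v′)
        ≈⟨ solve 5 (λ e n x v w → e :* (n :+ x :* v) :- (n :* e :+ x :* x :* w) := (e :* v :- x :* w) :* x) ≈-refl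
             e (G₁.evenFactors n) x v v′ ⟩
      (e * v - x * v′) * x ∎
      where open ≈-Reasoning

  convolve-cong-≤ : ∀ {f f′ g g′} n → (∀ {i} → i ℕ.≤ n → f i ≡ f′ i) → (∀ {i} → i ℕ.≤ n → g i ≡ g′ i) →
    convolve f g n ≡ convolve f′ g′ n
  convolve-cong-≤ zero    f≡ g≡ = cong₂ ℤ._*_ (f≡ z≤n) (g≡ z≤n)
  convolve-cong-≤ (suc n) f≡ g≡ = cong₂ ℤ._+_ (cong₂ ℤ._*_ (f≡ z≤n) (g≡ ℕ.≤-refl))
    (convolve-cong-≤ n (λ i≤n → f≡ (s≤s i≤n)) (λ i≤n → g≡ (ℕ.m≤n⇒m≤1+n i≤n)))

  -- Parts up to 2n and the first 2n + 1 triangular numbers settle the coefficients up to n.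
  Γ*ψ≈ψ₂ : Γ * ψ ≈ ψ₂
  at Γ*ψ≈ψ₂ n = begin
    coeff (Γ * ψ) n
      ≡⟨ convolve-cong-≤ n (λ i≤n → coeff-Γ (ℕ.≤-trans i≤n (n≤double n)))
           (λ i≤n → sym (coeff-partialTheta₁ (suc (double n)) (s≤s (ℕ.≤-trans i≤n (n≤double n))))) ⟩
    coeff (signedPED (double n) * G₁.partialTheta (suc (double n))) n
      ≡⟨ ℤ.i-j≡0⇒i≡j (coeff (signedPED (double n) * G₁.partialTheta (suc (double n))) n) (coeff (G₂.partialTheta (suc (double n))) n)
           (signedPED-theta n (s≤s (n≤double n))) ⟩
    coeff (G₂.partialTheta (suc (double n))) n
      ≡⟨ coeff-partialTheta₂ (suc (double n)) (s≤s (n≤double n)) ⟩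
    coeff ψ₂ n ∎
    where open ≡-Reasoning

  -- The sign of a pair of partitions depends only on its total size n, so it comes out of the sum.
  coeff-Γ*Γ : ∀ n → coeff (Γ * Γ) n ≡ sign n ℤ.* + ped₋₂ n
  coeff-Γ*Γ n = begin
    coeff (Γ * Γ) n
      ≡⟨ at (gen-⊗ partitions partitions (sign ∘ sum) (sign ∘ sum)) n ⟨
    ∑ (list (fibre (partitions ⊗ partitions) n)) (λ (xs , ys) → sign (sum xs) ℤ.* sign (sum ys))
      ≡⟨ ∑-unique (fibre (partitions ⊗ partitions) n) bipartitions
           (λ { (_ , _ , s , (p , refl) , (q , refl)) → p , q , s })
           (λ (p , q , s) → _ , _ , s , (p , refl) , (q , refl))
           (λ { {xs , ys} (_ , _ , refl , (_ , refl) , (_ , refl)) →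
             ≡.trans (sym (sign-+ (sum xs) (sum ys))) (sym (ℤ.*-identityʳ _)) }) ⟩
    ∑ (pedBipartitions n) (λ _ → sign n ℤ.* 1ℤ)
      ≡⟨ ∑-*ˡ (pedBipartitions n) (sign n) one ⟩
    sign n ℤ.* ∑ (pedBipartitions n) one
      ≡⟨ cong (ℤ._*_ (sign n)) (∑-1 (pedBipartitions n)) ⟩
    sign n ℤ.* + ped₋₂ n ∎
    where
    open ≡-Reasoning
    bipartitions : Enumeration (IsPEDBipartition n)
    bipartitions = record
      { list     = pedBipartitions n
      ; unique   = pedBipartitions-unique n
      ; sound    = λ {b} → Equivalence.to (∈-pedBipartitions n b)
      ; complete = λ {b} → Equivalence.from (∈-pedBipartitions n b)
      }

  -- Reduction modulo 8

  halve : ℕ → ℕ ⊎ ℕ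
  halve zero          = inj₁ zero
  halve (suc zero)    = inj₂ zero
  halve (suc (suc n)) = [ inj₁ ∘ suc , inj₂ ∘ suc ] (halve n)

  unhalve : ℕ ⊎ ℕ → ℕ
  unhalve (inj₁ k) = double k
  unhalve (inj₂ k) = suc (double k)

  unhalve-halve : ∀ n → unhalve (halve n) ≡ n
  unhalve-halve zero          = refl
  unhalve-halve (suc zero)    = refl
  unhalve-halve (suc (suc n)) with halve n | unhalve-halve n
  ... | inj₁ k | eq = cong (suc ∘ suc) eq
  ... | inj₂ k | eq = cong (suc ∘ suc) eq

  halve-unhalve : ∀ z → halve (unhalve z) ≡ z
  halve-unhalve (inj₁ zero)    = refl
  halve-unhalve (inj₁ (suc k)) = cong [ inj₁ ∘ suc , inj₂ ∘ suc ] (halve-unhalve (inj₁ k))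
  halve-unhalve (inj₂ zero)    = refl
  halve-unhalve (inj₂ (suc k)) = cong [ inj₁ ∘ suc , inj₂ ∘ suc ] (halve-unhalve (inj₂ k))

  square : ℕ → ℕ
  square n = n ℕ.* n

  n≤square-suc : ∀ n → n ℕ.≤ square (suc n)
  n≤square-suc n = ℕ.≤-trans (ℕ.n≤1+n n) (ℕ.m≤m*n (suc n) (suc n))

  oddSquares evenSquares doubleSquares : Graded ℕ
  oddSquares    = gradedℕ (λ i → square (suc (double i))) (λ i → ℕ.≤-trans (n≤double i) (n≤square-suc (double i)))
  evenSquares   = gradedℕ (λ i → square (double (suc i))) (λ i → ℕ.≤-trans (ℕ.≤-trans (n≤double i) (ℕ.n≤1+n (double i))) (n≤square-suc (suc (double i))))
  doubleSquares = gradedℕ (λ i → double (square (suc i))) (λ i → ℕ.≤-trans (n≤square-suc i) (n≤double (square (suc i))))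

  -- The index n stands for (n + 1)², so an even index yields an odd square.
  S≈ : S ≈ gen oddSquares one + gen evenSquares one
  S≈ = ≈-trans
    (gen-bijection squares (oddSquares ⊕ evenSquares) halve unhalve
      (λ { {n} refl → toDeg n }) (λ { {inj₁ _} d → d ; {inj₂ _} d → d })
      (λ {n} _ → unhalve-halve n) (λ {z} _ → halve-unhalve z) (λ _ → refl))
    (gen-⊕ oddSquares evenSquares one)
    where
    toDeg : ∀ n → Deg (oddSquares ⊕ evenSquares) (halve n) (square (suc n))
    toDeg n with halve n | unhalve-halve n
    ... | inj₁ k | refl = refl
    ... | inj₂ k | refl = refl

  oddSquare≢double : ∀ i n → square (suc (double i)) ≢ double n
  oddSquare≢double i n eq = double≢suc-double {n} (begin
    double n                                         ≡⟨ eq ⟨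
    square (suc (double i))                          ≡⟨ cong (λ d → square (suc d)) (double≡ i) ⟩
    square (suc (i ℕ.+ i))                           ≡⟨ lemma i ⟩
    suc ((2 ℕ.* i ℕ.* i ℕ.+ 2 ℕ.* i) ℕ.+ (2 ℕ.* i ℕ.* i ℕ.+ 2 ℕ.* i)) ≡⟨ cong suc (double≡ (2 ℕ.* i ℕ.* i ℕ.+ 2 ℕ.* i)) ⟨
    suc (double (2 ℕ.* i ℕ.* i ℕ.+ 2 ℕ.* i))         ∎)
    where
    open ≡-Reasoning
    lemma : ∀ i → suc (i ℕ.+ i) ℕ.* suc (i ℕ.+ i) ≡ suc ((2 ℕ.* i ℕ.* i ℕ.+ 2 ℕ.* i) ℕ.+ (2 ℕ.* i ℕ.* i ℕ.+ 2 ℕ.* i))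
    lemma = ℕ-Solver.solve-∀

  -- Odd squares have odd degree and drop out. The even squares 4i² contribute S(q⁴), whose even
  -- part, with q² renamed, is S(q²).
  even-S : even S ≈ dilate S
  even-S = begin
    even S
      ≈⟨ pointwise (λ n → at S≈ (double n)) ⟩
    even (gen oddSquares one) + even (gen evenSquares one)
      ≈⟨ +-cong (pointwise λ n → ∑-empty (fibre oddSquares (double n)) (λ {i} → oddSquare≢double i n))
                (pointwise λ n → at (≈-trans evenSquares≈ (dilate-cong doubleSquares≈)) (double n)) ⟩
    0# + even (dilate (dilate S))
      ≈⟨ pointwise (λ n → ≡.trans (ℤ.+-identityˡ _) (at (even-dilate (dilate S)) n)) ⟩
    dilate S ∎
    where
    open ≈-Reasoning
    square-double : ∀ n → square (double n) ≡ double (double (square n))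
    square-double n = ≡.trans (cong square (double≡ n)) (≡.trans (lemma n)
      (≡.trans (cong₂ ℕ._+_ (sym (double≡ (square n))) (sym (double≡ (square n)))) (sym (double≡ (double (square n))))))
      where
      lemma : ∀ n → (n ℕ.+ n) ℕ.* (n ℕ.+ n) ≡ (n ℕ.* n ℕ.+ n ℕ.* n) ℕ.+ (n ℕ.* n ℕ.+ n ℕ.* n)
      lemma = ℕ-Solver.solve-∀

    evenSquares≈ : gen evenSquares one ≈ dilate (gen doubleSquares one)
    evenSquares≈ = gen-dilate doubleSquares evenSquares one
      (λ { {i} refl → square-double (suc i) }) (λ { {i} refl → _ , square-double (suc i) , refl })

    doubleSquares≈ : gen doubleSquares one ≈ dilate S
    doubleSquares≈ = gen-dilate squares doubleSquares one (cong double) (λ { refl → _ , refl , refl })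

  -- Here φ² = 1 + 4(S + S²) and S² = S(q²) + 2h. `even` exchanges S and S(q²), so their sum is
  -- unchanged; only h moves, and it carries the factor 8.
  even-φ*φ : ∃ λ w → even (φ * φ) ≈ φ * φ + constant (+ 8) * w
  even-φ*φ = even h - h , (begin
    even (φ * φ)
      ≈⟨ pointwise (λ n → at φ*φ≈ (double n)) ⟩
    even (1# + constant (+ 4) * (S + S * S))
      ≈⟨ pointwise (λ n → cong₂ ℤ._+_ (at (even-constant 1ℤ) n) (≡.trans (constant-* (+ 4) (S + S * S) (double n)) (sym (constant-* (+ 4) (even S + even (S * S)) n)))) ⟩
    1# + constant (+ 4) * (even S + even (S * S))
      ≈⟨ +-congˡ (*-congˡ (+-cong even-S (pointwise λ n → ≡.trans (at S*S≈ (double n))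
           (cong₂ ℤ._+_ (at (even-dilate S) n) (≡.trans (constant-* (+ 2) h (double n)) (sym (constant-* (+ 2) (even h) n))))))) ⟩
    1# + constant (+ 4) * (dilate S + (S + constant (+ 2) * even h))
      ≈⟨ solve 4 (λ s d h e → con 1ℤ :+ con (+ 4) :* (d :+ (s :+ con (+ 2) :* e)) :=
                  (con 1ℤ :+ con (+ 4) :* (s :+ (d :+ con (+ 2) :* h))) :+ con (+ 8) :* (e :- h)) ≈-refl S (dilate S) h (even h) ⟩
    (1# + constant (+ 4) * (S + (dilate S + constant (+ 2) * h))) + constant (+ 8) * (even h - h)
      ≈⟨ +-congʳ (≈-trans (+-congˡ (*-congˡ (+-congˡ (≈-sym S*S≈)))) (≈-sym φ*φ≈)) ⟩
    φ * φ + constant (+ 8) * (even h - h) ∎)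
    where
    open ≈-Reasoning
    h = proj₁ (square≡dilate-mod-2 S)
    S*S≈ = proj₂ (square≡dilate-mod-2 S)

    φ*φ≈ : φ * φ ≈ 1# + constant (+ 4) * (S + S * S)
    φ*φ≈ = solve 1 (λ s → (con 1ℤ :+ (s :+ s)) :* (con 1ℤ :+ (s :+ s)) := con 1ℤ :+ con (+ 4) :* (s :+ s :* s)) ≈-refl S

    even-constant : ∀ c → even (constant c) ≈ constant c
    at (even-constant c) zero    = refl
    at (even-constant c) (suc n) = refl

  -- From ψ⁴ = ψ(q²)² φ² the even part is ψ² times that of φ², hence congruent to ψ² φ². Two uses of
  -- the theta identities give ψ² = φ² Γ², and φ⁴ ≡ 1 removes the rest.
  even-σ-odd : ∃ λ w → even σ-odd ≈ Γ * Γ + constant (+ 8) * w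
  even-σ-odd = constant-multiple , (begin
    even σ-odd
      ≈⟨ pointwise (λ n → at (≈-trans σ-odd≈ψ⁴ ψ⁴≈) (double n)) ⟩
    even (dilate (ψ * ψ) * (φ * φ))
      ≈⟨ even-dilate-* (ψ * ψ) (φ * φ) ⟩
    ψ * ψ * even (φ * φ)
      ≈⟨ *-cong ψ*ψ≈ (proj₂ even-φ*φ) ⟩
    φ * (Γ * Γ * φ) * (φ * φ + constant (+ 8) * w)
      -- The coefficients 1, 3, 4, 2 come from ((1 + 2S)⁴ - 1)/8 = S + 3S² + 4S³ + 2S⁴.
      ≈⟨ solve 3 (λ s g w → let f = con 1ℤ :+ (s :+ s) in
           f :* (g :* g :* f) :* (f :* f :+ con (+ 8) :* w) :=
           g :* g :+ con (+ 8) :* (g :* g :* (s :+ con (+ 3) :* (s :* s) :+ con (+ 4) :* (s :* s :* s) :+ con (+ 2) :* (s :* s :* s :* s)) :+ f :* (g :* g :* f) :* w))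
           ≈-refl S Γ w ⟩
    Γ * Γ + constant (+ 8) * constant-multiple ∎)
    where
    open ≈-Reasoning
    w = proj₁ even-φ*φ
    constant-multiple = Γ * Γ * (S + constant (+ 3) * (S * S) + constant (+ 4) * (S * S * S) + constant (+ 2) * (S * S * S * S)) + φ * (Γ * Γ * φ) * w

    ψ⁴≈ : ψ * ψ * (ψ * ψ) ≈ dilate (ψ * ψ) * (φ * φ)
    ψ⁴≈ = begin
      ψ * ψ * (ψ * ψ)       ≈⟨ *-cong ψ*ψ≈φ*ψ₂ ψ*ψ≈φ*ψ₂ ⟩
      φ * ψ₂ * (φ * ψ₂)     ≈⟨ solve 2 (λ f p → f :* p :* (f :* p) := p :* p :* (f :* f)) ≈-refl φ ψ₂ ⟩
      ψ₂ * ψ₂ * (φ * φ)     ≈⟨ *-congʳ (≈-trans (*-cong ψ₂≈dilate-ψ ψ₂≈dilate-ψ) (≈-sym (dilate-* ψ ψ))) ⟩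
      dilate (ψ * ψ) * (φ * φ) ∎

    Γ*Γ*φ≈ψ₂ : Γ * Γ * φ ≈ ψ₂
    Γ*Γ*φ≈ψ₂ = *-cancelˡ ψ₂ refl (begin
      ψ₂ * (Γ * Γ * φ)      ≈⟨ solve 3 (λ p g f → p :* (g :* g :* f) := g :* g :* (f :* p)) ≈-refl ψ₂ Γ φ ⟩
      Γ * Γ * (φ * ψ₂)      ≈⟨ *-congˡ ψ*ψ≈φ*ψ₂ ⟨
      Γ * Γ * (ψ * ψ)       ≈⟨ solve 2 (λ g p → g :* g :* (p :* p) := g :* p :* (g :* p)) ≈-refl Γ ψ ⟩
      Γ * ψ * (Γ * ψ)       ≈⟨ *-cong Γ*ψ≈ψ₂ Γ*ψ≈ψ₂ ⟩
      ψ₂ * ψ₂ ∎)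

    ψ*ψ≈ : ψ * ψ ≈ φ * (Γ * Γ * φ)
    ψ*ψ≈ = ≈-trans ψ*ψ≈φ*ψ₂ (*-congˡ (≈-sym Γ*Γ*φ≈ψ₂))

  coeff-even-σ-odd : ∀ n → ∃ λ w → coeff (even σ-odd) n ≡ sign n ℤ.* + ped₋₂ n ℤ.+ + 8 ℤ.* w
  coeff-even-σ-odd n = coeff w n , ≡.trans (at (proj₂ even-σ-odd) n)
    (cong₂ ℤ._+_ (coeff-Γ*Γ n) (constant-* (+ 8) w n))
    where
    w = proj₁ even-σ-odd

open GeneratingFunctions
  using (Graded; coeff; even; double; double≡; double-injective; double≢suc-double; parity; isEven; isOdd;
         triangle; 2*triangle; odds; oddsDeg; 2x+1; σ-odd; sign; 2∣double; 2∤suc-double; coeff-even-σ-odd)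
open import Data.Nat using (_+_; _*_; _^_; _%_; _/_; _≤_; _<_; NonZero)

-- The sum of divisors

divisors : ∀ k → .{{NonZero k}} → Enumeration (_∣ k)
divisors k = filterEnumeration (_∣? k) (Unique.upTo⁺ (suc k)) (λ d∣k → ∈-upTo⁺ (s≤s (∣⇒≤ d∣k)))

σ : ∀ k → .{{NonZero k}} → ℤ
σ k = ∑ (list (divisors k)) (λ d → + d)

σ-cong : ∀ {k l} .{{_ : NonZero k}} .{{_ : NonZero l}} → k ≡ l → σ k ≡ σ l
σ-cong refl = refl

-- `even` picks the coefficient of `σ-odd` at 2n, which belongs to 2(2n) + 1 = 4n + 1. All divisors
-- of this odd number are odd, so each is 2u + 1 with a cofactor 2v + 1.
σ-coeff : ∀ n → coeff (even σ-odd) n ≡ σ (suc (double (double n)))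
σ-coeff n = begin
  ∑ (list pairs) (λ (u , v) → 2x+1 (+ u))
    ≡⟨ ∑-cong (list pairs) (λ { {u , v} _ → cong (ℤ._+_ 1ℤ) (sym (ℤ.pos-* 2 u)) }) ⟩
  ∑ (list pairs) (λ (u , v) → + suc (2 * u))
    ≡⟨ ∑-map divisor (list pairs) ⟨
  ∑ (map divisor (list pairs)) (λ d → + d)
    ≡⟨ ∑-unique oddDivisors (divisors k) id id (λ _ → refl) ⟩
  σ k ∎
  where
  open ≡-Reasoning
  k = suc (double (double n))
  pairs = Graded.fibre odds (double n)

  divisor : ℕ × ℕ → ℕ
  divisor (u , v) = suc (2 * u)

  product≡ : ∀ u v → suc (2 * u) * suc (2 * v) ≡ suc (double (oddsDeg (u , v)))
  product≡ u v = ≡.trans (lemma u v) (cong suc (sym (double≡ (v + u * suc (2 * v)))))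
    where
    lemma : ∀ u v → suc (2 * u) * suc (2 * v) ≡ suc ((v + u * suc (2 * v)) + (v + u * suc (2 * v)))
    lemma = ℕ-Solver.solve-∀

  sound′ : ∀ {uv} → uv ∈ list pairs → suc (2 * proj₁ uv) * suc (2 * proj₂ uv) ≡ k
  sound′ {u , v} uv∈ = ≡.trans (product≡ u v) (cong (suc ∘ double) (sound pairs uv∈))

  odd-divisor : ∀ {d e} → d * e ≡ k → ∃ λ u → d ≡ suc (2 * u)
  odd-divisor {d} {e} eq with parity d
  ... | isOdd u  = u , cong suc (≡.trans (double≡ u) (lemma u))
    where
    lemma : ∀ u → u + u ≡ 2 * u
    lemma = ℕ-Solver.solve-∀
  ... | isEven u = contradiction (≡.trans (≡.trans (double≡ (u * e)) (≡.trans (lemma u e) (cong (_* e) (sym (double≡ u))))) eq)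
                     (double≢suc-double {u * e} {double n})
    where
    lemma : ∀ u e → u * e + u * e ≡ (u + u) * e
    lemma = ℕ-Solver.solve-∀

  oddDivisors : Enumeration (_∣ k)
  oddDivisors = record
    { list     = map divisor (list pairs)
    ; unique   = map-unique divisor injective (unique pairs)
    ; sound    = λ d∈ → let (u , v) , uv∈ , d≡ = ∈-map⁻ divisor d∈ in
                 divides (suc (2 * v)) (≡.trans (sym (sound′ uv∈)) (≡.trans (ℕ.*-comm (suc (2 * u)) _) (cong (suc (2 * v) *_) (sym d≡))))
    ; complete = complete′
    }
    where
    injective : ∀ {x y} → x ∈ list pairs → y ∈ list pairs → divisor x ≡ divisor y → x ≡ y
    injective {u , v} {u′ , v′} p q eq with ℕ.*-cancelˡ-≡ u u′ 2 (ℕ.suc-injective eq)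
    ... | refl = cong (u ,_) (ℕ.*-cancelˡ-≡ v v′ 2 (ℕ.suc-injective
      (ℕ.*-cancelˡ-≡ (suc (2 * v)) (suc (2 * v′)) (suc (2 * u)) (≡.trans (sound′ p) (sym (sound′ q))))))

    complete′ : ∀ {d} → d ∣ k → d ∈ map divisor (list pairs)
    complete′ {d} (divides e k≡e*d) with odd-divisor {d} {e} (≡.trans (ℕ.*-comm d e) (sym k≡e*d)) | odd-divisor {e} {d} (sym k≡e*d)
    ... | u , refl | v , refl = ∈-map⁺ divisor {x = u , v} (complete pairs (double-injective (ℕ.suc-injective
      (≡.trans (sym (product≡ u v)) (≡.trans (ℕ.*-comm (suc (2 * u)) (suc (2 * v))) (sym k≡e*d))))))

σ≡±ped : ∀ n → ∃ λ w → σ (suc (double (double n))) ≡ sign n ℤ.* + ped₋₂ n ℤ.+ + 8 ℤ.* w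
σ≡±ped n = let w , eq = coeff-even-σ-odd n in w , ≡.trans (sym (σ-coeff n)) eq

∤⇒coprime : ∀ {p d} → Prime p → ¬ p ∣ d → Coprime d p
∤⇒coprime pp p∤d (i∣d , i∣p) with prime⇒irreducible pp i∣p
... | inj₁ i≡1  = i≡1
... | inj₂ refl = contradiction i∣d p∤d

∤-divisor : ∀ {p d} a {m} → Prime p → ¬ p ∣ d → d ∣ p ^ a * m → d ∣ m
∤-divisor zero    {m} pp p∤d d∣ = subst (_ ∣_) (ℕ.*-identityˡ m) d∣
∤-divisor {p} {d} (suc a) {m} pp p∤d d∣ = ∤-divisor a pp p∤d
  (coprime-divisor (∤⇒coprime pp p∤d) (subst (d ∣_) (ℕ.*-assoc p (p ^ a) m) d∣))

-- 1 + p + ... + pᵃ in Horner form.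
geometric : ℕ → ℕ → ℤ
geometric p zero    = 1ℤ
geometric p (suc a) = 1ℤ ℤ.+ + p ℤ.* geometric p a

*-nonZero : ∀ {m n} → NonZero m → NonZero n → NonZero (m * n)
*-nonZero {m} {n} m≢0 n≢0 = ℕ.m*n≢0 m n {{m≢0}} {{n≢0}}

^-nonZero : ∀ {p} a → Prime p → NonZero (p ^ a)
^-nonZero {p} a pp = ℕ.m^n≢0 p a {{prime⇒nonZero pp}}

-- A divisor of p^{a+1} m that p does not divide is a divisor of m, and every other one is p times a
-- divisor of p^a m.
σ-suc : ∀ {p m} a → Prime p → ¬ p ∣ m → .{{_ : NonZero m}} .{{_ : NonZero (p ^ a * m)}} .{{_ : NonZero (p ^ suc a * m)}} →
  σ (p ^ suc a * m) ≡ σ m ℤ.+ + p ℤ.* σ (p ^ a * m)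
σ-suc {p} {m} a pp p∤m = begin
  σ (p ^ suc a * m)
    ≡⟨ ∑-bijection (divisors (p ^ suc a * m)) (sumEnumeration (divisors m) (divisors (p ^ a * m)))
         {w = [ (λ d → + d) , (λ d → + p ℤ.* + d) ]} to from (λ {d} → toDivides d) (λ {z} → fromDivides z)
         (λ {d} _ → from-to d) (λ {z} → to-from z) (λ {d} _ → weight≡ d) ⟩
  ∑ (list (sumEnumeration (divisors m) (divisors (p ^ a * m)))) [ (λ d → + d) , (λ d → + p ℤ.* + d) ]
    ≡⟨ ∑-sumEnumeration (divisors m) (divisors (p ^ a * m)) [ (λ d → + d) , (λ d → + p ℤ.* + d) ] ⟩
  σ m ℤ.+ ∑ (list (divisors (p ^ a * m))) (λ d → + p ℤ.* + d)
    ≡⟨ cong (ℤ._+_ (σ m)) (∑-*ˡ (list (divisors (p ^ a * m))) (+ p) (λ d → + d)) ⟩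
  σ m ℤ.+ + p ℤ.* σ (p ^ a * m) ∎
  where
  open ≡-Reasoning
  instance
    p≢0 : NonZero p
    p≢0 = prime⇒nonZero pp

  to : ℕ → ℕ ⊎ ℕ
  to d with p ∣? d
  ... | yes _ = inj₂ (d / p)
  ... | no  _ = inj₁ d

  from : ℕ ⊎ ℕ → ℕ
  from (inj₁ d) = d
  from (inj₂ d) = d * p

  from-to : ∀ d → from (to d) ≡ d
  from-to d with p ∣? d
  ... | yes p∣d = m/n*n≡m p∣d
  ... | no  _   = refl

  to-from : ∀ z → [ _∣ m , _∣ p ^ a * m ] z → to (from z) ≡ z
  to-from (inj₁ d) d∣m with p ∣? d
  ... | yes p∣d = contradiction (∣-trans p∣d d∣m) p∤m
  ... | no  _   = refl
  to-from (inj₂ d) _ with p ∣? d * p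
  ... | yes _ = cong inj₂ (m*n/n≡m d p)
  ... | no ∤  = contradiction (n∣m*n d) ∤

  toDivides : ∀ d → d ∣ p ^ suc a * m → [ _∣ m , _∣ p ^ a * m ] (to d)
  toDivides d d∣ with p ∣? d
  ... | yes (divides e refl) = subst (_∣ p ^ a * m) (sym (m*n/n≡m e p))
    (*-cancelʳ-∣ p (subst (e * p ∣_) (lemma p (p ^ a) m) d∣))
    where
    lemma : ∀ p x m → p * x * m ≡ x * m * p
    lemma = ℕ-Solver.solve-∀
  ... | no p∤d = ∤-divisor (suc a) pp p∤d d∣

  fromDivides : ∀ z → [ _∣ m , _∣ p ^ a * m ] z → from z ∣ p ^ suc a * m
  fromDivides (inj₁ d) d∣ = ∣n⇒∣m*n (p ^ suc a) d∣
  fromDivides (inj₂ d) d∣ = subst (d * p ∣_) (lemma p (p ^ a) m) (*-monoˡ-∣ p d∣)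
    where
    lemma : ∀ p x m → x * m * p ≡ p * x * m
    lemma = ℕ-Solver.solve-∀

  weight≡ : ∀ d → + d ≡ [ (λ d → + d) , (λ d → + p ℤ.* + d) ] (to d)
  weight≡ d with p ∣? d
  ... | yes p∣d = ≡.trans (cong (λ n → + n) (≡.trans (sym (m/n*n≡m p∣d)) (ℕ.*-comm (d / p) p))) (ℤ.pos-* p (d / p))
  ... | no  _   = refl

σ-multiplicative : ∀ {p m} a → Prime p → ¬ p ∣ m → .{{_ : NonZero m}} .{{_ : NonZero (p ^ a * m)}} →
  σ (p ^ a * m) ≡ geometric p a ℤ.* σ m
σ-multiplicative {p} {m} zero pp p∤m = ≡.trans (σ-cong (ℕ.*-identityˡ m)) (sym (ℤ.*-identityˡ (σ m)))
σ-multiplicative {p} {m} (suc a) pp p∤m = begin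
  σ (p ^ suc a * m)                              ≡⟨ σ-suc a pp p∤m ⟩
  σ m ℤ.+ + p ℤ.* σ (p ^ a * m)                  ≡⟨ cong (λ s → σ m ℤ.+ + p ℤ.* s) (σ-multiplicative a pp p∤m) ⟩
  σ m ℤ.+ + p ℤ.* (geometric p a ℤ.* σ m)        ≡⟨ lemma (+ p) (geometric p a) (σ m) ⟩
  geometric p (suc a) ℤ.* σ m                    ∎
  where
  open ≡-Reasoning
  instance
    p^a*m≢0 : NonZero (p ^ a * m)
    p^a*m≢0 = ℕ.m*n≢0 (p ^ a) m {{^-nonZero a pp}}
  lemma : ∀ p g s → s ℤ.+ p ℤ.* (g ℤ.* s) ≡ (1ℤ ℤ.+ p ℤ.* g) ℤ.* s
  lemma = solve-∀

-- An `OddMultiple` of d lies in the class of d modulo 2d. Taken for d = 1, 2, 4, together with the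
-- `Multiple`s of 8, these are the outcomes of the theorem, in a form that passes to products.
OddMultiple Multiple : ℤ → ℤ → Set
OddMultiple d x = ∃ λ t → x ≡ d ℤ.* (1ℤ ℤ.+ + 2 ℤ.* t)
Multiple    d x = ∃ λ t → x ≡ d ℤ.* t

OddMultiple-* : ∀ {d e x y} → OddMultiple d x → OddMultiple e y → OddMultiple (d ℤ.* e) (x ℤ.* y)
OddMultiple-* {d} {e} (s , refl) (t , refl) = s ℤ.+ t ℤ.+ + 2 ℤ.* s ℤ.* t , lemma d e s t
  where
  lemma : ∀ d e s t → (d ℤ.* (1ℤ ℤ.+ + 2 ℤ.* s)) ℤ.* (e ℤ.* (1ℤ ℤ.+ + 2 ℤ.* t)) ≡
    d ℤ.* e ℤ.* (1ℤ ℤ.+ + 2 ℤ.* (s ℤ.+ t ℤ.+ + 2 ℤ.* s ℤ.* t))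
  lemma = solve-∀

Multiple-* : ∀ {d e x y} → Multiple d x → Multiple e y → Multiple (d ℤ.* e) (x ℤ.* y)
Multiple-* {d} {e} (s , refl) (t , refl) = s ℤ.* t , lemma d e s t
  where
  lemma : ∀ d e s t → (d ℤ.* s) ℤ.* (e ℤ.* t) ≡ d ℤ.* e ℤ.* (s ℤ.* t)
  lemma = solve-∀

Multiple-1 : ∀ x → Multiple 1ℤ x
Multiple-1 x = x , sym (ℤ.*-identityˡ x)

-- Powers of two dividing 1 + p + ... + pᵃ

Odd : ℕ → Set
Odd n = ∃ λ r → n ≡ 1 + 2 * r

¬2∣⇒Odd : ∀ {n} → ¬ 2 ∣ n → Odd n
¬2∣⇒Odd {n} 2∤n with parity n
... | isEven k = contradiction (2∣double k) 2∤n
... | isOdd k  = k , cong suc (≡.trans (double≡ k) (lemma k))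
  where
  lemma : ∀ k → k + k ≡ 2 * k
  lemma = ℕ-Solver.solve-∀

+1+ : ∀ d r → + (1 + d * r) ≡ 1ℤ ℤ.+ + d ℤ.* + r
+1+ d r = cong (λ x → 1ℤ ℤ.+ x) (ℤ.pos-* d r)

-- There are 2c + 1 summands, all odd. The witness results from expanding 1 + p + p² g at p = 1 + 2r
-- and g = 1 + 2t.
geometric-even : ∀ {p} c → Odd p → OddMultiple 1ℤ (geometric p (double c))
geometric-even zero _ = 0ℤ , refl
geometric-even {p} (suc c) odd@(r , refl) = let t , eq = geometric-even {p} c odd in
  1ℤ ℤ.+ + r ℤ.+ t ℤ.+ + 2 ℤ.* + r ℤ.+ + 2 ℤ.* + r ℤ.* + r ℤ.+ + 4 ℤ.* + r ℤ.* t ℤ.+ + 4 ℤ.* + r ℤ.* + r ℤ.* t ,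
  ≡.trans (cong₂ (λ p g → 1ℤ ℤ.+ p ℤ.* (1ℤ ℤ.+ p ℤ.* g)) (+1+ 2 r) eq) (lemma (+ r) t)
  where
  lemma : ∀ r t → let p = 1ℤ ℤ.+ + 2 ℤ.* r in
    1ℤ ℤ.+ p ℤ.* (1ℤ ℤ.+ p ℤ.* (1ℤ ℤ.* (1ℤ ℤ.+ + 2 ℤ.* t))) ≡
    1ℤ ℤ.* (1ℤ ℤ.+ + 2 ℤ.* (1ℤ ℤ.+ r ℤ.+ t ℤ.+ + 2 ℤ.* r ℤ.+ + 2 ℤ.* r ℤ.* r ℤ.+ + 4 ℤ.* r ℤ.* t ℤ.+ + 4 ℤ.* r ℤ.* r ℤ.* t))
  lemma = solve-∀

-- 1 + p + … + p^{2c+1} = (1 + p)(1 + p² + … + p^{2c}), and p² ≡ 1 (mod 8).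
geometric-odd : ∀ c r → ∃ λ t → geometric (1 + 2 * r) (suc (double c)) ≡
  + 2 ℤ.* (1ℤ ℤ.+ + r) ℤ.* (1ℤ ℤ.+ + c ℤ.+ + 8 ℤ.* t)
geometric-odd c r =
  let t , eq = factor c in
  t , ≡.trans eq (cong (λ x → x ℤ.* (1ℤ ℤ.+ + c ℤ.+ + 8 ℤ.* t)) (≡.trans (cong (ℤ._+_ 1ℤ) (+1+ 2 r)) (lemma (+ r))))
  where
  p = 1 + 2 * r
  lemma : ∀ r → 1ℤ ℤ.+ (1ℤ ℤ.+ + 2 ℤ.* r) ≡ + 2 ℤ.* (1ℤ ℤ.+ r)
  lemma = solve-∀

  lemma₀ : ∀ p → 1ℤ ℤ.+ p ℤ.* 1ℤ ≡ (1ℤ ℤ.+ p) ℤ.* (1ℤ ℤ.+ 0ℤ ℤ.+ + 8 ℤ.* 0ℤ)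
  lemma₀ = solve-∀

  r[r+1] : ∃ λ s → + r ℤ.* + r ℤ.+ + r ≡ + 2 ℤ.* s
  r[r+1] = + triangle r , sym (2*triangle r)

  p² : ∃ λ s → + p ℤ.* + p ≡ 1ℤ ℤ.+ + 8 ℤ.* s
  p² = let s , eq = r[r+1] in s , ≡.trans (cong (λ x → x ℤ.* x) (+1+ 2 r))
    (≡.trans (lemma₁ (+ r)) (≡.trans (cong (λ x → 1ℤ ℤ.+ + 4 ℤ.* x) eq) (lemma₂ s)))
    where
    lemma₁ : ∀ r → (1ℤ ℤ.+ + 2 ℤ.* r) ℤ.* (1ℤ ℤ.+ + 2 ℤ.* r) ≡ 1ℤ ℤ.+ + 4 ℤ.* (r ℤ.* r ℤ.+ r)
    lemma₁ = solve-∀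
    lemma₂ : ∀ s → 1ℤ ℤ.+ + 4 ℤ.* (+ 2 ℤ.* s) ≡ 1ℤ ℤ.+ + 8 ℤ.* s
    lemma₂ = solve-∀

  factor : ∀ c → ∃ λ t → geometric p (suc (double c)) ≡ (1ℤ ℤ.+ + p) ℤ.* (1ℤ ℤ.+ + c ℤ.+ + 8 ℤ.* t)
  factor zero    = 0ℤ , lemma₀ (+ p)
  factor (suc c) = let t , eq = factor c ; s , p²≡ = p² in t ℤ.+ s ℤ.+ s ℤ.* + c ℤ.+ + 8 ℤ.* s ℤ.* t , (begin
    1ℤ ℤ.+ + p ℤ.* (1ℤ ℤ.+ + p ℤ.* geometric p (suc (double c)))
      ≡⟨ cong (λ g → 1ℤ ℤ.+ + p ℤ.* (1ℤ ℤ.+ + p ℤ.* g)) eq ⟩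
    1ℤ ℤ.+ + p ℤ.* (1ℤ ℤ.+ + p ℤ.* ((1ℤ ℤ.+ + p) ℤ.* (1ℤ ℤ.+ + c ℤ.+ + 8 ℤ.* t)))
      ≡⟨ step₁ (+ p) (1ℤ ℤ.+ + c ℤ.+ + 8 ℤ.* t) ⟩
    (1ℤ ℤ.+ + p) ℤ.* (1ℤ ℤ.+ + p ℤ.* + p ℤ.* (1ℤ ℤ.+ + c ℤ.+ + 8 ℤ.* t))
      ≡⟨ cong (λ x → (1ℤ ℤ.+ + p) ℤ.* (1ℤ ℤ.+ x ℤ.* (1ℤ ℤ.+ + c ℤ.+ + 8 ℤ.* t))) p²≡ ⟩
    (1ℤ ℤ.+ + p) ℤ.* (1ℤ ℤ.+ (1ℤ ℤ.+ + 8 ℤ.* s) ℤ.* (1ℤ ℤ.+ + c ℤ.+ + 8 ℤ.* t))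
      ≡⟨ step₂ (+ p) s (+ c) t ⟩
    (1ℤ ℤ.+ + p) ℤ.* (1ℤ ℤ.+ (1ℤ ℤ.+ + c) ℤ.+ + 8 ℤ.* (t ℤ.+ s ℤ.+ s ℤ.* + c ℤ.+ + 8 ℤ.* s ℤ.* t)) ∎)
    where
    open ≡-Reasoning
    step₁ : ∀ p x → 1ℤ ℤ.+ p ℤ.* (1ℤ ℤ.+ p ℤ.* ((1ℤ ℤ.+ p) ℤ.* x)) ≡ (1ℤ ℤ.+ p) ℤ.* (1ℤ ℤ.+ p ℤ.* p ℤ.* x)
    step₁ = solve-∀
    step₂ : ∀ p s c t → (1ℤ ℤ.+ p) ℤ.* (1ℤ ℤ.+ (1ℤ ℤ.+ + 8 ℤ.* s) ℤ.* (1ℤ ℤ.+ c ℤ.+ + 8 ℤ.* t)) ≡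
      (1ℤ ℤ.+ p) ℤ.* (1ℤ ℤ.+ (1ℤ ℤ.+ c) ℤ.+ + 8 ℤ.* (t ℤ.+ s ℤ.+ s ℤ.* c ℤ.+ + 8 ℤ.* s ℤ.* t))
    step₂ = solve-∀

%⇒ : ∀ {n r} d .{{_ : NonZero d}} → n % d ≡ r → ∃ λ q → n ≡ r + q * d
%⇒ {n} d refl = n / d , m≡m%n+[m/n]*n n d

-- For p = 2r + 1 and a = 2c + 1 the sum is 2(1 + r)(1 + c + 8t). Here 1 + r is odd exactly if p ≡ 1
-- (mod 4), and 1 + c is odd, 2 mod 4 or 0 mod 4 according as a is 1 mod 4, 3 mod 8 or 7 mod 8.
module GeometricResidues {p} (odd : Odd p) where
  private
    r = proj₁ odd

    expand : ∀ c → ∃ λ t → geometric p (suc (double c)) ≡ + 2 ℤ.* (1ℤ ℤ.+ + r) ℤ.* (1ℤ ℤ.+ + c ℤ.+ + 8 ℤ.* t)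
    expand c = subst (λ q → ∃ λ t → geometric q (suc (double c)) ≡ + 2 ℤ.* (1ℤ ℤ.+ + r) ℤ.* (1ℤ ℤ.+ + c ℤ.+ + 8 ℤ.* t))
      (sym (proj₂ odd)) (geometric-odd c r)

    half-exponent : ∀ {c a} k → suc (double c) ≡ a → a ≡ suc (2 * k) → c ≡ k
    half-exponent {c} k refl eq = ℕ.*-cancelˡ-≡ c k 2 (≡.trans (lemma c) (≡.trans (sym (double≡ c)) (ℕ.suc-injective eq)))
      where
      lemma : ∀ c → 2 * c ≡ c + c
      lemma = ℕ-Solver.solve-∀

    r-even : p % 4 ≡ 1 → ∃ λ q → r ≡ 2 * q
    r-even p%4≡1 with %⇒ {p} 4 p%4≡1
    ... | q , p≡ = q , ℕ.*-cancelˡ-≡ r (2 * q) 2 (ℕ.suc-injective (≡.trans (sym (proj₂ odd)) (≡.trans p≡ (lemma q))))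
      where
      lemma : ∀ q → 1 + q * 4 ≡ suc (2 * (2 * q))
      lemma = ℕ-Solver.solve-∀

  geometric-2 : ∀ c → Multiple (+ 2) (geometric p (suc (double c)))
  geometric-2 c = let t , eq = expand c in (1ℤ ℤ.+ + r) ℤ.* (1ℤ ℤ.+ + c ℤ.+ + 8 ℤ.* t) , ≡.trans eq (ℤ.*-assoc (+ 2) (1ℤ ℤ.+ + r) (1ℤ ℤ.+ + c ℤ.+ + 8 ℤ.* t))

  geometric-1%4 : ∀ c → p % 4 ≡ 1 → suc (double c) % 4 ≡ 1 → OddMultiple (+ 2) (geometric p (suc (double c)))
  geometric-1%4 c p%4≡1 a%4≡1 with r-even p%4≡1 | %⇒ {suc (double c)} 4 a%4≡1 | expand c
  ... | q , r≡ | k , a≡ | t , eq = + q ℤ.+ + k ℤ.+ + 4 ℤ.* t ℤ.+ + 2 ℤ.* + q ℤ.* + k ℤ.+ + 8 ℤ.* + q ℤ.* t , ≡.trans eq (≡.trans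
    (cong₂ (λ r c → + 2 ℤ.* (1ℤ ℤ.+ r) ℤ.* (1ℤ ℤ.+ c ℤ.+ + 8 ℤ.* t))
      (≡.trans (cong (λ n → + n) r≡) (ℤ.pos-* 2 q))
      (≡.trans (cong (λ n → + n) (half-exponent {c} (2 * k) refl (≡.trans a≡ (lemma k)))) (ℤ.pos-* 2 k)))
    (lemma′ (+ q) (+ k) t))
    where
    lemma : ∀ k → 1 + k * 4 ≡ suc (2 * (2 * k))
    lemma = ℕ-Solver.solve-∀
    lemma′ : ∀ q k t → + 2 ℤ.* (1ℤ ℤ.+ + 2 ℤ.* q) ℤ.* (1ℤ ℤ.+ + 2 ℤ.* k ℤ.+ + 8 ℤ.* t) ≡
      + 2 ℤ.* (1ℤ ℤ.+ + 2 ℤ.* (q ℤ.+ k ℤ.+ + 4 ℤ.* t ℤ.+ + 2 ℤ.* q ℤ.* k ℤ.+ + 8 ℤ.* q ℤ.* t))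
    lemma′ = solve-∀

  geometric-3%8 : ∀ c → p % 4 ≡ 1 → suc (double c) % 8 ≡ 3 → OddMultiple (+ 4) (geometric p (suc (double c)))
  geometric-3%8 c p%4≡1 a%8≡3 with r-even p%4≡1 | %⇒ {suc (double c)} 8 a%8≡3 | expand c
  ... | q , r≡ | k , a≡ | t , eq = + q ℤ.+ + k ℤ.+ + 2 ℤ.* t ℤ.+ + 2 ℤ.* + q ℤ.* + k ℤ.+ + 4 ℤ.* + q ℤ.* t , ≡.trans eq (≡.trans
    (cong₂ (λ r c → + 2 ℤ.* (1ℤ ℤ.+ r) ℤ.* (1ℤ ℤ.+ c ℤ.+ + 8 ℤ.* t))
      (≡.trans (cong (λ n → + n) r≡) (ℤ.pos-* 2 q))
      (≡.trans (cong (λ n → + n) (half-exponent {c} (1 + 4 * k) refl (≡.trans a≡ (lemma k)))) (+1+ 4 k)))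
    (lemma′ (+ q) (+ k) t))
    where
    lemma : ∀ k → 3 + k * 8 ≡ suc (2 * (1 + 4 * k))
    lemma = ℕ-Solver.solve-∀
    lemma′ : ∀ q k t → + 2 ℤ.* (1ℤ ℤ.+ + 2 ℤ.* q) ℤ.* (1ℤ ℤ.+ (1ℤ ℤ.+ + 4 ℤ.* k) ℤ.+ + 8 ℤ.* t) ≡
      + 4 ℤ.* (1ℤ ℤ.+ + 2 ℤ.* (q ℤ.+ k ℤ.+ + 2 ℤ.* t ℤ.+ + 2 ℤ.* q ℤ.* k ℤ.+ + 4 ℤ.* q ℤ.* t))
    lemma′ = solve-∀

  geometric-7%8 : ∀ c → suc (double c) % 8 ≡ 7 → Multiple (+ 8) (geometric p (suc (double c)))
  geometric-7%8 c a%8≡7 with %⇒ {suc (double c)} 8 a%8≡7 | expand c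
  ... | k , a≡ | t , eq = (1ℤ ℤ.+ + r) ℤ.* (1ℤ ℤ.+ + k ℤ.+ + 2 ℤ.* t) , ≡.trans eq (≡.trans
    (cong (λ c → + 2 ℤ.* (1ℤ ℤ.+ + r) ℤ.* (1ℤ ℤ.+ c ℤ.+ + 8 ℤ.* t))
      (≡.trans (cong (λ n → + n) (half-exponent {c} (3 + 4 * k) refl (≡.trans a≡ (lemma k)))) (cong (λ x → + 3 ℤ.+ x) (ℤ.pos-* 4 k))))
    (lemma′ (+ r) (+ k) t))
    where
    lemma : ∀ k → 7 + k * 8 ≡ suc (2 * (3 + 4 * k))
    lemma = ℕ-Solver.solve-∀
    lemma′ : ∀ r k t → + 2 ℤ.* (1ℤ ℤ.+ r) ℤ.* (1ℤ ℤ.+ (+ 3 ℤ.+ + 4 ℤ.* k) ℤ.+ + 8 ℤ.* t) ≡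
      + 8 ℤ.* ((1ℤ ℤ.+ r) ℤ.* (1ℤ ℤ.+ k ℤ.+ + 2 ℤ.* t))
    lemma′ = solve-∀

  geometric-3%4 : ∀ c → suc (double c) % 4 ≡ 3 → Multiple (+ 4) (geometric p (suc (double c)))
  geometric-3%4 c a%4≡3 with %⇒ {suc (double c)} 4 a%4≡3 | expand c
  ... | k , a≡ | t , eq = (1ℤ ℤ.+ + r) ℤ.* (1ℤ ℤ.+ + k ℤ.+ + 4 ℤ.* t) , ≡.trans eq (≡.trans
    (cong (λ c → + 2 ℤ.* (1ℤ ℤ.+ + r) ℤ.* (1ℤ ℤ.+ c ℤ.+ + 8 ℤ.* t))
      (≡.trans (cong (λ n → + n) (half-exponent {c} (1 + 2 * k) refl (≡.trans a≡ (lemma k)))) (+1+ 2 k)))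
    (lemma′ (+ r) (+ k) t))
    where
    lemma : ∀ k → 3 + k * 4 ≡ suc (2 * (1 + 2 * k))
    lemma = ℕ-Solver.solve-∀
    lemma′ : ∀ r k t → + 2 ℤ.* (1ℤ ℤ.+ r) ℤ.* (1ℤ ℤ.+ (1ℤ ℤ.+ + 2 ℤ.* k) ℤ.+ + 8 ℤ.* t) ≡
      + 4 ℤ.* ((1ℤ ℤ.+ r) ℤ.* (1ℤ ℤ.+ k ℤ.+ + 4 ℤ.* t))
    lemma′ = solve-∀

  geometric-p%4≡3 : ∀ c → p % 4 ≡ 3 → Multiple (+ 4) (geometric p (suc (double c)))
  geometric-p%4≡3 c p%4≡3 with %⇒ {p} 4 p%4≡3 | expand c
  ... | k , p≡ | t , eq = (1ℤ ℤ.+ + k) ℤ.* (1ℤ ℤ.+ + c ℤ.+ + 8 ℤ.* t) , ≡.trans eq (≡.trans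
    (cong (λ r → + 2 ℤ.* (1ℤ ℤ.+ r) ℤ.* (1ℤ ℤ.+ + c ℤ.+ + 8 ℤ.* t))
      (≡.trans (cong (λ n → + n) (ℕ.*-cancelˡ-≡ r (1 + 2 * k) 2 (ℕ.suc-injective (≡.trans (sym (proj₂ odd)) (≡.trans p≡ (lemma k)))))) (+1+ 2 k)))
    (lemma′ (+ c) (+ k) t))
    where
    lemma : ∀ k → 3 + k * 4 ≡ suc (2 * (1 + 2 * k))
    lemma = ℕ-Solver.solve-∀
    lemma′ : ∀ c k t → + 2 ℤ.* (1ℤ ℤ.+ (1ℤ ℤ.+ + 2 ℤ.* k)) ℤ.* (1ℤ ℤ.+ c ℤ.+ + 8 ℤ.* t) ≡
      + 4 ℤ.* ((1ℤ ℤ.+ k) ℤ.* (1ℤ ℤ.+ c ℤ.+ + 8 ℤ.* t))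
    lemma′ = solve-∀

-- Prime factors and their exponents

∃prime-divisor : ∀ m → .{{NonZero m}} → m ≢ 1 → ∃₂ λ p m′ → Prime p × m ≡ p * m′
∃prime-divisor m m≢1 with factorise m
... | record { factors = []     ; isFactorisation = eq }                             = contradiction eq m≢1
... | record { factors = p ∷ ps ; isFactorisation = eq ; factorsPrime = pp ∷ _ } = p , product ps , pp , eq

prime≢1 : ∀ {p} → Prime p → p ≢ 1
prime≢1 pp refl = ℕ.<-irrefl refl (ℕ.nonTrivial⇒n>1 1 {{prime⇒nonTrivial pp}})

nonZero-factors : ∀ m n → NonZero (m * n) → NonZero m × NonZero n
nonZero-factors zero    n       ()
nonZero-factors (suc m) zero    mn≢0 = contradiction (ℕ.*-zeroʳ m) (ℕ.≢-nonZero⁻¹ (m * 0) {{mn≢0}})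
nonZero-factors (suc m) (suc n) _    = _ , _

∤-* : ∀ {p} m n → Prime p → ¬ p ∣ m → ¬ p ∣ n → ¬ p ∣ m * n
∤-* m n pp p∤m p∤n p∣mn = [ p∤m , p∤n ] (euclidsLemma m n pp p∣mn)

∤-1 : ∀ {p} → Prime p → ¬ p ∣ 1
∤-1 pp p∣1 = prime≢1 pp (∣1⇒≡1 p∣1)

∤-^ : ∀ {p} m a → Prime p → ¬ p ∣ m → ¬ p ∣ m ^ a
∤-^ m zero    pp p∤m = ∤-1 pp
∤-^ m (suc a) pp p∤m = ∤-* m (m ^ a) pp p∤m (∤-^ m a pp p∤m)

∤-prime : ∀ {p q} → Prime p → Prime q → p ≢ q → ¬ p ∣ q
∤-prime pp pq p≢q p∣q = [ prime≢1 pp , p≢q ] (prime⇒irreducible pq p∣q)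

-- If p still divided the cofactor, a higher power of p would divide n, against `ord-maximal`.
p-part : ∀ {p} n → Prime p → .{{NonZero n}} → ∃₂ λ c n′ → n ≡ p ^ c * n′ × ¬ p ∣ n′
p-part {p} n pp with ord-divides p n
... | divides q n≡ = ord p n , q , ≡.trans n≡ (ℕ.*-comm q _) , λ { (divides q′ refl) →
  ℕ.<-irrefl refl (ord-maximal p n {{prime⇒nonTrivial pp}} (suc (ord p n))
    (divides q′ (≡.trans n≡ (ℕ.*-assoc q′ p (p ^ ord p n))))) }

ord-unique : ∀ {p k} a m → Prime p → .{{NonZero k}} → k ≡ p ^ a * m → ¬ p ∣ m → ord p k ≡ a
ord-unique {p} {k} a m pp k≡ p∤m = ℕ.≤-antisym (ℕ.≮⇒≥ too-large)
  (ord-maximal p k {{prime⇒nonTrivial pp}} a (divides m (≡.trans k≡ (ℕ.*-comm (p ^ a) m))))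
  where
  too-large : ¬ a < ord p k
  too-large a<ord = p∤m (*-cancelˡ-∣ (p ^ a) {{^-nonZero a pp}}
    (subst₂ _∣_ (ℕ.*-comm p (p ^ a)) k≡ (∣-trans (^-mono-∣ a<ord) (ord-divides p k))))
    where
    open ≡ using (subst₂)
    ^-mono-∣ : ∀ {a b} → a ≤ b → p ^ a ∣ p ^ b
    ^-mono-∣ {a} {b} a≤b = divides (p ^ (b ℕ.∸ a)) (≡.trans (cong (p ^_) (sym (ℕ.m∸n+n≡m a≤b))) (ℕ.^-distribˡ-+-* p (b ℕ.∸ a) a))

^-double : ∀ p c → p ^ double c ≡ (p ^ c) ^ 2
^-double p c = ≡.trans (cong (p ^_) (≡.trans (double≡ c) (lemma c))) (sym (ℕ.^-*-assoc p c 2))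
  where
  lemma : ∀ c → c + c ≡ c * 2
  lemma = ℕ-Solver.solve-∀

^2-* : ∀ m n → (m * n) ^ 2 ≡ m ^ 2 * n ^ 2
^2-* = lemma
  where
  lemma : ∀ m n → m * n * (m * n * 1) ≡ m * (m * 1) * (n * (n * 1))
  lemma = ℕ-Solver.solve-∀

record SquarePart (p N : ℕ) : Set where
  field
    {exponent rest} : ℕ
    rest≢0          : NonZero rest
    rest∣N          : rest ∣ N
    p∤rest          : ¬ p ∣ rest
    factorisation   : N ^ 2 ≡ p ^ double exponent * rest ^ 2

squarePart : ∀ p N → Prime p → .{{NonZero N}} → SquarePart p N
squarePart p N pp with p-part {p} N pp
... | c , N′ , refl , p∤N′ = record
  { exponent      = c
  ; rest          = N′
  ; rest≢0        = ℕ.≢-nonZero λ { refl → p∤N′ (p ∣0) }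
  ; rest∣N        = n∣m*n (p ^ c)
  ; p∤rest        = p∤N′
  ; factorisation = ≡.trans (^2-* (p ^ c) N′) (cong (_* N′ ^ 2) (sym (^-double p c)))
  }

^2-nonZero : ∀ {N} → NonZero N → NonZero (N ^ 2)
^2-nonZero {N} N≢0 = ℕ.m^n≢0 N 2 {{N≢0}}

-- The exponent of p in N²pM is odd: 2c + 1, where c is the exponent of p in N. The cofactor is
-- again a square times M, so further primes of M can be split off in the same way.
module Peel {p N : ℕ} (M : ℕ) (pp : Prime p) (N≢0 : NonZero N) (M≢0 : NonZero M) (p∤M : ¬ p ∣ M) where
  open SquarePart (squarePart p N pp {{N≢0}}) public

  p-exponent : ℕ
  p-exponent = suc (double exponent)

  cofactor : ℕ
  cofactor = rest ^ 2 * M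

  cofactor≢0 : NonZero cofactor
  cofactor≢0 = *-nonZero (^2-nonZero rest≢0) M≢0

  p∤cofactor : ¬ p ∣ cofactor
  p∤cofactor = ∤-* (rest ^ 2) M pp (∤-^ rest 2 pp p∤rest) p∤M

  peeled : N ^ 2 * (p * M) ≡ p ^ p-exponent * cofactor
  peeled = ≡.trans (cong (_* (p * M)) factorisation) (lemma (p ^ double exponent) (rest ^ 2) p M)
    where
    lemma : ∀ x n p m → x * n * (p * m) ≡ p * x * (n * m)
    lemma = ℕ-Solver.solve-∀

  σ-peeled : ∀ {k} .{{_ : NonZero k}} .{{_ : NonZero cofactor}} → k ≡ N ^ 2 * (p * M) →
    σ k ≡ geometric p p-exponent ℤ.* σ cofactor
  σ-peeled k≡ = ≡.trans (σ-cong (≡.trans k≡ peeled)) (σ-multiplicative p-exponent pp p∤cofactor)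
    where
    instance
      product≢0 : NonZero (p ^ p-exponent * cofactor)
      product≢0 = *-nonZero (^-nonZero p-exponent pp) cofactor≢0

-- Strong induction on N: a prime p dividing N splits off an even power of p, whose divisor sum is
-- odd because p is odd, and leaves the square of a proper divisor of N.
σ-square : ∀ N → .{{NonZero N}} → ¬ 2 ∣ N → .{{_ : NonZero (N ^ 2)}} → OddMultiple 1ℤ (σ (N ^ 2))
σ-square N 2∤N = <-rec (λ N → .{{NonZero N}} → ¬ 2 ∣ N → .{{_ : NonZero (N ^ 2)}} → OddMultiple 1ℤ (σ (N ^ 2))) step N 2∤N
  where
  step : ∀ N → (∀ {N′} → N′ < N → .{{NonZero N′}} → ¬ 2 ∣ N′ → .{{_ : NonZero (N′ ^ 2)}} → OddMultiple 1ℤ (σ (N′ ^ 2))) →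
    .{{NonZero N}} → ¬ 2 ∣ N → .{{_ : NonZero (N ^ 2)}} → OddMultiple 1ℤ (σ (N ^ 2))
  step N smaller 2∤N with N ℕ.≟ 1
  ... | yes refl = 0ℤ , refl
  ... | no N≢1 with ∃prime-divisor N N≢1
  ...   | p , N₁ , pp , N≡p*N₁ = subst (OddMultiple 1ℤ)
    (sym (≡.trans (σ-cong factorisation) (σ-multiplicative (double exponent) pp (∤-^ rest 2 pp p∤rest))))
    (OddMultiple-* {1ℤ} {1ℤ} (geometric-even exponent (¬2∣⇒Odd λ 2∣p → 2∤N (∣-trans 2∣p p∣N)))
                   (smaller (ℕ.≤∧≢⇒< (∣⇒≤ rest∣N) rest≢N) (λ 2∣rest → 2∤N (∣-trans 2∣rest rest∣N))))
    where
    open SquarePart (squarePart p N pp)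
    p∣N : p ∣ N
    p∣N = divides N₁ (≡.trans N≡p*N₁ (ℕ.*-comm p N₁))
    rest≢N : rest ≢ N
    rest≢N eq = p∤rest (subst (p ∣_) (sym eq) p∣N)
    instance
      rest-nonZero : NonZero rest
      rest-nonZero = rest≢0
      rest²-nonZero : NonZero (rest ^ 2)
      rest²-nonZero = ^2-nonZero rest≢0
      product-nonZero : NonZero (p ^ double exponent * rest ^ 2)
      product-nonZero = *-nonZero (^-nonZero (double exponent) pp) (^2-nonZero rest≢0)

-- From σ to ped₋₂

%-unique : ∀ {m r d} t .{{_ : NonZero d}} → r < d → + m ≡ + r ℤ.+ + d ℤ.* t → m % d ≡ r
%-unique {m} {r} {d} (+ j) r<d eq = begin
  m % d           ≡⟨ cong (_% d) (ℤ.+-injective (≡.trans eq (cong (λ x → + r ℤ.+ x) (sym (ℤ.pos-* d j))))) ⟩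
  (r + d * j) % d ≡⟨ cong (λ x → (r + x) % d) (ℕ.*-comm d j) ⟩
  (r + j * d) % d ≡⟨ [m+kn]%n≡m%n r j d ⟩
  r % d           ≡⟨ m<n⇒m%n≡m r<d ⟩
  r ∎
  where open ≡-Reasoning
-- A negative quotient would mean m + d(j + 1) = r, which contradicts r < d.
%-unique {m} {r} {d} -[1+ j ] r<d eq = contradiction r<d (ℕ.≤⇒≯ (subst (d ≤_) r≡ (ℕ.≤-trans (ℕ.m≤m*n d (suc j)) (ℕ.m≤n+m (d * suc j) m))))
  where
  lemma : ∀ r x → (r ℤ.+ ℤ.- x) ℤ.+ x ≡ r
  lemma = solve-∀
  r≡ : m + d * suc j ≡ r
  r≡ = ℤ.+-injective (≡.trans (cong₂ ℤ._+_ eq (ℤ.pos-* d (suc j)))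
    (≡.trans (cong (λ x → (+ r ℤ.+ x) ℤ.+ + d ℤ.* + suc j) (sym (ℤ.neg-distribʳ-* (+ d) (+ suc j)))) (lemma (+ r) (+ d ℤ.* + suc j))))

sign-cases : ∀ n → sign n ≡ 1ℤ ⊎ sign n ≡ ℤ.- 1ℤ
sign-cases zero    = inj₁ refl
sign-cases (suc n) with sign-cases n
... | inj₁ eq = inj₂ (cong (λ x → ℤ.- x) eq)
... | inj₂ eq = inj₁ (cong (λ x → ℤ.- x) eq)

K : ℕ → ℕ
K n = suc (double (double n))

-- Congruence modulo 8 up to sign: it forgets the factor (-1)ⁿ, on which no outcome of the theorem
-- depends.
data _≡±_ (m : ℕ) (s : ℤ) : Set where
  plus  : ∀ w → + m ≡ s ℤ.+ + 8 ℤ.* w → m ≡± s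
  minus : ∀ w → + m ≡ ℤ.- s ℤ.+ + 8 ℤ.* w → m ≡± s

≡±-sign : ∀ {m s ε w} → ε ≡ 1ℤ ⊎ ε ≡ ℤ.- 1ℤ → s ≡ ε ℤ.* + m ℤ.+ + 8 ℤ.* w → m ≡± s
≡±-sign {m} {w = w} (inj₁ refl) refl = plus (ℤ.- w) (lemma (+ m) w)
  where
  lemma : ∀ p w → p ≡ (1ℤ ℤ.* p ℤ.+ + 8 ℤ.* w) ℤ.+ + 8 ℤ.* (ℤ.- w)
  lemma = solve-∀
≡±-sign {m} {w = w} (inj₂ refl) refl = minus w (lemma (+ m) w)
  where
  lemma : ∀ p w → p ≡ ℤ.- (ℤ.- 1ℤ ℤ.* p ℤ.+ + 8 ℤ.* w) ℤ.+ + 8 ℤ.* w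
  lemma = solve-∀

ped≡±σ : ∀ n → ped₋₂ n ≡± σ (K n)
ped≡±σ n = ≡±-sign (sign-cases n) (proj₂ (σ≡±ped n))

d<2*d : ∀ d → .{{NonZero d}} → d < 2 * d
d<2*d d = subst (d <_) (ℕ.*-comm d 2) (ℕ.m<m*n d 2 (s≤s (s≤s z≤n)))

-- Since -d(1 + 2t) = d + 2d(-1 - t), either sign leads to the class of d. The number e is 8/(2d);
-- it carries the congruence from modulus 8 to modulus 2d.
OddMultiple⇒% : ∀ {m s} d e .{{_ : NonZero d}} .{{_ : NonZero (2 * d)}} → + 8 ≡ + (2 * d) ℤ.* e →
  m ≡± s → OddMultiple (+ d) s → m % (2 * d) ≡ d
OddMultiple⇒% d e 8≡ (plus w eq) (t , refl) = %-unique (t ℤ.+ e ℤ.* w) (d<2*d d) (≡.trans eq (≡.trans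
    (cong (λ x → + d ℤ.* (1ℤ ℤ.+ + 2 ℤ.* t) ℤ.+ x ℤ.* w) 8≡) (lemma (+ d) (+ (2 * d)) e t w (ℤ.pos-* 2 d))))
  where
  lemma : ∀ d D e t w → D ≡ + 2 ℤ.* d → d ℤ.* (1ℤ ℤ.+ + 2 ℤ.* t) ℤ.+ D ℤ.* e ℤ.* w ≡ d ℤ.+ D ℤ.* (t ℤ.+ e ℤ.* w)
  lemma d _ e t w refl = identity d e t w
    where
    identity : ∀ d e t w → d ℤ.* (1ℤ ℤ.+ + 2 ℤ.* t) ℤ.+ + 2 ℤ.* d ℤ.* e ℤ.* w ≡ d ℤ.+ + 2 ℤ.* d ℤ.* (t ℤ.+ e ℤ.* w)
    identity = solve-∀
OddMultiple⇒% d e 8≡ (minus w eq) (t , refl) = %-unique (ℤ.- 1ℤ ℤ.- t ℤ.+ e ℤ.* w) (d<2*d d) (≡.trans eq (≡.trans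
    (cong (λ x → ℤ.- (+ d ℤ.* (1ℤ ℤ.+ + 2 ℤ.* t)) ℤ.+ x ℤ.* w) 8≡) (lemma (+ d) (+ (2 * d)) e t w (ℤ.pos-* 2 d))))
  where
  lemma : ∀ d D e t w → D ≡ + 2 ℤ.* d →
    ℤ.- (d ℤ.* (1ℤ ℤ.+ + 2 ℤ.* t)) ℤ.+ D ℤ.* e ℤ.* w ≡ d ℤ.+ D ℤ.* (ℤ.- 1ℤ ℤ.- t ℤ.+ e ℤ.* w)
  lemma d _ e t w refl = identity d e t w
    where
    identity : ∀ d e t w → ℤ.- (d ℤ.* (1ℤ ℤ.+ + 2 ℤ.* t)) ℤ.+ + 2 ℤ.* d ℤ.* e ℤ.* w ≡
      d ℤ.+ + 2 ℤ.* d ℤ.* (ℤ.- 1ℤ ℤ.- t ℤ.+ e ℤ.* w)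
    identity = solve-∀

Multiple⇒% : ∀ {m s} → m ≡± s → Multiple (+ 8) s → m % 8 ≡ 0
Multiple⇒% (plus w eq) (t , refl) = %-unique (t ℤ.+ w) (s≤s z≤n) (≡.trans eq (lemma t w))
  where
  lemma : ∀ t w → + 8 ℤ.* t ℤ.+ + 8 ℤ.* w ≡ 0ℤ ℤ.+ + 8 ℤ.* (t ℤ.+ w)
  lemma = solve-∀
Multiple⇒% (minus w eq) (t , refl) = %-unique (w ℤ.- t) (s≤s z≤n) (≡.trans eq (lemma t w))
  where
  lemma : ∀ t w → ℤ.- (+ 8 ℤ.* t) ℤ.+ + 8 ℤ.* w ≡ 0ℤ ℤ.+ + 8 ℤ.* (w ℤ.- t)
  lemma = solve-∀

odd%4 : ∀ c → suc (double c) % 4 ≡ 1 ⊎ suc (double c) % 4 ≡ 3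
odd%4 zero          = inj₁ refl
odd%4 (suc zero)    = inj₂ refl
odd%4 (suc (suc c)) = subst (λ r → r ≡ 1 ⊎ r ≡ 3) (sym (≡.trans (cong (_% 4) (ℕ.+-comm 4 (suc (double c)))) ([m+kn]%n≡m%n (suc (double c)) 1 4))) (odd%4 c)

odd%8 : ∀ c → suc (double c) % 4 ≡ 1 ⊎ suc (double c) % 8 ≡ 3 ⊎ suc (double c) % 8 ≡ 7
odd%8 zero                      = inj₁ refl
odd%8 (suc zero)                = inj₂ (inj₁ refl)
odd%8 (suc (suc zero))          = inj₁ refl
odd%8 (suc (suc (suc zero)))    = inj₂ (inj₂ refl)
odd%8 (suc (suc (suc (suc c)))) = ≡.subst₂ (λ r s → r ≡ 1 ⊎ s ≡ 3 ⊎ s ≡ 7)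
  (sym (≡.trans (cong (_% 4) (ℕ.+-comm 8 (suc (double c)))) ([m+kn]%n≡m%n (suc (double c)) 2 4)))
  (sym (≡.trans (cong (_% 8) (ℕ.+-comm 8 (suc (double c)))) ([m+kn]%n≡m%n (suc (double c)) 1 8)))
  (odd%8 c)

K≡ : ∀ n → 4 * n + 1 ≡ K n
K≡ n = ≡.trans (lemma n) (cong suc (sym (≡.trans (double≡ (double n)) (cong₂ _+_ (double≡ n) (double≡ n)))))
  where
  lemma : ∀ n → 4 * n + 1 ≡ suc ((n + n) + (n + n))
  lemma = ℕ-Solver.solve-∀

-- Case analysis on the prime factors of M

module Representation (n N M : ℕ) (N≢0 : NonZero N) (M≢0 : NonZero M) (k≡ : 4 * n + 1 ≡ N ^ 2 * M) where

  K≡N²M : K n ≡ N ^ 2 * M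
  K≡N²M = ≡.trans (sym (K≡ n)) k≡

  ∣K⇒odd : ∀ {d} → d ∣ N ^ 2 * M → ¬ 2 ∣ d
  ∣K⇒odd {d} d∣ 2∣d = 2∤suc-double (double n) (∣-trans 2∣d (subst (d ∣_) (sym K≡N²M) d∣))

  M∣ : M ∣ N ^ 2 * M
  M∣ = n∣m*n (N ^ 2)

  N-odd : ¬ 2 ∣ N
  N-odd = ∣K⇒odd (∣m⇒∣m*n M (divides (N * 1) (ℕ.*-comm N (N * 1))))

  M-odd : ¬ 2 ∣ M
  M-odd = ∣K⇒odd M∣

  ord≡ : ∀ {p} a m → Prime p → 4 * n + 1 ≡ p ^ a * m → ¬ p ∣ m → ord p (4 * n + 1) ≡ a
  ord≡ a m pp eq = ord-unique a m pp {{ℕ.≢-nonZero λ eq → ℕ.1+n≢0 (≡.trans (ℕ.+-comm 1 (4 * n)) eq)}} eq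

  -- N is odd, so N² ≡ 1 (mod 4). For prime M this supplies the condition p ≡ 1 (mod 4) behind the
  -- residues in cases 2 and 3.
  M%4≡1 : M % 4 ≡ 1
  M%4≡1 = begin
    M % 4                              ≡⟨ [m+kn]%n≡m%n M ((u * u + u) * M) 4 ⟨
    (M + (u * u + u) * M * 4) % 4      ≡⟨ cong (_% 4) (lemma u M) ⟩
    ((1 + 2 * u) ^ 2 * M) % 4          ≡⟨ cong (λ m → (m ^ 2 * M) % 4) (proj₂ N-odd′) ⟨
    (N ^ 2 * M) % 4                    ≡⟨ cong (_% 4) k≡ ⟨
    (4 * n + 1) % 4                    ≡⟨ cong (_% 4) (lemma′ n) ⟩
    (1 + n * 4) % 4                    ≡⟨ [m+kn]%n≡m%n 1 n 4 ⟩
    1 ∎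
    where
    open ≡-Reasoning
    N-odd′ = ¬2∣⇒Odd N-odd
    u = proj₁ N-odd′
    lemma : ∀ u M → M + (u * u + u) * M * 4 ≡ (1 + 2 * u) * ((1 + 2 * u) * 1) * M
    lemma = ℕ-Solver.solve-∀
    lemma′ : ∀ n → 4 * n + 1 ≡ 1 + n * 4
    lemma′ = ℕ-Solver.solve-∀

σ-square*1 : ∀ {N} → (N≢0 : NonZero N) → ¬ 2 ∣ N → .{{_ : NonZero (N ^ 2 * 1)}} → OddMultiple 1ℤ (σ (N ^ 2 * 1))
σ-square*1 {N} N≢0 2∤N = subst (OddMultiple 1ℤ) (σ-cong (sym (ℕ.*-identityʳ (N ^ 2)))) (σ-square N 2∤N)
  where
  instance
    N-nonZero = N≢0
    N²-nonZero : NonZero (N ^ 2)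
    N²-nonZero = ^2-nonZero N≢0

σ-square-case : ∀ {n N} → NonZero N → 4 * n + 1 ≡ N ^ 2 * 1 → OddMultiple 1ℤ (σ (K n))
σ-square-case {n} {N} N≢0 k≡ = subst (OddMultiple 1ℤ) (σ-cong (sym K≡N²M)) (σ-square*1 N≢0 N-odd)
  where
  open Representation n N 1 N≢0 _ k≡
  instance
    N²*1-nonZero : NonZero (N ^ 2 * 1)
    N²*1-nonZero = *-nonZero (^2-nonZero N≢0) _

module OnePrime (n N p M : ℕ) (N≢0 : NonZero N) (pp : Prime p) (M≢0 : NonZero M) (p∤M : ¬ p ∣ M)
  (k≡ : 4 * n + 1 ≡ N ^ 2 * (p * M)) where

  open Representation n N (p * M) N≢0 (*-nonZero (prime⇒nonZero pp) M≢0) k≡ public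
  module P = Peel {p} {N} M pp N≢0 M≢0 p∤M

  p-odd : Odd p
  p-odd = ¬2∣⇒Odd λ 2∣p → M-odd (∣-trans 2∣p (m∣m*n M))

  module Residues = GeometricResidues {p} p-odd

  rest-odd : ¬ 2 ∣ P.rest
  rest-odd 2∣rest = N-odd (∣-trans 2∣rest P.rest∣N)

  instance
    cofactor-nonZero : NonZero P.cofactor
    cofactor-nonZero = P.cofactor≢0

  σ≡ : σ (K n) ≡ geometric p P.p-exponent ℤ.* σ P.cofactor
  σ≡ = P.σ-peeled K≡N²M

  ord-p : ord p (4 * n + 1) ≡ P.p-exponent
  ord-p = ord≡ P.p-exponent P.cofactor pp (≡.trans k≡ P.peeled) P.p∤cofactor

-- The second prime is peeled from the cofactor that the first one leaves, with `P.rest` in the role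
-- of N.
module TwoPrimes (n N p₁ p₂ M : ℕ) (N≢0 : NonZero N) (pp₁ : Prime p₁) (pp₂ : Prime p₂) (M≢0 : NonZero M)
  (p₁∤p₂M : ¬ p₁ ∣ p₂ * M) (p₂∤M : ¬ p₂ ∣ M) (k≡ : 4 * n + 1 ≡ N ^ 2 * (p₁ * (p₂ * M))) where

  open OnePrime n N p₁ (p₂ * M) N≢0 pp₁ (*-nonZero (prime⇒nonZero pp₂) M≢0) p₁∤p₂M k≡ public
  module P₂ = Peel {p₂} {P.rest} M pp₂ P.rest≢0 M≢0 p₂∤M

  p₂-odd : Odd p₂
  p₂-odd = ¬2∣⇒Odd λ 2∣p₂ → M-odd (∣-trans 2∣p₂ (∣n⇒∣m*n p₁ (m∣m*n M)))

  module Residues₂ = GeometricResidues {p₂} p₂-odd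

  rest₂-odd : ¬ 2 ∣ P₂.rest
  rest₂-odd 2∣rest = rest-odd (∣-trans 2∣rest P₂.rest∣N)

  instance
    cofactor₂-nonZero : NonZero P₂.cofactor
    cofactor₂-nonZero = P₂.cofactor≢0

  σ≡₂ : σ (K n) ≡ geometric p₁ P.p-exponent ℤ.* (geometric p₂ P₂.p-exponent ℤ.* σ P₂.cofactor)
  σ≡₂ = ≡.trans σ≡ (cong (ℤ._*_ (geometric p₁ P.p-exponent)) (P₂.σ-peeled refl))

  p₂∤p₁ : ¬ p₂ ∣ p₁
  p₂∤p₁ = ∤-prime pp₂ pp₁ λ { refl → p₁∤p₂M (m∣m*n M) }

  ord-p₂ : ord p₂ (4 * n + 1) ≡ P₂.p-exponent
  ord-p₂ = ord≡ P₂.p-exponent (p₁ ^ P.p-exponent * P₂.cofactor) pp₂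
    (≡.trans k≡ (≡.trans P.peeled (≡.trans (cong (p₁ ^ P.p-exponent *_) P₂.peeled)
      (lemma (p₁ ^ P.p-exponent) (p₂ ^ P₂.p-exponent) P₂.cofactor))))
    (∤-* (p₁ ^ P.p-exponent) P₂.cofactor pp₂ (∤-^ p₁ P.p-exponent pp₂ p₂∤p₁) P₂.p∤cofactor)
    where
    lemma : ∀ x y z → x * (y * z) ≡ y * (x * z)
    lemma = ℕ-Solver.solve-∀

Multiple-8 : ∀ {x y z} → Multiple (+ 2) x → Multiple (+ 2) y → Multiple (+ 4) x ⊎ Multiple (+ 4) y →
  Multiple (+ 8) (x ℤ.* (y ℤ.* z))
Multiple-8 {x} {y} {z} 2∣x 2∣y (inj₁ 4∣x) = Multiple-* {+ 4} {+ 2} {x} {y ℤ.* z} 4∣x (Multiple-* {+ 2} {1ℤ} {y} {z} 2∣y (Multiple-1 z))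
Multiple-8 {x} {y} {z} 2∣x 2∣y (inj₂ 4∣y) = Multiple-* {+ 2} {+ 4} {x} {y ℤ.* z} 2∣x (Multiple-* {+ 4} {1ℤ} {y} {z} 4∣y (Multiple-1 z))

module _ {n N : ℕ} (N≢0 : NonZero N) where

  private
    ped≡ : ∀ {d} e .{{_ : NonZero d}} .{{_ : NonZero (2 * d)}} → + 8 ≡ + (2 * d) ℤ.* e →
      OddMultiple (+ d) (σ (K n)) → ped₋₂ n % (2 * d) ≡ d
    ped≡ {d} e 8≡ = OddMultiple⇒% d e 8≡ (ped≡±σ n)

  module OnePrimeOnly {p} (pp : Prime p) (k≡ : 4 * n + 1 ≡ N ^ 2 * p) where
    private
      module One = OnePrime n N p 1 N≢0 pp _ (∤-1 pp) (≡.trans k≡ (cong (N ^ 2 *_) (sym (ℕ.*-identityʳ p))))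
    open One

    p%4≡1 : p % 4 ≡ 1
    p%4≡1 = ≡.trans (cong (_% 4) (sym (ℕ.*-identityʳ p))) M%4≡1

    σ-rest : OddMultiple 1ℤ (σ P.cofactor)
    σ-rest = σ-square*1 P.rest≢0 rest-odd

    case₂ : ord p (4 * n + 1) % 4 ≡ 1 → ped₋₂ n % 4 ≡ 2
    case₂ ord%4≡1 = ped≡ (+ 2) refl (subst (OddMultiple (+ 2)) (sym σ≡)
      (OddMultiple-* {+ 2} {1ℤ} (Residues.geometric-1%4 P.exponent p%4≡1 (≡.trans (cong (_% 4) (sym ord-p)) ord%4≡1)) σ-rest))

    case₃ : ord p (4 * n + 1) % 8 ≡ 3 → ped₋₂ n % 8 ≡ 4
    case₃ ord%8≡3 = ped≡ (+ 1) refl (subst (OddMultiple (+ 4)) (sym σ≡)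
      (OddMultiple-* {+ 4} {1ℤ} (Residues.geometric-3%8 P.exponent p%4≡1 (≡.trans (cong (_% 8) (sym ord-p)) ord%8≡3)) σ-rest))

    otherwise : ord p (4 * n + 1) % 4 ≢ 1 → ord p (4 * n + 1) % 8 ≢ 3 → Multiple (+ 8) (σ (K n))
    otherwise ord%4≢1 ord%8≢3 with odd%8 P.exponent
    ... | inj₁ eq        = contradiction (≡.trans (cong (_% 4) ord-p) eq) ord%4≢1
    ... | inj₂ (inj₁ eq) = contradiction (≡.trans (cong (_% 8) ord-p) eq) ord%8≢3
    ... | inj₂ (inj₂ eq) = subst (Multiple (+ 8)) (sym σ≡)
      (Multiple-* {+ 8} {1ℤ} (Residues.geometric-7%8 P.exponent eq) (Multiple-1 _))

  module TwoPrimesOnly {p₁ p₂} (pp₁ : Prime p₁) (pp₂ : Prime p₂) (p₁≢p₂ : p₁ ≢ p₂) (k≡ : 4 * n + 1 ≡ N ^ 2 * (p₁ * p₂)) where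
    private
      module Two = TwoPrimes n N p₁ p₂ 1 N≢0 pp₁ pp₂ _
        (∤-* p₂ 1 pp₁ (∤-prime pp₁ pp₂ p₁≢p₂) (∤-1 pp₁)) (∤-1 pp₂)
        (≡.trans k≡ (cong (λ x → N ^ 2 * (p₁ * x)) (sym (ℕ.*-identityʳ p₂))))
    open Two

    case₄ : p₁ % 4 ≡ 1 → p₂ % 4 ≡ 1 → ord p₁ (4 * n + 1) % 4 ≡ 1 → ord p₂ (4 * n + 1) % 4 ≡ 1 → ped₋₂ n % 8 ≡ 4
    case₄ p₁%4≡1 p₂%4≡1 ord₁ ord₂ = ped≡ (+ 1) refl (subst (OddMultiple (+ 4)) (sym σ≡₂)
      (OddMultiple-* {+ 2} {+ 2} (Residues.geometric-1%4 P.exponent p₁%4≡1 (≡.trans (cong (_% 4) (sym ord-p)) ord₁))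
        (OddMultiple-* {+ 2} {1ℤ} (Residues₂.geometric-1%4 P₂.exponent p₂%4≡1 (≡.trans (cong (_% 4) (sym ord-p₂)) ord₂))
          (σ-square*1 P₂.rest≢0 rest₂-odd))))

    otherwise : ¬ (p₁ % 4 ≡ 1 × p₂ % 4 ≡ 1 × ord p₁ (4 * n + 1) % 4 ≡ 1 × ord p₂ (4 * n + 1) % 4 ≡ 1) →
      Multiple (+ 8) (σ (K n))
    otherwise ¬case₄ = subst (Multiple (+ 8)) (sym σ≡₂) (Multiple-8 (Residues.geometric-2 P.exponent) (Residues₂.geometric-2 P₂.exponent)
      (cases (p%4 p-odd) (p%4 p₂-odd) (odd%4 P.exponent) (odd%4 P₂.exponent)))
      where
      p%4 : ∀ {p} → Odd p → p % 4 ≡ 1 ⊎ p % 4 ≡ 3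
      p%4 (r , refl) = subst (λ d → suc d % 4 ≡ 1 ⊎ suc d % 4 ≡ 3) (≡.trans (double≡ r) (lemma r)) (odd%4 r)
        where
        lemma : ∀ r → r + r ≡ 2 * r
        lemma = ℕ-Solver.solve-∀

      cases : p₁ % 4 ≡ 1 ⊎ p₁ % 4 ≡ 3 → p₂ % 4 ≡ 1 ⊎ p₂ % 4 ≡ 3 →
        P.p-exponent % 4 ≡ 1 ⊎ P.p-exponent % 4 ≡ 3 → P₂.p-exponent % 4 ≡ 1 ⊎ P₂.p-exponent % 4 ≡ 3 →
        Multiple (+ 4) (geometric p₁ P.p-exponent) ⊎ Multiple (+ 4) (geometric p₂ P₂.p-exponent)
      -- Each prime contributes a factor 2; a failed condition raises one of the two to a factor 4,
      -- which makes 8 in all.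
      cases (inj₂ p₁≡3) _ _ _ = inj₁ (Residues.geometric-p%4≡3 P.exponent p₁≡3)
      cases (inj₁ _) (inj₂ p₂≡3) _ _ = inj₂ (Residues₂.geometric-p%4≡3 P₂.exponent p₂≡3)
      cases (inj₁ _) (inj₁ _) (inj₂ a₁≡3) _ = inj₁ (Residues.geometric-3%4 P.exponent a₁≡3)
      cases (inj₁ _) (inj₁ _) (inj₁ _) (inj₂ a₂≡3) = inj₂ (Residues₂.geometric-3%4 P₂.exponent a₂≡3)
      cases (inj₁ p₁≡1) (inj₁ p₂≡1) (inj₁ a₁≡1) (inj₁ a₂≡1) = ⊥-elim (¬case₄
        (p₁≡1 , p₂≡1 , ≡.trans (cong (_% 4) ord-p) a₁≡1 , ≡.trans (cong (_% 4) ord-p₂) a₂≡1))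

  -- Three odd exponents yield three factors 2. Further primes may remain in `M`; their contribution
  -- is not examined.
  threePrimes : ∀ {p₁ p₂ p₃ M} → Prime p₁ → Prime p₂ → Prime p₃ → NonZero M →
    ¬ p₁ ∣ p₂ * (p₃ * M) → ¬ p₂ ∣ p₃ * M → ¬ p₃ ∣ M →
    4 * n + 1 ≡ N ^ 2 * (p₁ * (p₂ * (p₃ * M))) → Multiple (+ 8) (σ (K n))
  threePrimes {p₁} {p₂} {p₃} {M} pp₁ pp₂ pp₃ M≢0 p₁∤ p₂∤ p₃∤ k≡ = subst (Multiple (+ 8)) (sym σ≡₃)
    (Multiple-* {+ 2} {+ 4} (Residues.geometric-2 P.exponent)
      (Multiple-* {+ 2} {+ 2} (Residues₂.geometric-2 P₂.exponent)
        (Multiple-* {+ 2} {1ℤ} (GeometricResidues.geometric-2 p₃-odd P₃.exponent) (Multiple-1 _))))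
    where
    open TwoPrimes n N p₁ p₂ (p₃ * M) N≢0 pp₁ pp₂ (*-nonZero (prime⇒nonZero pp₃) M≢0) p₁∤ p₂∤ k≡
    module P₃ = Peel {p₃} {P₂.rest} M pp₃ P₂.rest≢0 M≢0 p₃∤

    p₃-odd : Odd p₃
    p₃-odd = ¬2∣⇒Odd λ 2∣p₃ → M-odd (∣-trans 2∣p₃ (∣n⇒∣m*n p₁ (∣n⇒∣m*n p₂ (m∣m*n M))))

    instance
      cofactor₃-nonZero : NonZero P₃.cofactor
      cofactor₃-nonZero = P₃.cofactor≢0

    σ≡₃ : σ (K n) ≡ geometric p₁ P.p-exponent ℤ.* (geometric p₂ P₂.p-exponent ℤ.* (geometric p₃ P₃.p-exponent ℤ.* σ P₃.cofactor))
    σ≡₃ = ≡.trans σ≡₂ (cong (λ x → geometric p₁ P.p-exponent ℤ.* (geometric p₂ P₂.p-exponent ℤ.* x)) (P₃.σ-peeled refl))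

SquareFree-∣ : ∀ {m n} → m ∣ n → SquareFree n → SquareFree m
SquareFree-∣ m∣n square-free d dd∣m = square-free d (∣-trans dd∣m m∣n)

SquareFree-∤ : ∀ {p m} → Prime p → SquareFree (p * m) → ¬ p ∣ m
SquareFree-∤ {p} {m} pp square-free p∣m = prime≢1 pp (square-free p (*-monoʳ-∣ p p∣m))

-- The number of primes in M decides. None is case 1; one or two leave the failed conditions of
-- cases 2 to 4; three or more give 8 at once. Square-freeness makes the primes distinct.
σ-otherwise : ∀ {n N M} → NonZero N → NonZero M → 4 * n + 1 ≡ N ^ 2 * M → SquareFree M →
  ¬ Case₁ M → ¬ Case₂ n M → ¬ Case₃ n M → ¬ Case₄ n M → Multiple (+ 8) (σ (K n))
σ-otherwise {n} {N} {M} N≢0 M≢0 k≡ sf ¬1 ¬2 ¬3 ¬4 with ∃prime-divisor M {{M≢0}} ¬1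
... | p₁ , M₁ , pp₁ , refl with M₁ ℕ.≟ 1
...   | yes refl = subst (λ p → ¬ Case₂ n p → ¬ Case₃ n p → 4 * n + 1 ≡ N ^ 2 * p → Multiple (+ 8) (σ (K n))) (sym (ℕ.*-identityʳ p₁))
        (λ ¬2 ¬3 k≡ → OnePrimeOnly.otherwise {n} N≢0 pp₁ k≡ (λ eq → ¬2 (pp₁ , eq)) (λ eq → ¬3 (pp₁ , eq))) ¬2 ¬3 k≡
...   | no M₁≢1 with ∃prime-divisor M₁ {{proj₂ (nonZero-factors p₁ M₁ M≢0)}} M₁≢1
...     | p₂ , M₂ , pp₂ , refl with M₂ ℕ.≟ 1
...       | yes refl = TwoPrimesOnly.otherwise {n} N≢0 pp₁ pp₂ p₁≢p₂ (≡.trans k≡ (cong (λ x → N ^ 2 * (p₁ * x)) (ℕ.*-identityʳ p₂)))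
            (λ (e₁ , e₂ , o₁ , o₂) → ¬4 (p₁ , p₂ , pp₁ , pp₂ , p₁≢p₂ , cong (p₁ *_) (ℕ.*-identityʳ p₂) , e₁ , e₂ , o₁ , o₂))
            where
            p₁≢p₂ : p₁ ≢ p₂
            p₁≢p₂ refl = SquareFree-∤ pp₁ sf (m∣m*n 1)
...       | no M₂≢1 with ∃prime-divisor M₂ {{M₂≢0}} M₂≢1
            where
            M₂≢0 : NonZero M₂
            M₂≢0 = proj₂ (nonZero-factors p₂ M₂ (proj₂ (nonZero-factors p₁ (p₂ * M₂) M≢0)))
...         | p₃ , M₃ , pp₃ , refl = threePrimes {n} N≢0 pp₁ pp₂ pp₃ M₃≢0
              (SquareFree-∤ pp₁ sf) (SquareFree-∤ pp₂ sf₁) (SquareFree-∤ pp₃ (SquareFree-∣ (n∣m*n p₂) sf₁)) k≡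
              where
              M₃≢0 : NonZero M₃
              M₃≢0 = proj₂ (nonZero-factors p₃ M₃ (proj₂ (nonZero-factors p₂ (p₃ * M₃) (proj₂ (nonZero-factors p₁ (p₂ * (p₃ * M₃)) M≢0)))))
              sf₁ : SquareFree (p₂ * (p₃ * M₃))
              sf₁ = SquareFree-∣ (n∣m*n p₁) sf

theorem1p6 : ∀ (n N M : ℕ) → NonZero N → NonZero M →
    4 * n + 1 ≡ N ^ 2 * M → SquareFree M →
    (Case₁ M → ped₋₂ n % 2 ≡ 1) ×
    (Case₂ n M → ped₋₂ n % 4 ≡ 2) ×
    (Case₃ n M → ped₋₂ n % 8 ≡ 4) ×
    (Case₄ n M → ped₋₂ n % 8 ≡ 4) ×
    (¬ Case₁ M → ¬ Case₂ n M → ¬ Case₃ n M → ¬ Case₄ n M → ped₋₂ n % 8 ≡ 0)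
theorem1p6 n N M N≢0 M≢0 k≡ square-free =
  (λ { refl → OddMultiple⇒% 1 (+ 4) refl (ped≡±σ n) (σ-square-case {n} N≢0 k≡) }) ,
  (λ (pp , ord%4) → OnePrimeOnly.case₂ {n} N≢0 pp k≡ ord%4) ,
  (λ (pp , ord%8) → OnePrimeOnly.case₃ {n} N≢0 pp k≡ ord%8) ,
  (λ { (_ , _ , pp₁ , pp₂ , p₁≢p₂ , refl , e₁ , e₂ , o₁ , o₂) → TwoPrimesOnly.case₄ {n} N≢0 pp₁ pp₂ p₁≢p₂ k≡ e₁ e₂ o₁ o₂ }) ,
  (λ ¬1 ¬2 ¬3 ¬4 → Multiple⇒% (ped≡±σ n) (σ-otherwise {n} N≢0 M≢0 k≡ square-free ¬1 ¬2 ¬3 ¬4))
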